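{- Let $k\ge 3$ be an odd integer and let $G$ be a finite group of even order with $\gcd(k,|G|)=1$. Then there are infinitely many integers $v$ for which there exists a $2$-$(v,k,1)$-design whose automorphism group has a subgroup isomorphic to $G$.
   Context: A $2$-$(v,k,1)$-design consists of a set of $v$ points together with a collection of $k$-element subsets of the points (called blocks) such that any two distinct points lie in exactly one block. An automorphism is a permutation of the points mapping the set of blocks onto itself. -}

module Defs where

open import Level using (Level; _⊔_)
open import Data.Nat using (ℕ; _≤_)
open import Data.Nat.Divisibility using (_∣_)
open import Data.Nat.GCD using (gcd)
open import Data.Fin using (Fin)
open import Data.Fin.Subset using (Subset; ∣_∣) renaming (_∈_ to _∈ₛ_)
open import Data.Fin.Permutation using (Permutation′; _⟨$⟩ʳ_; _⟨$⟩ˡ_)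
open import Data.Vec using (lookup; tabulate)
open import Data.List using (List)
open import Data.List.Membership.Propositional using (_∈_)
open import Data.Product using (Σ; ∃; ∃-syntax; _×_; _,_)
open import Relation.Binary.PropositionalEquality using (_≡_; _≢_)
open import Relation.Nullary using (¬_)
open import Algebra.Bundles using (Group)

-- A 2-(v,k,1) design on the point set Fin v.  The set of blocks is the set
-- of members of the list 'blocks' (repetitions in the list are irrelevant).
record Design (v k : ℕ) : Set where
  field
    blocks     : List (Subset v)
    blockSize  : ∀ {B} → B ∈ blocks → ∣ B ∣ ≡ k
    covered    : ∀ (x y : Fin v) → x ≢ y →
                 ∃[ B ] (B ∈ blocks × x ∈ₛ B × y ∈ₛ B)
    uniqueBlk  : ∀ (x y : Fin v) → x ≢ y → ∀ {B B′} →
                 B ∈ blocks → x ∈ₛ B → y ∈ₛ B →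
                 B′ ∈ blocks → x ∈ₛ B′ → y ∈ₛ B′ → B ≡ B′

open Design public

image : ∀ {v} → Permutation′ v → Subset v → Subset v
image σ B = tabulate (λ y → lookup B (σ ⟨$⟩ˡ y))

IsAutomorphism : ∀ {v k} → Design v k → Permutation′ v → Set
IsAutomorphism D σ =
  (∀ {B} → B ∈ blocks D → image σ B ∈ blocks D) ×
  (∀ {B} → B ∈ blocks D → ∃[ B′ ] (B′ ∈ blocks D × image σ B′ ≡ B))

record HasOrder {c ℓ : Level} (G : Group c ℓ) (n : ℕ) : Set (c ⊔ ℓ) where
  open Group G
  field
    enum      : Fin n → Carrier
    enum-inj  : ∀ i j → enum i ≈ enum j → i ≡ j
    enum-surj : ∀ g → ∃[ i ] (enum i ≈ g)

record EmbedsInAut {c ℓ : Level} (G : Group c ℓ) {v k : ℕ} (D : Design v k)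
       : Set (c ⊔ ℓ) where
  open Group G
  field
    ρ        : Carrier → Permutation′ v
    ρ-aut    : ∀ g → IsAutomorphism D (ρ g)
    ρ-cong   : ∀ {g h} → g ≈ h → ∀ x → ρ g ⟨$⟩ʳ x ≡ ρ h ⟨$⟩ʳ x
    ρ-hom    : ∀ g h x → ρ (g ∙ h) ⟨$⟩ʳ x ≡ ρ g ⟨$⟩ʳ (ρ h ⟨$⟩ʳ x)
    ρ-inj    : ∀ g h → (∀ x → ρ g ⟨$⟩ʳ x ≡ ρ h ⟨$⟩ʳ x) → g ≈ h

module Submission where

-- Let k = 2r + 1.  For suitable primes Q and p, the group G permutes the coordinates of V = F_pⁿ regularly, and it
-- acts on the point set F_Q × V through V.  Blocks of three kinds are used.
--   * level: B × {a}, for B in a 2-(Q,k,1) design on F_Q coming from a difference family (Wilson).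
--   * starter: {(w + u z, a + b d)}, for (z , b) in a fixed set of k positions (0 , 0) and (zᵢ , ±cᵢ), 1 ≤ i ≤ r.
--     They cover the pairs inside a column {w} × V and some pairs (z , x), (z′ , x′) with z ≠ z′ and x ≠ x′.
--   * transverse: {(Bᵢ , a + bᵢ d)}, with B = {B₁, …, B_k} a block of the design on F_Q, for all remaining pairs.
-- With E = r (Q - 1) and f = (p - 1) / E, the map χ x = xᶠ extends to a G-invariant χ̂ on V \ {0} with
-- χ̂ (s d) = χ s · χ̂ d, and F_Q* embeds into the E-th roots of unity of F_p by a homomorphism λ.  Requiring
-- χ̂ d = λ u in the starter blocks, whether a pair is covered by one depends only on the class
-- χ̂ (x′ - x) / λ (z′ - z); a greedy choice of the cᵢ makes the classes covered by the different pairs of positions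
-- distinct.  Each remaining class is realised by transverse blocks in which the χ (bⱼ - bᵢ) are prescribed.
-- Elements of a large F_p whose differences lie in prescribed classes are found one at a time by a second-moment
-- argument; they also give the difference family.  Finally, primes that are 1 modulo M are found among the prime
-- divisors of M^K - 1 for K a power of M.

-- The obstacle is that an element of G may send a direction d to a multiple t d, so G does not act
-- freely on the candidates for d and a condition on d must not notice such factors. Some power of t
-- with exponent at most n is 1; hence tᶠ = 1 as soon as n! divides f, and `χ̂` becomes well
-- defined. The value of E comes from the pairs inside a column. The positions (zᵢ , ±cᵢ) produce
-- the difference 2 cᵢ d, of class χ(2) χ(cᵢ) λ(u). Every E-th root of unity has to be χ(cᵢ) λ(u)
-- for exactly one i and one u, which forces E = r (Q - 1), with the χ(cᵢ) representing the r cosets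
-- of the image of λ. For a pair joining two columns, λ(u) cancels in χ̂ (x′ - x) / λ (z′ - z), so
-- the class is determined by the two positions alone. Each class is thus covered by starter blocks
-- entirely or not at all, and the transverse blocks have to supply whole classes. A starter block
-- is unchanged when d becomes -d; therefore f is even, and positions are only separated up to a
-- common sign. The prime Q is fixed before p, because the size required of p depends on E.

-- Finite fields and a ring solver for them.

module FiniteFields where

  open import Level using (0ℓ)
  open import Algebra using (CommutativeRing; Op₁; Op₂)
  open import Algebra.Structures using (IsCommutativeRing)
  open import Data.Nat as ℕ using (ℕ; suc)
  open import Data.Fin using (Fin)
  open import Data.Maybe using (Maybe; just; nothing)
  open import Data.Product using (_×_; _,_)
  open import Relation.Nullary using (yes; no)
  open import Relation.Binary.PropositionalEquality
  import Algebra.Solver.Ring as RingSolver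
  import Algebra.Properties.Semiring.Mult as Mult
  import Algebra.Properties.Ring as RingProps
  open import Algebra.Solver.Ring.AlmostCommutativeRing

  -- With `Fin q` itself as carrier, elements have decidable equality, the laws hold up to `_≡_`,
  -- and solutions of equations can be counted by sums over `Fin q`. The inverse is a total function
  -- whose value at `0#` is left open.
  record FiniteField (q : ℕ) : Set where
    infixl 7 _*_
    infixl 6 _+_
    infix 8 -_
    field
      _+_ _*_           : Op₂ (Fin q)
      -_                : Op₁ (Fin q)
      0# 1#             : Fin q
      isCommutativeRing : IsCommutativeRing _≡_ _+_ _*_ -_ 0# 1#
      1≢0               : 1# ≢ 0#
      _⁻¹               : Op₁ (Fin q)
      ⁻¹-inverseʳ       : ∀ x → x ≢ 0# → x * x ⁻¹ ≡ 1#

    commutativeRing : CommutativeRing 0ℓ 0ℓ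
    commutativeRing = record { isCommutativeRing = isCommutativeRing }

    open CommutativeRing commutativeRing public
      using (+-assoc; +-comm; +-identityˡ; +-identityʳ; *-assoc; *-comm; *-identityˡ; *-identityʳ;
             distribˡ; distribʳ; zeroˡ; zeroʳ; -‿inverseʳ; -‿inverseˡ; ring; semiring;
             *-commutativeMonoid; _-_)

    open Mult semiring using (×-homo-+; ×1-homo-*) renaming (_×_ to _·_)
    open RingProps ring public using (-0#≈0#; -‿involutive; -‿distribˡ-*; -‿distribʳ-*; -‿+-comm)

    -- The coefficient (m , n) stands for the integer m - n.
    module Solver where
      acr : AlmostCommutativeRing 0ℓ 0ℓ
      acr = fromCommutativeRing commutativeRing

      open import Algebra.Bundles.Raw using (RawRing)
      coeff : RawRing 0ℓ 0ℓ
      coeff = record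
        { Carrier = ℕ Data.Product.× ℕ
        ; _≈_ = _≡_
        ; _+_ = λ (a , b) (c , d) → a ℕ.+ c , b ℕ.+ d
        ; _*_ = λ (a , b) (c , d) → a ℕ.* c ℕ.+ b ℕ.* d , a ℕ.* d ℕ.+ b ℕ.* c
        ; -_ = λ (a , b) → b , a
        ; 0# = 0 , 0
        ; 1# = 1 , 0
        }

      ⟦_⟧ᵣ : ℕ Data.Product.× ℕ → Fin q
      ⟦ a , b ⟧ᵣ = (a · 1#) - (b · 1#)

      -- Agrees with ⟦_⟧ᵣ, but makes con (0 , 0) and con (1 , 0) definitionally 0# and 1#.
      ⟦_⟧c : ℕ Data.Product.× ℕ → Fin q
      ⟦ 0 , 0 ⟧c = 0#
      ⟦ 1 , 0 ⟧c = 1#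
      ⟦ x ⟧c = ⟦ x ⟧ᵣ

      private
        open import Algebra.Properties.CommutativeSemigroup
          (CommutativeRing.+-commutativeSemigroup commutativeRing) using (interchange)
        open ≡-Reasoning

        +-homo : ∀ x y → ⟦ RawRing._+_ coeff x y ⟧ᵣ ≡ ⟦ x ⟧ᵣ + ⟦ y ⟧ᵣ
        +-homo (a , b) (c , d) = begin
          ((a ℕ.+ c) · 1#) + - ((b ℕ.+ d) · 1#)
            ≡⟨ cong₂ (λ s t → s + - t) (×-homo-+ 1# a c) (×-homo-+ 1# b d) ⟩
          (a · 1# + c · 1#) + - (b · 1# + d · 1#)
            ≡⟨ cong ((a · 1# + c · 1#) +_) (sym (-‿+-comm _ _)) ⟩
          (a · 1# + c · 1#) + (- (b · 1#) + - (d · 1#))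
            ≡⟨ interchange _ _ _ _ ⟩
          ⟦ a , b ⟧ᵣ + ⟦ c , d ⟧ᵣ ∎

        -‿homo : ∀ x → ⟦ RawRing.-_ coeff x ⟧ᵣ ≡ - ⟦ x ⟧ᵣ
        -‿homo (a , b) = begin
          b · 1# + - (a · 1#)       ≡⟨ +-comm _ _ ⟩
          - (a · 1#) + b · 1#       ≡⟨ cong (- (a · 1#) +_) (sym (-‿involutive _)) ⟩
          - (a · 1#) + - - (b · 1#) ≡⟨ -‿+-comm _ _ ⟩
          - ⟦ a , b ⟧ᵣ ∎

        *-homo : ∀ x y → ⟦ RawRing._*_ coeff x y ⟧ᵣ ≡ ⟦ x ⟧ᵣ * ⟦ y ⟧ᵣ
        *-homo (a , b) (c , d) = begin
          (a ℕ.* c ℕ.+ b ℕ.* d) · 1# + - ((a ℕ.* d ℕ.+ b ℕ.* c) · 1#)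
            ≡⟨ cong₂ (λ s t → s + - t)
                 (trans (×-homo-+ 1# (a ℕ.* c) _) (cong₂ _+_ (×1-homo-* a c) (×1-homo-* b d)))
                 (trans (×-homo-+ 1# (a ℕ.* d) _) (cong₂ _+_ (×1-homo-* a d) (×1-homo-* b c))) ⟩
          (A * C + B * D) + - (A * D + B * C)
            ≡⟨ cong ((A * C + B * D) +_) (sym (-‿+-comm _ _)) ⟩
          (A * C + B * D) + (- (A * D) + - (B * C))
            ≡⟨ interchange _ _ _ _ ⟩
          (A * C + - (A * D)) + (B * D + - (B * C))
            ≡⟨ cong₂ _+_ (cong (A * C +_) (-‿distribʳ-* A D))
                 (trans (+-comm _ _) (cong₂ _+_ (-‿distribˡ-* B C) neg-neg)) ⟩
          (A * C + A * - D) + (- B * C + - B * - D)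
            ≡⟨ sym (cong₂ _+_ (distribˡ A C (- D)) (distribˡ (- B) C (- D))) ⟩
          A * (C + - D) + - B * (C + - D)
            ≡⟨ sym (distribʳ _ A (- B)) ⟩
          ⟦ a , b ⟧ᵣ * ⟦ c , d ⟧ᵣ ∎
          where
          A = a · 1#
          B = b · 1#
          C = c · 1#
          D = d · 1#
          neg-neg : B * D ≡ - B * - D
          neg-neg = begin
            B * D         ≡⟨ sym (-‿involutive _) ⟩
            - - (B * D)   ≡⟨ cong -_ (-‿distribʳ-* B D) ⟩
            - (B * - D)   ≡⟨ -‿distribˡ-* B (- D) ⟩
            - B * - D ∎

        1-homo : ⟦ 1 , 0 ⟧ᵣ ≡ 1#
        1-homo = trans (cong₂ _+_ (+-identityʳ 1#) -0#≈0#) (+-identityʳ 1#)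

        cancel : ∀ {w x y z} → w + z ≡ y + x → w - x ≡ y - z
        cancel {w} {x} {y} {z} e = begin
          w + - x               ≡⟨ sym (+-identityʳ _) ⟩
          (w + - x) + 0#        ≡⟨ cong (w + - x +_) (sym (-‿inverseʳ z)) ⟩
          (w + - x) + (z + - z) ≡⟨ interchange _ _ _ _ ⟩
          (w + z) + (- x + - z) ≡⟨ cong (_+ (- x + - z)) e ⟩
          (y + x) + (- x + - z) ≡⟨ +-assoc _ _ _ ⟩
          y + (x + (- x + - z)) ≡⟨ cong (y +_) (sym (+-assoc _ _ _)) ⟩
          y + ((x + - x) + - z) ≡⟨ cong (λ t → y + (t + - z)) (-‿inverseʳ x) ⟩
          y + (0# + - z)        ≡⟨ cong (y +_) (+-identityˡ _) ⟩
          y + - z ∎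

        norm : ∀ x → ⟦ x ⟧c ≡ ⟦ x ⟧ᵣ
        norm (0 , 0) = sym (-‿inverseʳ 0#)
        norm (1 , 0) = sym 1-homo
        norm (0 , suc b) = refl
        norm (1 , suc b) = refl
        norm (suc (suc a) , b) = refl

      morphism : coeff -Raw-AlmostCommutative⟶ acr
      morphism = record
        { ⟦_⟧ = ⟦_⟧c
        ; +-homo = λ x y → trans (norm (RawRing._+_ coeff x y)) (trans (+-homo x y) (sym (cong₂ _+_ (norm x) (norm y))))
        ; *-homo = λ x y → trans (norm (RawRing._*_ coeff x y)) (trans (*-homo x y) (sym (cong₂ _*_ (norm x) (norm y))))
        ; -‿homo = λ x → trans (norm (RawRing.-_ coeff x)) (trans (-‿homo x) (sym (cong -_ (norm x))))
        ; 0-homo = refl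
        ; 1-homo = refl
        }

      -- Pairs are compared as integers, m - n = m′ - n′ in the form m + n′ = m′ + n. Integers that
      -- agree only modulo the characteristic give `nothing`, so the solver proves exactly the
      -- identities valid in every commutative ring.
      coeff≟ : ∀ x y → Maybe (⟦ x ⟧c ≡ ⟦ y ⟧c)
      coeff≟ (a , b) (c , d) with a ℕ.+ d ℕ.≟ c ℕ.+ b
      ... | yes e =
        just (trans (norm (a , b)) (trans (cancel (trans (sym (×-homo-+ 1# a d))
          (trans (cong (_· 1#) e) (×-homo-+ 1# c b)))) (sym (norm (c , d)))))
      ... | no _ = nothing

      open RingSolver coeff acr morphism coeff≟ public
        using (solve; _:=_; _:+_; _:*_; _:-_; :-_; con; Polynomial)

      :0 :1 : ∀ {n} → Polynomial n
      :0 = con (0 , 0)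
      :1 = con (1 , 0)

-- Elementary field algebra.

module FieldLemmas where
  open FiniteFields
  open import Data.Nat as ℕ using (ℕ; zero; suc)
  import Data.Nat.Properties as ℕₚ
  open import Data.Fin using (Fin)
  open import Data.Fin.Properties using () renaming (_≟_ to _≟F_)
  open import Data.Sum using (_⊎_; inj₁; inj₂)
  open import Relation.Nullary using (yes; no)
  open import Relation.Binary.PropositionalEquality
  open import Algebra using (CommutativeRing)
  import Algebra.Properties.Semiring.Exp as Exp
  import Algebra.Properties.CommutativeSemiring.Exp as CExp

  module FieldProperties {q : ℕ} (F : FiniteField q) where
    open FiniteField F public
    open Solver public
    open ≡-Reasoning
    open Exp semiring public using (_^_; ^-homo-*; ^-assocʳ)
    open CExp (CommutativeRing.commutativeSemiring commutativeRing) public using (^-distrib-*)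

    x-y≡0⇒x≡y : ∀ {x y} → x - y ≡ 0# → x ≡ y
    x-y≡0⇒x≡y {x} {y} e = begin
      x           ≡⟨ solve 2 (λ x y → x := x :- y :+ y) refl x y ⟩
      x - y + y   ≡⟨ cong (_+ y) e ⟩
      0# + y      ≡⟨ +-identityˡ y ⟩
      y ∎

    x≢y⇒x-y≢0 : ∀ {x y} → x ≢ y → x - y ≢ 0#
    x≢y⇒x-y≢0 x≢y e = x≢y (x-y≡0⇒x≡y e)

    ⁻¹-inverseˡ : ∀ x → x ≢ 0# → x ⁻¹ * x ≡ 1#
    ⁻¹-inverseˡ x x≢0 = trans (*-comm _ _) (⁻¹-inverseʳ x x≢0)

    *-cancelˡ : ∀ {x y z} → x ≢ 0# → x * y ≡ x * z → y ≡ z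
    *-cancelˡ {x} {y} {z} x≢0 e = begin
      y              ≡⟨ sym (*-identityˡ y) ⟩
      1# * y         ≡⟨ cong (_* y) (sym (⁻¹-inverseˡ x x≢0)) ⟩
      x ⁻¹ * x * y   ≡⟨ *-assoc _ _ _ ⟩
      x ⁻¹ * (x * y) ≡⟨ cong (x ⁻¹ *_) e ⟩
      x ⁻¹ * (x * z) ≡⟨ sym (*-assoc _ _ _) ⟩
      x ⁻¹ * x * z   ≡⟨ cong (_* z) (⁻¹-inverseˡ x x≢0) ⟩
      1# * z         ≡⟨ *-identityˡ z ⟩
      z ∎

    *-cancelʳ : ∀ {x y z} → x ≢ 0# → y * x ≡ z * x → y ≡ z
    *-cancelʳ x≢0 e = *-cancelˡ x≢0 (trans (*-comm _ _) (trans e (*-comm _ _)))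

    x*y≡0⇒x≡0∨y≡0 : ∀ x y → x * y ≡ 0# → x ≡ 0# ⊎ y ≡ 0#
    x*y≡0⇒x≡0∨y≡0 x y e with x ≟F 0#
    ... | yes x≡0 = inj₁ x≡0
    ... | no x≢0 = inj₂ (*-cancelˡ x≢0 (trans e (sym (zeroʳ x))))

    *-≢0 : ∀ {x y} → x ≢ 0# → y ≢ 0# → x * y ≢ 0#
    *-≢0 {x} {y} x≢0 y≢0 e with x*y≡0⇒x≡0∨y≡0 x y e
    ... | inj₁ x≡0 = x≢0 x≡0
    ... | inj₂ y≡0 = y≢0 y≡0

    ⁻¹-≢0 : ∀ {x} → x ≢ 0# → x ⁻¹ ≢ 0#
    ⁻¹-≢0 {x} x≢0 e = 1≢0 (trans (sym (⁻¹-inverseʳ x x≢0)) (trans (cong (x *_) e) (zeroʳ x)))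

    -‿≢0 : ∀ {x} → x ≢ 0# → - x ≢ 0#
    -‿≢0 x≢0 e = x≢0 (trans (sym (-‿involutive _)) (trans (cong -_ e) -0#≈0#))

    infixl 7 _/_
    _/_ : Fin q → Fin q → Fin q
    x / y = x * y ⁻¹

    [x/y]*y≡x : ∀ x {y} → y ≢ 0# → x / y * y ≡ x
    [x/y]*y≡x x {y} y≢0 = trans (*-assoc _ _ _) (trans (cong (x *_) (⁻¹-inverseˡ y y≢0)) (*-identityʳ x))

    x*y≡z⇒x≡z/y : ∀ {x y z} → y ≢ 0# → x * y ≡ z → x ≡ z / y
    x*y≡z⇒x≡z/y y≢0 e = *-cancelʳ y≢0 (trans e (sym ([x/y]*y≡x _ y≢0)))

    /-≢0 : ∀ {x y} → x ≢ 0# → y ≢ 0# → x / y ≢ 0#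
    /-≢0 x≢0 y≢0 = *-≢0 x≢0 (⁻¹-≢0 y≢0)

    1^n≡1 : ∀ n → 1# ^ n ≡ 1#
    1^n≡1 zero = refl
    1^n≡1 (suc n) = trans (*-identityˡ _) (1^n≡1 n)

    ^-≢0 : ∀ {x} n → x ≢ 0# → x ^ n ≢ 0#
    ^-≢0 zero _ = 1≢0
    ^-≢0 (suc n) x≢0 = *-≢0 x≢0 (^-≢0 n x≢0)

    x^n≡1⇒x≢0 : ∀ {x} n → .{{_ : ℕ.NonZero n}} → x ^ n ≡ 1# → x ≢ 0#
    x^n≡1⇒x≢0 {x} (suc n) e x≡0 = 1≢0 (trans (sym e) (trans (cong (_* x ^ n) x≡0) (zeroˡ (x ^ n))))

    0^n≡0 : ∀ n → .{{_ : ℕ.NonZero n}} → 0# ^ n ≡ 0#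
    0^n≡0 (suc n) = zeroˡ (0# ^ n)

    ^-/ : ∀ x {y} n → y ≢ 0# → (x / y) ^ n ≡ x ^ n / y ^ n
    ^-/ x {y} n y≢0 = x*y≡z⇒x≡z/y (^-≢0 n y≢0)
      (trans (sym (^-distrib-* (x / y) y n)) (cong (_^ n) ([x/y]*y≡x x y≢0)))

    x+y≡x⇒y≡0 : ∀ x y → x + y ≡ x → y ≡ 0#
    x+y≡x⇒y≡0 x y e = trans (solve 2 (λ x y → y := (x :+ y) :- x) refl x y) (trans (cong (_- x) e) (-‿inverseʳ x))

    -- The map x ↦ (β - x) / (β′ - x) is injective since its determinant is β - β′.
    möbius-injective : ∀ {β β′ x y} → β ≢ β′ → β′ - x ≢ 0# → β′ - y ≢ 0# →
                       (β - x) / (β′ - x) ≡ (β - y) / (β′ - y) → x ≡ y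
    möbius-injective {β} {β′} {x} {y} β≢β′ x≢ y≢ h = x-y≡0⇒x≡y (*-cancelˡ (x≢y⇒x-y≢0 β≢β′) (begin
      (β - β′) * (x - y)
        ≡⟨ solve 4 (λ β β′ x y → (β :- β′) :* (x :- y) := (β :- x) :* (β′ :- y) :- (β :- y) :* (β′ :- x)) refl β β′ x y ⟩
      (β - x) * (β′ - y) - (β - y) * (β′ - x)
        ≡⟨ cong₂ (λ s t → s * (β′ - y) - t * (β′ - x)) (sym ([x/y]*y≡x (β - x) x≢)) (sym ([x/y]*y≡x (β - y) y≢)) ⟩
      (β - x) / (β′ - x) * (β′ - x) * (β′ - y) - v * (β′ - y) * (β′ - x)
        ≡⟨ cong (λ t → t * (β′ - x) * (β′ - y) - v * (β′ - y) * (β′ - x)) h ⟩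
      v * (β′ - x) * (β′ - y) - v * (β′ - y) * (β′ - x)
        ≡⟨ solve 4 (λ p s t z → p :* s :* t :- p :* t :* s := z :* :0) refl v (β′ - x) (β′ - y) (β - β′) ⟩
      (β - β′) * 0# ∎))
      where
      v = (β - y) / (β′ - y)

    x-y≡-[y-x] : ∀ x y → x - y ≡ - (y - x)
    x-y≡-[y-x] x y = solve 2 (λ x y → x :- y := :- (y :- x)) refl x y

    -- This is why f is taken even: the class of a difference then does not depend on the order of
    -- the two points.
    -x^2m≡x^2m : ∀ x m → (- x) ^ (m ℕ.* 2) ≡ x ^ (m ℕ.* 2)
    -x^2m≡x^2m x m = trans (^-even (- x)) (trans (cong (_^ m) (solve 1 (λ x → :- x :* :- x := x :* x) refl x)) (sym (^-even x)))
      where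
      ^-even : ∀ y → y ^ (m ℕ.* 2) ≡ (y * y) ^ m
      ^-even y = trans (cong (y ^_) (ℕₚ.*-comm m 2)) (trans (sym (^-assocʳ y 2 m)) (cong (λ t → (y * t) ^ m) (*-identityʳ y)))

    module OddCharacteristic (2≢0 : 1# + 1# ≢ 0#) where
      x≢-x : ∀ {x} → x ≢ 0# → x ≢ - x
      x≢-x {x} x≢0 e = *-≢0 2≢0 x≢0 (begin
        (1# + 1#) * x   ≡⟨ solve 1 (λ x → (:1 :+ :1) :* x := x :+ x) refl x ⟩
        x + x           ≡⟨ cong (x +_) e ⟩
        x - x           ≡⟨ -‿inverseʳ x ⟩
        0# ∎)

-- Counting by indicator sums.

module Counting where
  open import Level using (Level)
  open import Data.Nat
  open import Data.Nat.Properties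
  open import Data.Fin using (Fin; zero; suc)
  open import Data.Fin.Properties using () renaming (_≟_ to _≟F_)
  open import Data.Sum using (_⊎_; inj₁; inj₂)
  open import Data.Product using (_×_; _,_; ∃-syntax)
  open import Data.Empty using (⊥-elim)
  open import Function using (_∘_)
  open import Relation.Unary using (Pred; Decidable)
  open import Data.List as List using (List; []; _∷_; length; cartesianProduct)
  open import Data.List.Properties using (length-++; length-map)
  open import Data.List.Membership.Propositional using (_∈_)
  open import Data.List.Relation.Unary.Any using (here; there)
  open import Relation.Nullary
  open import Relation.Nullary.Decidable using (_×-dec_; ¬?)
  open import Relation.Binary.PropositionalEquality
  open import Algebra.Properties.Semiring.Sum +-*-semiring public
    using (sum; sum-cong-≗; ∑-distrib-+; ∑-comm; *-distribˡ-sum; *-distribʳ-sum; sum-syntax)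

  private variable
    a b : Level
    A : Set a
    B : Set b
    m n : ℕ

  ind : Dec A → ℕ
  ind (yes _) = 1
  ind (no _)  = 0

  ind-yes : (a? : Dec A) → A → ind a? ≡ 1
  ind-yes (yes _) _ = refl
  ind-yes (no ¬a) a = ⊥-elim (¬a a)

  ind-no : (a? : Dec A) → ¬ A → ind a? ≡ 0
  ind-no (yes a) ¬a = ⊥-elim (¬a a)
  ind-no (no _) _ = refl

  ind-mono : (a? : Dec A) (b? : Dec B) → (A → B) → ind a? ≤ ind b?
  ind-mono (yes a) b? f = ≤-reflexive (sym (ind-yes b? (f a)))
  ind-mono (no _) _ _ = z≤n

  ind-cong : (a? : Dec A) (b? : Dec B) → (A → B) → (B → A) → ind a? ≡ ind b?
  ind-cong a? b? f g = ≤-antisym (ind-mono a? b? f) (ind-mono b? a? g)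

  ind-× : (a? : Dec A) (b? : Dec B) → ind (a? ×-dec b?) ≡ ind a? * ind b?
  ind-× (yes _) (yes _) = refl
  ind-× (yes _) (no _) = refl
  ind-× (no _) _ = refl

  ind-idem : (a? : Dec A) → ind a? * ind a? ≡ ind a?
  ind-idem (yes _) = refl
  ind-idem (no _) = refl

  sum-mono : {f g : Fin n → ℕ} → (∀ i → f i ≤ g i) → sum f ≤ sum g
  sum-mono {zero} _ = z≤n
  sum-mono {suc n} h = +-mono-≤ (h zero) (sum-mono (h ∘ suc))

  sum-const : ∀ n c → ∑[ i < n ] c ≡ n * c
  sum-const zero c = refl
  sum-const (suc n) c = cong (c +_) (sum-const n c)

  sum-zero : {f : Fin n → ℕ} → (∀ i → f i ≡ 0) → sum f ≡ 0
  sum-zero {n} h = trans (sum-cong-≗ h) (trans (sum-const n 0) (*-zeroʳ n))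

  term≤sum : (f : Fin n → ℕ) (i : Fin n) → f i ≤ sum f
  term≤sum f zero = m≤m+n _ _
  term≤sum f (suc i) = ≤-trans (term≤sum (f ∘ suc) i) (m≤n+m _ _)

  sum-δ : (f : Fin n → ℕ) (j : Fin n) → ∑[ i < n ] (ind (i ≟F j) * f i) ≡ f j
  sum-δ {suc n} f zero = trans (cong₂ _+_ (+-identityʳ _) (sum-zero {n} λ i → refl)) (+-identityʳ _)
  sum-δ {suc n} f (suc j) = trans (sum-cong-≗ {n} λ i → cong (_* f (suc i)) (ind-cong (suc i ≟F suc j) (i ≟F j) suc-injective′ (cong suc)))
    (sum-δ (f ∘ suc) j)
    where
    suc-injective′ : ∀ {n} {i j : Fin n} → Fin.suc i ≡ suc j → i ≡ j
    suc-injective′ refl = refl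

  count : {P : Pred (Fin n) a} → Decidable P → ℕ
  count P? = sum (ind ∘ P?)

  count-mono : {P : Pred (Fin n) a} {R : Pred (Fin n) b} (P? : Decidable P) (R? : Decidable R) →
               (∀ i → P i → R i) → count P? ≤ count R?
  count-mono P? R? h = sum-mono λ i → ind-mono (P? i) (R? i) (h i)

  count-none : {P : Pred (Fin n) a} (P? : Decidable P) → (∀ i → ¬ P i) → count P? ≡ 0
  count-none P? h = sum-zero λ i → ind-no (P? i) (h i)

  count-∪ : ∀ {c} {C : Pred (Fin n) c} {P : Pred (Fin n) a} {R : Pred (Fin n) b}
            (C? : Decidable C) (P? : Decidable P) (R? : Decidable R) →
            (∀ i → C i → P i ⊎ R i) → count C? ≤ count P? + count R?
  count-∪ C? P? R? h = ≤-trans (sum-mono λ i → lem (C? i) (P? i) (R? i) (h i)) (≤-reflexive (∑-distrib-+ (ind ∘ P?) (ind ∘ R?)))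
    where
    lem : ∀ {c a b} {C : Set c} {A : Set a} {B : Set b} (c? : Dec C) (a? : Dec A) (b? : Dec B) →
          (C → A ⊎ B) → ind c? ≤ ind a? + ind b?
    lem (no _) _ _ _ = z≤n
    lem (yes c) a? b? h with h c
    ... | inj₁ a = ≤-trans (≤-reflexive (sym (ind-yes a? a))) (m≤m+n _ _)
    ... | inj₂ b = ≤-trans (≤-reflexive (sym (ind-yes b? b))) (m≤n+m _ _)

  count-≡ : (j : Fin n) → count (_≟F j) ≡ 1
  count-≡ {n} j = trans (sum-cong-≗ {n} λ i → sym (*-identityʳ (ind (i ≟F j)))) (sum-δ (λ _ → 1) j)

  count-unique : {P : Pred (Fin n) a} (P? : Decidable P) → (∀ i j → P i → P j → i ≡ j) → count P? ≤ 1
  count-unique {n = zero} P? _ = z≤n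
  count-unique {n = suc n} P? u with P? zero
  ... | yes p = ≤-reflexive (cong suc (count-none (P? ∘ suc) λ i pi → case (u zero (suc i) p pi)))
    where
    case : ∀ {i : Fin n} → zero ≢ Fin.suc i
    case ()
  ... | no _ = count-unique (P? ∘ suc) λ i j pi pj → suc-inj (u _ _ pi pj)
    where
    suc-inj : ∀ {i j : Fin n} → Fin.suc i ≡ suc j → i ≡ j
    suc-inj refl = refl

  -- Double counting of the pairs (i , f i) with P i: after exchanging the sums, the fibre over j
  -- has at most one element, and none unless R j.
  count-injective : {P : Pred (Fin m) a} {R : Pred (Fin n) b} (P? : Decidable P) (R? : Decidable R)
                    (f : Fin m → Fin n) → (∀ i → P i → R (f i)) →
                    (∀ i j → P i → P j → f i ≡ f j → i ≡ j) → count P? ≤ count R?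
  count-injective {m} {n = n} P? R? f PR inj = begin
    ∑[ i < m ] ind (P? i)
      ≡⟨ sum-cong-≗ (λ i → sym (sum-δ (λ _ → ind (P? i)) (f i))) ⟩
    ∑[ i < m ] ∑[ j < n ] (ind (j ≟F f i) * ind (P? i))
      ≡⟨ ∑-comm (λ i j → ind (j ≟F f i) * ind (P? i)) ⟩
    ∑[ j < n ] ∑[ i < m ] (ind (j ≟F f i) * ind (P? i))
      ≤⟨ sum-mono fibre ⟩
    ∑[ j < n ] ind (R? j) ∎
    where
    open ≤-Reasoning
    D? : ∀ j i → Dec (j ≡ f i × _)
    D? j i = (j ≟F f i) ×-dec P? i
    fibre : ∀ j → ∑[ i < m ] (ind (j ≟F f i) * ind (P? i)) ≤ ind (R? j)
    fibre j with R? j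
    ... | yes _ = ≤-trans (≤-reflexive (sum-cong-≗ λ i → sym (ind-× (j ≟F f i) (P? i))))
                    (count-unique (D? j) λ i i′ (e , p) (e′ , p′) → inj i i′ p p′ (trans (sym e) e′))
    ... | no ¬r = ≤-reflexive (trans (sum-cong-≗ λ i → sym (ind-× (j ≟F f i) (P? i)))
                    (count-none (D? j) λ { i (refl , p) → ¬r (PR i p) }))

  count>0⇒∃ : {P : Pred (Fin n) a} (P? : Decidable P) → 0 < count P? → ∃[ i ] P i
  count>0⇒∃ {n = suc n} P? h with P? zero
  ... | yes p = zero , p
  ... | no _ with count>0⇒∃ (P? ∘ suc) h
  ...   | i , p = suc i , p

  count-all : {P : Pred (Fin n) a} (P? : Decidable P) → (∀ i → P i) → count P? ≡ n
  count-all {n} P? h = trans (sum-cong-≗ {n} λ i → ind-yes (P? i) (h i)) (trans (sum-const n 1) (*-identityʳ n))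

  count+count¬ : {P : Pred (Fin n) a} (P? : Decidable P) → count P? + count (¬? ∘ P?) ≡ n
  count+count¬ {n} P? = trans (sym (∑-distrib-+ (ind ∘ P?) (ind ∘ ¬? ∘ P?))) (trans (sum-cong-≗ {n} λ i → lem (P? i)) (trans (sum-const n 1) (*-identityʳ n)))
    where
    lem : ∀ {a} {A : Set a} (a? : Dec A) → ind a? + ind (¬? a?) ≡ 1
    lem (yes _) = refl
    lem (no _) = refl

  -- Union bound. The induction removes one bad set at a time from C, which costs at most `t`
  -- elements per step.
  avoid : ∀ {c} {I : Set} {C : Pred (Fin n) c} {P : I → Pred (Fin n) a} (C? : Decidable C) (P? : ∀ i → Decidable (P i)) (t : ℕ) →
          (∀ i → count (P? i) ≤ t) → ∀ is → length is * t < count C? → ∃[ x ] (C x × (∀ {i} → i ∈ is → ¬ P i x))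
  avoid C? P? t P≤ [] lt with count>0⇒∃ C? lt
  ... | x , cx = x , cx , λ ()
  avoid {C = C} {P = P} C? P? t P≤ (i ∷ is) lt
    with avoid (λ x → C? x ×-dec ¬? (P? i x)) P? t P≤ is (+-cancelˡ-< t _ _ (<-≤-trans lt
           (≤-trans (count-∪ C? (P? i) (λ x → C? x ×-dec ¬? (P? i x)) split) (+-monoˡ-≤ _ (P≤ i)))))
    where
    split : ∀ x → C x → P i x ⊎ (C x × ¬ P i x)
    split x cx with P? i x
    ... | yes p = inj₁ p
    ... | no ¬p = inj₂ (cx , ¬p)
  ... | x , (cx , ¬p) , rest = x , cx , λ { (here refl) → ¬p ; (there h) → rest h }

  length-cartesianProduct : ∀ {a b} {A : Set a} {B : Set b} (xs : List A) (ys : List B) →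
                            length (cartesianProduct xs ys) ≡ length xs * length ys
  length-cartesianProduct [] ys = refl
  length-cartesianProduct (x ∷ xs) ys = trans (length-++ (List.map (x ,_) ys))
    (cong₂ _+_ (length-map (x ,_) ys) (length-cartesianProduct xs ys))

-- Prime divisors and the prime-power part of a number.

module PrimeDivisors where
  open import Data.Nat
  open import Data.Nat.Properties
  open import Data.Nat.Divisibility
  open import Data.Nat.Primality
  open import Data.Nat.Primality.Factorisation using (factorise; module PrimeFactorisation)
  open import Data.Nat.Coprimality using (Coprime)
  open import Data.Nat.Induction using (<-rec)
  open import Data.List using ([]; _∷_)
  open import Data.Nat.ListAction using (product)
  open import Data.List.Relation.Unary.All using (_∷_)
  open import Data.Sum using (inj₁; inj₂)
  open import Data.Product using (_×_; _,_; ∃-syntax)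
  open import Data.Empty using (⊥-elim)
  open import Relation.Nullary
  open import Relation.Binary.PropositionalEquality

  ∃-prime-divisor : ∀ n → .{{_ : NonZero n}} → n ≢ 1 → ∃[ ℓ ] (Prime ℓ × ℓ ∣ n)
  ∃-prime-divisor n n≢1 with factorise n
  ... | record { factors = [] ; isFactorisation = e } = ⊥-elim (n≢1 e)
  ... | record { factors = ℓ ∷ ℓs ; isFactorisation = e ; factorsPrime = pr ∷ _ } =
    ℓ , pr , subst (ℓ ∣_) (sym e) (m∣m*n (product ℓs))

  prime∤⇒coprime : ∀ {ℓ n} → Prime ℓ → ¬ ℓ ∣ n → Coprime ℓ n
  prime∤⇒coprime pr ℓ∤n (d∣ℓ , d∣n) with prime⇒irreducible pr d∣ℓ
  ... | inj₁ d≡1 = d≡1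
  ... | inj₂ refl = ⊥-elim (ℓ∤n d∣n)

  prime∣^⇒∣ : ∀ {ℓ} m n → Prime ℓ → ℓ ∣ m ^ n → ℓ ∣ m
  prime∣^⇒∣ m zero pr h with ∣1⇒≡1 h
  ... | refl = ⊥-elim (¬prime[1] pr)
  prime∣^⇒∣ m (suc n) pr h with euclidsLemma m (m ^ n) pr h
  ... | inj₁ h′ = h′
  ... | inj₂ h′ = prime∣^⇒∣ m n pr h′

  prime∣prime⇒≡ : ∀ {ℓ ℓ′} → Prime ℓ → Prime ℓ′ → ℓ ∣ ℓ′ → ℓ ≡ ℓ′
  prime∣prime⇒≡ pr pr′ h with prime⇒irreducible pr′ h
  ... | inj₁ refl = ⊥-elim (¬prime[1] pr)
  ... | inj₂ e = e

  prime-part : ∀ {ℓ} → Prime ℓ → ∀ d → .{{NonZero d}} → ∃[ a ] ∃[ m ] (d ≡ ℓ ^ a * m × ¬ ℓ ∣ m)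
  prime-part {ℓ} pr d {{nz}} = <-rec (λ d → NonZero d → ∃[ a ] ∃[ m ] (d ≡ ℓ ^ a * m × ¬ ℓ ∣ m)) step d (recompute-NZ nz)
    where
    recompute-NZ : ∀ {d} → .(NonZero d) → NonZero d
    recompute-NZ {suc d} _ = _
    step : ∀ d → (∀ {d′} → d′ < d → NonZero d′ → ∃[ a ] ∃[ m ] (d′ ≡ ℓ ^ a * m × ¬ ℓ ∣ m)) →
           NonZero d → ∃[ a ] ∃[ m ] (d ≡ ℓ ^ a * m × ¬ ℓ ∣ m)
    step d rec nz with ℓ ∣? d
    ... | no ℓ∤d = 0 , d , sym (+-identityʳ d) , ℓ∤d
    ... | yes ℓ∣d with rec (quotient-< ℓ∣d {{prime⇒nonTrivial pr}} {{nz}}) (quotient≢0 ℓ∣d {{nz}})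
    ...   | a , m , e , ℓ∤m = suc a , m ,
            trans (m∣n⇒n≡m*quotient ℓ∣d) (trans (cong (ℓ *_) e) (sym (*-assoc ℓ (ℓ ^ a) m))) , ℓ∤m

-- Roots of polynomials, Fermat's theorem and primitive roots.

module MultiplicativeGroups where
  open FiniteFields
  open FieldLemmas
  open Counting
  open PrimeDivisors
  open import Data.Nat as ℕ using (ℕ; zero; suc; _≤_; _<_; s≤s; z≤n; NonZero)
  import Data.Nat.Properties as ℕₚ
  open import Data.Nat.Divisibility
  open import Data.Nat.GCD using (module Bézout; gcd; gcd-GCD; gcd[m,n]∣m; gcd[m,n]∣n)
  open import Data.Nat.Coprimality using (Coprime; coprime-Bézout)
  open import Data.Nat.Primality
  open import Data.Nat.Induction using (<-rec)
  open import Data.Fin using (Fin; zero; suc; toℕ; punchIn)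
  open import Data.Fin.Properties using (any?; punchInᵢ≢i; pigeonhole; toℕ<n) renaming (_≟_ to _≟F_)
  open import Data.Fin.Permutation using (Permutation′; permutation)
  open import Data.Vec using (Vec; []; _∷_; replicate)
  open import Data.Sum using (_⊎_; inj₁; inj₂)
  open import Data.Product using (_×_; _,_; ∃-syntax; proj₁; proj₂)
  open import Data.Empty using (⊥-elim)
  open import Function using (_∘_)
  open import Relation.Nullary
  open import Relation.Nullary.Decidable using (¬?; _×-dec_)
  open import Relation.Binary.PropositionalEquality
  import Algebra.Properties.CommutativeMonoid.Sum as ProductOver
  import Data.Vec.Functional as VF
  open Bézout using (module Identity)

  module Roots {q : ℕ} (F : FiniteField q) where
    open FieldProperties F

    -- The monic polynomial of degree d with the given lower coefficients.
    eval : ∀ {d} → Vec (Fin q) d → Fin q → Fin q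
    eval [] x = 1#
    eval (a ∷ v) x = a + x * eval v x

    -- Synthetic division by x - r: the coefficients of the quotient are the partial values of
    -- Horner's scheme at r.
    quo : ∀ {d} → Vec (Fin q) (suc d) → Fin q → Vec (Fin q) d
    quo {zero} _ _ = []
    quo {suc d} (a ∷ v) r = eval v r ∷ quo v r

    eval-quo : ∀ {d} (v : Vec (Fin q) (suc d)) x r → eval v x ≡ (x - r) * eval (quo v r) x + eval v r
    eval-quo {zero} (a ∷ []) x r =
      solve 3 (λ a x r → a :+ x :* :1 := (x :- r) :* :1 :+ (a :+ r :* :1)) refl a x r
    eval-quo {suc d} (a ∷ v) x r = begin
      a + x * eval v x                                   ≡⟨ cong (λ t → a + x * t) (eval-quo v x r) ⟩
      a + x * ((x - r) * eval (quo v r) x + eval v r)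
        ≡⟨ solve 5 (λ a x r s t → a :+ x :* ((x :- r) :* s :+ t) := (x :- r) :* (t :+ x :* s) :+ (a :+ r :* t))
             refl a x r (eval (quo v r) x) (eval v r) ⟩
      (x - r) * eval (quo (a ∷ v) r) x + eval (a ∷ v) r ∎
      where open ≡-Reasoning

    count-roots : ∀ {d} (v : Vec (Fin q) d) → count (λ x → eval v x ≟F 0#) ≤ d
    count-roots {zero} [] = ℕₚ.≤-reflexive (count-none {n = q} (λ x → 1# ≟F 0#) λ _ → 1≢0)
    count-roots {suc d} v with any? (λ x → eval v x ≟F 0#)
    ... | no none = ℕₚ.≤-trans (ℕₚ.≤-reflexive (count-none (λ x → eval v x ≟F 0#) λ i e → none (i , e))) z≤n
    ... | yes (r , er) = ℕₚ.≤-trans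
      (count-∪ (λ x → eval v x ≟F 0#) (_≟F r) (λ x → eval (quo v r) x ≟F 0#) split)
      (ℕₚ.+-mono-≤ (ℕₚ.≤-reflexive (count-≡ r)) (count-roots (quo v r)))
      where
      split : ∀ x → eval v x ≡ 0# → x ≡ r ⊎ eval (quo v r) x ≡ 0#
      split x ex with x*y≡0⇒x≡0∨y≡0 (x - r) (eval (quo v r) x)
        (trans (sym (+-identityʳ _)) (trans (cong ((x - r) * eval (quo v r) x +_) (sym er)) (trans (sym (eval-quo v x r)) ex)))
      ... | inj₁ e = inj₁ (x-y≡0⇒x≡y e)
      ... | inj₂ e = inj₂ e

    eval-replicate : ∀ d x → eval (replicate d 0#) x ≡ x ^ d
    eval-replicate zero x = refl
    eval-replicate (suc d) x = trans (+-identityˡ _) (cong (x *_) (eval-replicate d x))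

    count-^≡ : ∀ d → .{{NonZero d}} → ∀ y → count (λ x → x ^ d ≟F y) ≤ d
    count-^≡ (suc d) y = ℕₚ.≤-trans
      (count-mono (λ x → x ^ suc d ≟F y) (λ x → eval ((- y) ∷ replicate d 0#) x ≟F 0#) λ x e →
        trans (cong (λ t → - y + x * t) (eval-replicate d x)) (trans (cong (- y +_) e) (-‿inverseˡ y)))
      (count-roots ((- y) ∷ replicate d 0#))

    ^-∣ : ∀ {x i j} → x ^ i ≡ 1# → i ∣ j → x ^ j ≡ 1#
    ^-∣ {x} {i} e (divides s refl) = begin
      x ^ (s ℕ.* i)  ≡⟨ cong (x ^_) (ℕₚ.*-comm s i) ⟩
      x ^ (i ℕ.* s)  ≡⟨ sym (^-assocʳ x i s) ⟩
      (x ^ i) ^ s    ≡⟨ cong (_^ s) e ⟩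
      1# ^ s         ≡⟨ 1^n≡1 s ⟩
      1# ∎
      where open ≡-Reasoning

    ^-+-cancel : ∀ {x} i j → x ^ (i ℕ.+ j) ≡ 1# → x ^ j ≡ 1# → x ^ i ≡ 1#
    ^-+-cancel {x} i j e e′ = begin
      x ^ i              ≡⟨ sym (*-identityʳ _) ⟩
      x ^ i * 1#         ≡⟨ cong (x ^ i *_) (sym e′) ⟩
      x ^ i * x ^ j      ≡⟨ sym (^-homo-* x i j) ⟩
      x ^ (i ℕ.+ j)      ≡⟨ e ⟩
      1# ∎
      where open ≡-Reasoning

    -- The identity is given without subtraction, as d + t j = s i or its mirror image, so x^d is
    -- reached by cancelling a power of x known to be 1.
    ^-Bézout : ∀ {x i j d} → Bézout.Identity d i j → x ^ i ≡ 1# → x ^ j ≡ 1# → x ^ d ≡ 1#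
    ^-Bézout {x} {i} {j} {d} (Identity.+- s t eq) ei ej =
      ^-+-cancel d (t ℕ.* j) (trans (cong (x ^_) eq) (^-∣ ei (n∣m*n s))) (^-∣ ej (n∣m*n t))
    ^-Bézout {x} {i} {j} {d} (Identity.-+ s t eq) ei ej =
      ^-+-cancel d (s ℕ.* i) (trans (cong (x ^_) eq) (^-∣ ej (n∣m*n t))) (^-∣ ei (n∣m*n s))

    ^-gcd : ∀ {x} i j → x ^ i ≡ 1# → x ^ j ≡ 1# → x ^ gcd i j ≡ 1#
    ^-gcd i j = ^-Bézout (Bézout.identity (gcd-GCD i j))

    ^-coprime : ∀ {x i j} → Coprime i j → x ^ i ≡ 1# → x ^ j ≡ 1# → x ≡ 1#
    ^-coprime {x} c ei ej = trans (sym (*-identityʳ x)) (^-Bézout (coprime-Bézout c) ei ej)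

  module MultiplicativeGroup {N : ℕ} (F : FiniteField (suc N)) where
    open FieldProperties F
    open Roots F
    open ≡-Reasoning
    module Π = ProductOver *-commutativeMonoid

    -- Multiplication by x permutes the nonzero elements, hence preserves their product.
    fermat : ∀ {x} → x ≢ 0# → x ^ N ≡ 1#
    fermat {x} x≢0 = *-cancelʳ {x = Π.sum h} (Π-≢0 h h≢0) (begin
      x ^ N * Π.sum h                    ≡⟨ cong (_* Π.sum h) (sym Πg) ⟩
      Π.sum g * Π.sum h                  ≡⟨ sym (Π.∑-distrib-+ g h) ⟩
      Π.sum (λ y → g y * h y)            ≡⟨ Π.sum-cong-≗ gh ⟩
      Π.sum (λ y → h (x * y))            ≡⟨ sym (Π.sum-permute h π) ⟩
      Π.sum h                            ≡⟨ sym (*-identityˡ _) ⟩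
      1# * Π.sum h ∎)
      where
      if0 : Fin (suc N) → Fin (suc N) → Fin (suc N)
      if0 z y with y ≟F 0#
      ... | yes _ = 1#
      ... | no _ = z
      g h : Fin (suc N) → Fin (suc N)
      g = if0 x
      h y = if0 y y
      h≢0 : ∀ y → h y ≢ 0#
      h≢0 y with y ≟F 0#
      ... | yes _ = 1≢0
      ... | no y≢0 = y≢0
      Π-≢0 : ∀ {n} (f : Fin n → Fin (suc N)) → (∀ i → f i ≢ 0#) → Π.sum f ≢ 0#
      Π-≢0 {zero} f _ = 1≢0
      Π-≢0 {suc n} f ne = *-≢0 (ne zero) (Π-≢0 (f ∘ suc) (ne ∘ suc))
      if0-0 : ∀ z → if0 z 0# ≡ 1#
      if0-0 z with 0# ≟F 0#
      ... | yes _ = refl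
      ... | no ne = ⊥-elim (ne refl)
      if0-≢0 : ∀ z y → y ≢ 0# → if0 z y ≡ z
      if0-≢0 z y ne with y ≟F 0#
      ... | yes e = ⊥-elim (ne e)
      ... | no _ = refl
      gh : ∀ y → g y * h y ≡ h (x * y)
      gh y with y ≟F 0#
      ... | yes refl = trans (*-identityˡ 1#) (sym (trans (cong h (zeroʳ x)) (if0-0 0#)))
      ... | no y≢0 = sym (if0-≢0 (x * y) (x * y) (*-≢0 x≢0 y≢0))
      Πg : Π.sum g ≡ x ^ N
      Πg = begin
        Π.sum g                                        ≡⟨ Π.sum-remove {i = 0#} g ⟩
        g 0# * Π.sum (VF.removeAt g 0#)                ≡⟨ cong₂ _*_ (if0-0 x) (Π.sum-cong-≗ λ i → if0-≢0 x (punchIn 0# i) (punchInᵢ≢i 0# i)) ⟩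
        1# * Π.sum (VF.replicate N x)                  ≡⟨ *-identityˡ _ ⟩
        Π.sum (VF.replicate N x)                       ≡⟨ Π.sum-replicate N ⟩
        x ^ N ∎
      π : Permutation′ (suc N)
      π = permutation (x *_) (x ⁻¹ *_)
        (λ y → trans (sym (*-assoc _ _ _)) (trans (cong (_* y) (⁻¹-inverseʳ x x≢0)) (*-identityˡ y)))
        (λ y → trans (sym (*-assoc _ _ _)) (trans (cong (_* y) (⁻¹-inverseˡ x x≢0)) (*-identityˡ y)))

    count-≢0 : count (λ x → ¬? (x ≟F 0#)) ≡ N
    count-≢0 = ℕₚ.suc-injective (trans (cong (ℕ._+ count (λ x → ¬? (x ≟F 0#))) (sym (count-≡ 0#))) (count+count¬ (_≟F 0#)))

    -- Otherwise x^m = 1 would have all N nonzero elements as solutions, more than its degree m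
    -- allows.
    ∃-^≢1 : ∀ m → .{{NonZero m}} → m < N → ∃[ x ] (x ≢ 0# × x ^ m ≢ 1#)
    ∃-^≢1 m m<N with any? (λ x → ¬? (x ≟F 0#) ×-dec ¬? (x ^ m ≟F 1#))
    ... | yes r = r
    ... | no none = ⊥-elim (ℕₚ.<⇒≱ m<N (ℕₚ.≤-trans (ℕₚ.≤-reflexive (sym count-≢0))
            (ℕₚ.≤-trans (count-mono (λ x → ¬? (x ≟F 0#)) (λ x → x ^ m ≟F 1#) all-roots) (count-^≡ m 1#))))
      where
      all-roots : ∀ x → x ≢ 0# → x ^ m ≡ 1#
      all-roots x x≢0 with x ^ m ≟F 1#
      ... | yes e = e
      ... | no ne = ⊥-elim (none (x , x≢0 , ne))

    -- Exactness is tested only at the maximal proper divisors d / ℓ with ℓ prime. Every proper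
    -- divisor of d divides one of these, and the test is easy to verify for a product of elements
    -- of coprime orders.
    HasExactOrder : ℕ → Fin (suc N) → Set
    HasExactOrder d y = y ^ d ≡ 1# × (∀ ℓ m → Prime ℓ → d ≡ ℓ ℕ.* m → y ^ m ≢ 1#)

    -- If d = ℓᵃm with ℓ prime and ℓ ∤ m, an element of order d is a product of elements of orders m and ℓᵃ,
    -- the latter being x^(N/ℓᵃ) for any x with x^(N/ℓ) ≠ 1.
    ∃-exactOrder : NonZero N → ∀ d → d ∣ N → ∃[ y ] HasExactOrder d y
    ∃-exactOrder nzN = <-rec (λ d → d ∣ N → ∃[ y ] HasExactOrder d y) step
      where
      instance _ = nzN
      nz-∣ : ∀ {d} → d ∣ N → NonZero d
      nz-∣ {zero} d∣N = ⊥-elim (ℕ.≢-nonZero⁻¹ N (0∣⇒≡0 d∣N))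
      nz-∣ {suc d} _ = _
      step : ∀ d → (∀ {d′} → d′ < d → d′ ∣ N → ∃[ y ] HasExactOrder d′ y) → d ∣ N → ∃[ y ] HasExactOrder d y
      step d rec d∣N with d ℕₚ.≟ 1
      ... | yes refl = 1# , *-identityʳ 1# , λ ℓ m pr e _ → ¬prime[1] (subst Prime (ℕₚ.m*n≡1⇒m≡1 ℓ m (sym e)) pr)
      ... | no d≢1 with ∃-prime-divisor d {{nz-∣ d∣N}} d≢1
      ...   | ℓ , pr , ℓ∣d with prime-part pr d {{nz-∣ d∣N}}
      ...     | zero , m , e , ℓ∤m = ⊥-elim (ℓ∤m (subst (ℓ ∣_) (trans e (ℕₚ.+-identityʳ m)) ℓ∣d))
      ...     | suc a , m , refl , ℓ∤m with d∣N
      ...       | divides t N≡ = y₁ * z , ord , proper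
        where
        instance
          _ = prime⇒nonZero pr
          _ = prime⇒nonTrivial pr
        ℓᵃ = ℓ ℕ.^ a
        ℓᵃ⁺¹ = ℓ ℕ.* ℓᵃ
        instance
          nzm : NonZero m
          nzm = ℕₚ.m*n≢0⇒n≢0 ℓᵃ⁺¹ {{nz-∣ d∣N}}
          nzℓᵃ : NonZero ℓᵃ
          nzℓᵃ = ℕₚ.m^n≢0 ℓ a
          nzt : NonZero t
          nzt = ℕₚ.m*n≢0⇒m≢0 t {{subst NonZero N≡ nzN}}
          nzN′ : NonZero (t ℕ.* (ℓᵃ ℕ.* m))
          nzN′ = ℕₚ.m*n≢0 t (ℓᵃ ℕ.* m) {{nzt}} {{ℕₚ.m*n≢0 ℓᵃ m}}
        N≡ℓ* : N ≡ ℓ ℕ.* (t ℕ.* (ℓᵃ ℕ.* m))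
        N≡ℓ* = trans N≡ (trans (cong (t ℕ.*_) (ℕₚ.*-assoc ℓ ℓᵃ m)) (trans (sym (ℕₚ.*-assoc t ℓ _))
                 (trans (cong (ℕ._* (ℓᵃ ℕ.* m)) (ℕₚ.*-comm t ℓ)) (ℕₚ.*-assoc ℓ t _))))
        m<d : m < ℓᵃ⁺¹ ℕ.* m
        m<d = subst (m <_) (ℕₚ.*-comm m ℓᵃ⁺¹) (ℕₚ.m<m*n m ℓᵃ⁺¹ (ℕₚ.<-≤-trans (ℕ.nonTrivial⇒n>1 ℓ) (ℕₚ.m≤m*n ℓ ℓᵃ)))
        y₁-spec = rec {m} m<d (∣-trans (n∣m*n ℓᵃ⁺¹) d∣N)
        y₁ = proj₁ y₁-spec
        x-spec = ∃-^≢1 (t ℕ.* (ℓᵃ ℕ.* m))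
          (subst (t ℕ.* (ℓᵃ ℕ.* m) <_) (sym N≡ℓ*) (subst (t ℕ.* (ℓᵃ ℕ.* m) <_) (ℕₚ.*-comm _ ℓ) (ℕₚ.m<m*n _ ℓ (ℕ.nonTrivial⇒n>1 ℓ))))
        x = proj₁ x-spec
        z = x ^ (t ℕ.* m)
        z^ℓᵃ⁺¹ : z ^ ℓᵃ⁺¹ ≡ 1#
        z^ℓᵃ⁺¹ = trans (^-assocʳ x (t ℕ.* m) ℓᵃ⁺¹) (trans (cong (x ^_)
          (trans (ℕₚ.*-assoc t m ℓᵃ⁺¹) (trans (cong (t ℕ.*_) (ℕₚ.*-comm m ℓᵃ⁺¹)) (sym N≡)))) (fermat (proj₁ (proj₂ x-spec))))
        z^ℓᵃ : z ^ ℓᵃ ≢ 1#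
        z^ℓᵃ e = proj₂ (proj₂ x-spec) (trans (cong (x ^_) (trans (cong (t ℕ.*_) (ℕₚ.*-comm ℓᵃ m)) (sym (ℕₚ.*-assoc t m ℓᵃ))))
          (trans (sym (^-assocʳ x (t ℕ.* m) ℓᵃ)) e))
        ord : (y₁ * z) ^ (ℓᵃ⁺¹ ℕ.* m) ≡ 1#
        ord = trans (^-distrib-* y₁ z (ℓᵃ⁺¹ ℕ.* m)) (trans (cong₂ _*_ (^-∣ {y₁} {m} (proj₁ (proj₂ y₁-spec)) (n∣m*n ℓᵃ⁺¹)) (^-∣ {z} {ℓᵃ⁺¹} z^ℓᵃ⁺¹ (m∣m*n m))) (*-identityʳ 1#))
        -- For ℓ′ = ℓ the exponent is a multiple of m, so y₁ drops out and the order of z would be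
        -- too small. For ℓ′ ≠ ℓ the prime ℓ′ divides m, so z drops out and y₁ would violate its own
        -- exactness.
        proper : ∀ ℓ′ m′ → Prime ℓ′ → ℓᵃ⁺¹ ℕ.* m ≡ ℓ′ ℕ.* m′ → (y₁ * z) ^ m′ ≢ 1#
        proper ℓ′ m′ pr′ e yz≡1 with ℓ ℕₚ.≟ ℓ′
        ... | yes refl = z^ℓᵃ (^-coprime (prime∤⇒coprime pr ℓ∤m)
                (trans (^-assocʳ z ℓᵃ ℓ) (trans (cong (z ^_) (ℕₚ.*-comm ℓᵃ ℓ)) z^ℓᵃ⁺¹))
                (trans (^-assocʳ z ℓᵃ m) z^ℓᵃm))
          where
          m′≡ : m′ ≡ ℓᵃ ℕ.* m
          m′≡ = ℕₚ.*-cancelˡ-≡ m′ (ℓᵃ ℕ.* m) ℓ (trans (sym e) (ℕₚ.*-assoc ℓ ℓᵃ m))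
          z^ℓᵃm : z ^ (ℓᵃ ℕ.* m) ≡ 1#
          z^ℓᵃm = begin
            z ^ (ℓᵃ ℕ.* m)                        ≡⟨ sym (*-identityˡ _) ⟩
            1# * z ^ (ℓᵃ ℕ.* m)                   ≡⟨ cong (_* z ^ (ℓᵃ ℕ.* m)) (sym (^-∣ {y₁} {m} (proj₁ (proj₂ y₁-spec)) (n∣m*n ℓᵃ))) ⟩
            y₁ ^ (ℓᵃ ℕ.* m) * z ^ (ℓᵃ ℕ.* m)      ≡⟨ sym (^-distrib-* y₁ z (ℓᵃ ℕ.* m)) ⟩
            (y₁ * z) ^ (ℓᵃ ℕ.* m)                 ≡⟨ cong ((y₁ * z) ^_) (sym m′≡) ⟩
            (y₁ * z) ^ m′                         ≡⟨ yz≡1 ⟩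
            1# ∎
        ... | no ℓ≢ℓ′ with euclidsLemma ℓᵃ⁺¹ m pr′ (subst (ℓ′ ∣_) (sym e) (m∣m*n m′))
        ...   | inj₁ ℓ′∣ = ⊥-elim (ℓ≢ℓ′ (sym (prime∣prime⇒≡ pr′ pr (prime∣^⇒∣ ℓ (suc a) pr′ ℓ′∣))))
        ...   | inj₂ (divides m₁ m≡) = proj₂ (proj₂ y₁-spec) ℓ′ m₁ pr′ (trans m≡ (ℕₚ.*-comm m₁ ℓ′))
                (^-coprime (prime∤⇒coprime pr′ λ h → ℓ≢ℓ′ (sym (prime∣prime⇒≡ pr′ pr (prime∣^⇒∣ ℓ (suc a) pr′ h))))
                  (trans (^-assocʳ y₁ m₁ ℓ′) (trans (cong (y₁ ^_) (sym m≡)) (proj₁ (proj₂ y₁-spec))))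
                  (trans (^-assocʳ y₁ m₁ ℓᵃ⁺¹) y₁^))
          where
          instance _ = prime⇒nonZero pr′
          m′≡ : m′ ≡ m₁ ℕ.* ℓᵃ⁺¹
          m′≡ = ℕₚ.*-cancelˡ-≡ m′ (m₁ ℕ.* ℓᵃ⁺¹) ℓ′ (trans (sym e) (trans (cong (ℓᵃ⁺¹ ℕ.*_) m≡)
                  (trans (ℕₚ.*-comm ℓᵃ⁺¹ (m₁ ℕ.* ℓ′)) (trans (cong (ℕ._* ℓᵃ⁺¹) (ℕₚ.*-comm m₁ ℓ′)) (ℕₚ.*-assoc ℓ′ m₁ ℓᵃ⁺¹)))))
          y₁^ : y₁ ^ (m₁ ℕ.* ℓᵃ⁺¹) ≡ 1#
          y₁^ = begin
            y₁ ^ (m₁ ℕ.* ℓᵃ⁺¹)                              ≡⟨ sym (*-identityʳ _) ⟩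
            y₁ ^ (m₁ ℕ.* ℓᵃ⁺¹) * 1#                         ≡⟨ cong (y₁ ^ (m₁ ℕ.* ℓᵃ⁺¹) *_) (sym (^-∣ {z} {ℓᵃ⁺¹} z^ℓᵃ⁺¹ (n∣m*n m₁))) ⟩
            y₁ ^ (m₁ ℕ.* ℓᵃ⁺¹) * z ^ (m₁ ℕ.* ℓᵃ⁺¹)          ≡⟨ sym (^-distrib-* y₁ z (m₁ ℕ.* ℓᵃ⁺¹)) ⟩
            (y₁ * z) ^ (m₁ ℕ.* ℓᵃ⁺¹)                        ≡⟨ cong ((y₁ * z) ^_) (sym m′≡) ⟩
            (y₁ * z) ^ m′                                   ≡⟨ yz≡1 ⟩
            1# ∎

    record PrimitiveRoot : Set where
      field
        g     : Fin (suc N)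
        g≢0   : g ≢ 0#
        g^N≡1 : g ^ N ≡ 1#
        order : ∀ i → g ^ i ≡ 1# → N ∣ i

      ^-injective-≤ : ∀ {i j} → i ≤ j → j < N → g ^ i ≡ g ^ j → i ≡ j
      ^-injective-≤ {i} {j} i≤j j<N e =
        ℕₚ.≤-antisym i≤j (ℕₚ.m∸n≡0⇒m≤n (∣∧<⇒≡0 (ℕₚ.≤-<-trans (ℕₚ.m∸n≤m j i) j<N) (order (j ℕ.∸ i) g^[j∸i]≡1)))
        where
        g^[j∸i]≡1 : g ^ (j ℕ.∸ i) ≡ 1#
        g^[j∸i]≡1 = *-cancelˡ {x = g ^ i} (^-≢0 i g≢0) (trans (sym (^-homo-* g i (j ℕ.∸ i)))
          (trans (cong (g ^_) (ℕₚ.m+[n∸m]≡n i≤j)) (trans (sym e) (sym (*-identityʳ _)))))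
        ∣∧<⇒≡0 : ∀ {k} → k < N → N ∣ k → k ≡ 0
        ∣∧<⇒≡0 {zero} _ _ = refl
        ∣∧<⇒≡0 {suc k} k<N h = ⊥-elim (ℕₚ.<⇒≱ k<N (∣⇒≤ h))

      ^-injective : ∀ {i j} → i < N → j < N → g ^ i ≡ g ^ j → i ≡ j
      ^-injective {i} {j} i<N j<N e with ℕₚ.≤-total i j
      ... | inj₁ i≤j = ^-injective-≤ i≤j j<N e
      ... | inj₂ j≤i = sym (^-injective-≤ j≤i i<N (sym e))

      -- If x were not a power of g, then 0, x, g⁰, ..., g^(N-1) would be N + 2 distinct elements
      -- among N + 1.
      log : ∀ x → x ≢ 0# → ∃[ e ] g ^ e ≡ x
      log x x≢0 with any? (λ (e : Fin N) → g ^ toℕ e ≟F x)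
      ... | yes (e , eq) = toℕ e , eq
      ... | no none = ⊥-elim absurd
        where
        f : Fin (suc (suc N)) → Fin (suc N)
        f zero = 0#
        f (suc zero) = x
        f (suc (suc e)) = g ^ toℕ e
        absurd : _
        absurd with pigeonhole (ℕₚ.n<1+n (suc N)) f
        ... | zero , suc zero , _ , e = x≢0 (sym e)
        ... | zero , suc (suc j) , _ , e = ^-≢0 (toℕ j) g≢0 (sym e)
        ... | suc zero , suc (suc j) , _ , e = none (j , sym e)
        ... | suc (suc i) , suc (suc j) , s≤s (s≤s i<j) , e =
          ℕₚ.<⇒≢ i<j (^-injective (toℕ<n i) (toℕ<n j) e)
        ... | suc zero , suc zero , s≤s () , _

    -- If y^i = 1 then also y^gcd(i,N) = 1. Were gcd(i,N) a proper divisor of N, it would divide N /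
    -- ℓ for some prime ℓ, against the exactness of the order of y.
    primitiveRoot : NonZero N → PrimitiveRoot
    primitiveRoot nzN with ∃-exactOrder nzN N ∣-refl
    ... | y , y^N , proper = record
      { g = y ; g≢0 = x^n≡1⇒x≢0 N y^N ; g^N≡1 = y^N ; order = ord }
      where
      instance _ = nzN
      ord : ∀ i → y ^ i ≡ 1# → N ∣ i
      ord i e with gcd[m,n]∣n i N
      ... | divides s N≡ with s ℕₚ.≟ 1
      ...   | yes refl = subst (_∣ i) (sym (trans N≡ (ℕₚ.+-identityʳ _))) (gcd[m,n]∣m i N)
      ...   | no s≢1 with ∃-prime-divisor s {{ℕₚ.m*n≢0⇒m≢0 s {{subst NonZero N≡ nzN}}}} s≢1
      ...     | ℓ , pr , divides s′ s≡ = ⊥-elim (proper ℓ (s′ ℕ.* gcd i N) pr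
                (trans N≡ (trans (cong (ℕ._* gcd i N) (trans s≡ (ℕₚ.*-comm s′ ℓ))) (ℕₚ.*-assoc ℓ s′ _)))
                (^-∣ (^-gcd i N e y^N) (n∣m*n s′)))

-- The field of residues modulo a prime.

module PrimeFields where
  open FiniteFields
  open import Data.Nat
  open import Data.Nat.Properties
  open import Data.Nat.DivMod
  open import Data.Nat.Divisibility
  open import Data.Nat.Primality
  open import Data.Nat.GCD using (module Bézout)
  open import Data.Nat.Coprimality using (coprime-Bézout; prime⇒coprime)
  open import Data.Nat.Solver using (module +-*-Solver)
  open import Data.Fin using (Fin; toℕ; fromℕ<)
  open import Data.Fin.Properties using (toℕ-injective; toℕ-fromℕ<; toℕ<n) renaming (_≟_ to _≟F_)
  open import Data.Product using (_,_; ∃-syntax; proj₁; proj₂)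
  open import Data.Empty using (⊥-elim)
  open import Algebra.Structures using (IsCommutativeRing)
  open import Relation.Nullary using (yes; no)
  open import Relation.Binary.PropositionalEquality hiding ([_])
  open import Relation.Binary.PropositionalEquality.Properties using (isEquivalence)
  open Bézout using (module Identity)

  module PrimeField {p : ℕ} (pr : Prime p) where
    open ≡-Reasoning
    instance
      p≢0 : NonZero p
      p≢0 = prime⇒nonZero pr

    [_] : ℕ → Fin p
    [ n ] = fromℕ< (m%n<n n p)

    toℕ-[] : ∀ n → toℕ [ n ] ≡ n % p
    toℕ-[] n = toℕ-fromℕ< (m%n<n n p)

    []-cong : ∀ {m n} → m % p ≡ n % p → [ m ] ≡ [ n ]
    []-cong {m} {n} e = toℕ-injective (trans (toℕ-[] m) (trans e (sym (toℕ-[] n))))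

    []-toℕ : ∀ x → x ≡ [ toℕ x ]
    []-toℕ x = toℕ-injective (sym (trans (toℕ-[] (toℕ x)) (m<n⇒m%n≡m (toℕ<n x))))

    _⊕_ _⊗_ : Fin p → Fin p → Fin p
    x ⊕ y = [ toℕ x + toℕ y ]
    x ⊗ y = [ toℕ x * toℕ y ]
    ⊖_ : Fin p → Fin p
    ⊖ x = [ p ∸ toℕ x ]

    []-+ : ∀ m n → [ m ] ⊕ [ n ] ≡ [ m + n ]
    []-+ m n = []-cong (trans (cong₂ (λ a b → (a + b) % p) (toℕ-[] m) (toℕ-[] n)) (sym (%-distribˡ-+ m n p)))

    []-* : ∀ m n → [ m ] ⊗ [ n ] ≡ [ m * n ]
    []-* m n = []-cong (trans (cong₂ (λ a b → (a * b) % p) (toℕ-[] m) (toℕ-[] n)) (sym (%-distribˡ-* m n p)))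

    []≡0⇒∣ : ∀ {n} → [ n ] ≡ [ 0 ] → p ∣ n
    []≡0⇒∣ {n} e = m%n≡0⇒n∣m n p (trans (sym (toℕ-[] n)) (trans (cong toℕ e) (trans (toℕ-[] 0) (m<n⇒m%n≡m (>-nonZero⁻¹ p)))))

    ∣⇒[]≡0 : ∀ {n} → p ∣ n → [ n ] ≡ [ 0 ]
    ∣⇒[]≡0 {n} h = []-cong (trans (n∣m⇒m%n≡0 n p h) (sym (m<n⇒m%n≡m (>-nonZero⁻¹ p))))

    ⊕-[] : ∀ x m → x ⊕ [ m ] ≡ [ toℕ x + m ]
    ⊕-[] x m = trans (cong (_⊕ [ m ]) ([]-toℕ x)) ([]-+ _ _)

    []-⊕ : ∀ m x → [ m ] ⊕ x ≡ [ m + toℕ x ]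
    []-⊕ m x = trans (cong ([ m ] ⊕_) ([]-toℕ x)) ([]-+ _ _)

    ⊗-[] : ∀ x m → x ⊗ [ m ] ≡ [ toℕ x * m ]
    ⊗-[] x m = trans (cong (_⊗ [ m ]) ([]-toℕ x)) ([]-* _ _)

    []-⊗ : ∀ m x → [ m ] ⊗ x ≡ [ m * toℕ x ]
    []-⊗ m x = trans (cong ([ m ] ⊗_) ([]-toℕ x)) ([]-* _ _)

    ⊕-comm : ∀ x y → x ⊕ y ≡ y ⊕ x
    ⊕-comm x y = cong [_] (+-comm (toℕ x) (toℕ y))
    ⊗-comm : ∀ x y → x ⊗ y ≡ y ⊗ x
    ⊗-comm x y = cong [_] (*-comm (toℕ x) (toℕ y))
    ⊕-identityˡ : ∀ x → [ 0 ] ⊕ x ≡ x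
    ⊕-identityˡ x = trans ([]-⊕ 0 x) (sym ([]-toℕ x))
    ⊗-identityˡ : ∀ x → [ 1 ] ⊗ x ≡ x
    ⊗-identityˡ x = trans ([]-⊗ 1 x) (trans (cong [_] (*-identityˡ _)) (sym ([]-toℕ x)))
    ⊕-assoc : ∀ x y z → (x ⊕ y) ⊕ z ≡ x ⊕ (y ⊕ z)
    ⊕-assoc x y z = trans ([]-⊕ _ z) (trans (cong [_] (+-assoc (toℕ x) (toℕ y) (toℕ z))) (sym (⊕-[] x _)))
    ⊗-assoc : ∀ x y z → (x ⊗ y) ⊗ z ≡ x ⊗ (y ⊗ z)
    ⊗-assoc x y z = trans ([]-⊗ _ z) (trans (cong [_] (*-assoc (toℕ x) (toℕ y) (toℕ z))) (sym (⊗-[] x _)))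
    ⊗-distribˡ-⊕ : ∀ x y z → x ⊗ (y ⊕ z) ≡ (x ⊗ y) ⊕ (x ⊗ z)
    ⊗-distribˡ-⊕ x y z = trans (⊗-[] x _) (trans (cong [_] (*-distribˡ-+ (toℕ x) (toℕ y) (toℕ z))) (sym ([]-+ _ _)))
    ⊖-inverseʳ : ∀ x → x ⊕ (⊖ x) ≡ [ 0 ]
    ⊖-inverseʳ x = trans (⊕-[] x _) (∣⇒[]≡0 (∣-reflexive (sym (m+[n∸m]≡n (<⇒≤ (toℕ<n x))))))

    isCommutativeRing : IsCommutativeRing _≡_ _⊕_ _⊗_ ⊖_ [ 0 ] [ 1 ]
    isCommutativeRing = record
      { isRing = record
        { +-isAbelianGroup = record
          { isGroup = record
            { isMonoid = record
              { isSemigroup = record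
                { isMagma = record { isEquivalence = isEquivalence ; ∙-cong = cong₂ _⊕_ }
                ; assoc = ⊕-assoc }
              ; identity = ⊕-identityˡ , λ x → trans (⊕-comm x _) (⊕-identityˡ x) }
            ; inverse = (λ x → trans (⊕-comm _ x) (⊖-inverseʳ x)) , ⊖-inverseʳ
            ; ⁻¹-cong = cong ⊖_ }
          ; comm = ⊕-comm }
        ; *-cong = cong₂ _⊗_
        ; *-assoc = ⊗-assoc
        ; *-identity = ⊗-identityˡ , λ x → trans (⊗-comm x _) (⊗-identityˡ x)
        ; distrib = ⊗-distribˡ-⊕ , λ x y z → trans (⊗-comm _ x) (trans (⊗-distribˡ-⊕ x y z) (cong₂ _⊕_ (⊗-comm x y) (⊗-comm x z)))
        }
      ; *-comm = ⊗-comm }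

    inverse : ∀ x → x ≢ [ 0 ] → ∃[ y ] x ⊗ y ≡ [ 1 ]
    inverse x x≢0 with coprime-Bézout (prime⇒coprime pr {{x≢0′}} (toℕ<n x))
      where
      x≢0′ : NonZero (toℕ x)
      x≢0′ = ≢-nonZero λ e → x≢0 (trans ([]-toℕ x) (cong [_] e))
    ... | Identity.-+ s t eq = [ t ] , (begin
      x ⊗ [ t ]          ≡⟨ ⊗-[] x t ⟩
      [ toℕ x * t ]      ≡⟨ cong [_] (trans (*-comm (toℕ x) t) (sym eq)) ⟩
      [ 1 + s * p ]      ≡⟨ []-cong ([m+kn]%n≡m%n 1 s p) ⟩
      [ 1 ] ∎)
    -- Here 1 + t x = s p, so the inverse of x is -t, represented by the natural number t (p - 1).
    ... | Identity.+- s t eq = [ t * pred p ] , (begin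
      x ⊗ [ t * pred p ]                 ≡⟨ ⊗-[] x _ ⟩
      [ toℕ x * (t * pred p) ]           ≡⟨ []-cong (sym ([m+n]%n≡m%n (toℕ x * (t * pred p)) p)) ⟩
      [ toℕ x * (t * pred p) + p ]       ≡⟨ cong (λ p′ → [ toℕ x * (t * pred p) + p′ ]) (sym (suc-pred p)) ⟩
      [ toℕ x * (t * p′) + suc p′ ]      ≡⟨ cong [_] (solve 3 (λ x t p′ → x :* (t :* p′) :+ (con 1 :+ p′) := con 1 :+ (con 1 :+ t :* x) :* p′) refl (toℕ x) t p′) ⟩
      [ 1 + (1 + t * toℕ x) * p′ ]       ≡⟨ cong (λ u → [ 1 + u * p′ ]) eq ⟩
      [ 1 + s * p * p′ ]                 ≡⟨ cong (λ u → [ 1 + u ]) (solve 3 (λ s p p′ → s :* p :* p′ := s :* p′ :* p) refl s p p′) ⟩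
      [ 1 + s * p′ * p ]                 ≡⟨ []-cong ([m+kn]%n≡m%n 1 (s * p′) p) ⟩
      [ 1 ] ∎)
      where
      open +-*-Solver
      p′ = pred p

    inv : Fin p → Fin p
    inv x with x ≟F [ 0 ]
    ... | yes _ = [ 0 ]
    ... | no x≢0 = proj₁ (inverse x x≢0)

    inv-inverseʳ : ∀ x → x ≢ [ 0 ] → x ⊗ inv x ≡ [ 1 ]
    inv-inverseʳ x x≢0 with x ≟F [ 0 ]
    ... | yes e = ⊥-elim (x≢0 e)
    ... | no x≢0′ = proj₂ (inverse x x≢0′)

    primeField : FiniteField p
    primeField = record
      { _+_ = _⊕_ ; _*_ = _⊗_ ; -_ = ⊖_ ; 0# = [ 0 ] ; 1# = [ 1 ]
      ; isCommutativeRing = isCommutativeRing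
      ; 1≢0 = λ e → ¬prime[1] (subst Prime (∣1⇒≡1 ([]≡0⇒∣ e)) pr)
      ; _⁻¹ = inv
      ; ⁻¹-inverseʳ = inv-inverseʳ
      }

  -- Besides the field, only the homomorphism from the natural numbers is kept, with the multiples
  -- of p as the elements sent to zero. It translates between divisibility by p and equations in the
  -- field.
  record ResidueField (p : ℕ) : Set where
    field
      field′ : FiniteField p
    open FiniteField field′ using () renaming (_+_ to _+′_; _*_ to _*′_; 0# to 0′; 1# to 1′)
    field
      [_]     : ℕ → Fin p
      []-+    : ∀ m n → [ m ] +′ [ n ] ≡ [ m + n ]
      []-*    : ∀ m n → [ m ] *′ [ n ] ≡ [ m * n ]
      [1]≡1   : [ 1 ] ≡ 1′
      []≡0⇒∣ : ∀ {n} → [ n ] ≡ 0′ → p ∣ n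
      ∣⇒[]≡0 : ∀ {n} → p ∣ n → [ n ] ≡ 0′

  abstract
    residueField : ∀ {p} → Prime p → ResidueField p
    residueField pr = record
      { field′ = primeField ; [_] = [_] ; []-+ = []-+ ; []-* = []-* ; [1]≡1 = refl ; []≡0⇒∣ = []≡0⇒∣ ; ∣⇒[]≡0 = ∣⇒[]≡0 }
      where open PrimeField pr

-- Arbitrarily large primes congruent to 1 modulo M.

module PrimesInProgressions where
  open FiniteFields
  open FieldLemmas
  open MultiplicativeGroups
  open PrimeDivisors
  open PrimeFields
  open import Data.Nat
  open import Data.Nat.Properties
  open import Data.Nat.Divisibility
  open import Data.Nat.Primality
  open import Data.Nat.GCD
  open import Data.Nat.Coprimality using (Coprime; coprime-divisor)
  open import Data.Nat.Solver using (module +-*-Solver)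
  open import Data.Sum using (inj₁; inj₂)
  open import Data.Product using (_×_; _,_; ∃-syntax)
  open import Data.Empty using (⊥-elim)
  open import Relation.Nullary
  open import Relation.Binary.PropositionalEquality hiding ([_])

  geometric : ℕ → ℕ → ℕ
  geometric y zero = 0
  geometric y (suc n) = 1 + y * geometric y n

  module _ where
    open +-*-Solver
    geometric-sum : ∀ z n → suc z ^ n ≡ 1 + z * geometric (suc z) n
    geometric-sum z zero = cong suc (sym (*-zeroʳ z))
    geometric-sum z (suc n) = trans (cong (suc z *_) (geometric-sum z n))
      (solve 2 (λ z s → (con 1 :+ z) :* (con 1 :+ z :* s) := con 1 :+ z :* (con 1 :+ (con 1 :+ z) :* s)) refl z (geometric (suc z) n))

    -- Modulo z every power of `suc z` is 1. A prime that divides both z and the geometric sum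
    -- therefore divides its length n.
    geometric-≡-length : ∀ z n → ∃[ s ] geometric (suc z) n ≡ n + z * s
    geometric-≡-length z zero = 0 , sym (*-zeroʳ z)
    geometric-≡-length z (suc n) with geometric-≡-length z n
    ... | s , e = (n + s + z * s) , trans (cong (λ t → 1 + suc z * t) e)
      (solve 3 (λ z n s → con 1 :+ (con 1 :+ z) :* (n :+ z :* s) := (con 1 :+ n) :+ z :* (n :+ s :+ z :* s)) refl z n s)

  coprime-^ˡ : ∀ {ℓ n} a → Prime ℓ → ¬ ℓ ∣ n → Coprime (ℓ ^ a) n
  coprime-^ˡ {ℓ} {n} a pr ℓ∤n {zero} (h , _) = ⊥-elim (≢-nonZero⁻¹ (ℓ ^ a) {{m^n≢0 ℓ a {{prime⇒nonZero pr}}}} (0∣⇒≡0 h))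
  coprime-^ˡ {ℓ} {n} a pr ℓ∤n {d@(suc _)} (d∣ℓᵃ , d∣n) with d ≟ 1
  ... | yes d≡1 = d≡1
  ... | no d≢1 with ∃-prime-divisor d d≢1
  ...   | s , prs , s∣d = ⊥-elim (ℓ∤n (subst (_∣ n) (prime∣prime⇒≡ prs pr (prime∣^⇒∣ ℓ a prs (∣-trans s∣d d∣ℓᵃ))) (∣-trans s∣d d∣n)))

  n<2^n : ∀ n → n < 2 ^ n
  n<2^n zero = s≤s z≤n
  n<2^n (suc n) = ≤-trans (+-mono-≤ (m^n>0 2 n) (n<2^n n)) (≤-reflexive (cong (2 ^ n +_) (sym (+-identityʳ (2 ^ n)))))

  -- A prime q dividing (M^K - 1) / (M^(K/ℓᴹ) - 1) for every ℓ ∣ M, where K = M^(M+1):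
  -- the order of M modulo q divides K but no K/ℓᴹ, which forces M ∣ q - 1.
  module PrimeOneMod (M : ℕ) (2≤M : 2 ≤ M) where
    instance
      M≢0 : NonZero M
      M≢0 = >-nonZero (<-trans (s≤s z≤n) 2≤M)
      K≢0′ : NonZero (M ^ M)
      K≢0′ = m^n≢0 M M
      K≢0 : NonZero (M * M ^ M)
      K≢0 = m*n≢0 M (M ^ M)

    K = M * M ^ M
    A₀ = pred (M ^ K)

    instance
      M^K≢0 : NonZero (M ^ K)
      M^K≢0 = m^n≢0 M K

    sucA : suc A₀ ≡ M ^ K
    sucA = suc-pred (M ^ K)

    -- This is K / ℓᴹ when M = ℓ m, written without division.
    exponent : ℕ → ℕ
    exponent m = m ^ M * M

    base : ℕ → ℕ
    base m = M ^ exponent m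

    K≡ : ∀ {ℓ m} → M ≡ ℓ * m → K ≡ exponent m * ℓ ^ M
    K≡ {ℓ} {m} e = begin
      M * M ^ M                ≡⟨ cong (λ t → M * t ^ M) e ⟩
      M * (ℓ * m) ^ M          ≡⟨ cong (M *_) (^-distribʳ-* M ℓ m) ⟩
      M * (ℓ ^ M * m ^ M)      ≡⟨ solve 3 (λ a b c → a :* (b :* c) := c :* a :* b) refl M (ℓ ^ M) (m ^ M) ⟩
      m ^ M * M * ℓ ^ M ∎
      where
      open ≡-Reasoning
      open +-*-Solver
      ^-distribʳ-* : ∀ n a b → (a * b) ^ n ≡ a ^ n * b ^ n
      ^-distribʳ-* zero a b = refl
      ^-distribʳ-* (suc n) a b = trans (cong (a * b *_) (^-distribʳ-* n a b))
        (solve 4 (λ a b c d → a :* b :* (c :* d) := a :* c :* (b :* d)) refl a b (a ^ n) (b ^ n))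

    suc-pred-base : ∀ m → suc (pred (base m)) ≡ base m
    suc-pred-base m = suc-pred (base m) {{m^n≢0 M (exponent m)}}

    A-factor : ∀ {ℓ m} → M ≡ ℓ * m → A₀ ≡ pred (base m) * geometric (base m) (ℓ ^ M)
    A-factor {ℓ} {m} e = suc-injective (begin
      suc A₀                                                      ≡⟨ sucA ⟩
      M ^ K                                                       ≡⟨ cong (M ^_) (K≡ e) ⟩
      M ^ (exponent m * ℓ ^ M)                                    ≡⟨ sym (^-*-assoc M (exponent m) (ℓ ^ M)) ⟩
      base m ^ (ℓ ^ M)                                            ≡⟨ cong (_^ (ℓ ^ M)) (sym (suc-pred-base m)) ⟩
      suc (pred (base m)) ^ (ℓ ^ M)                               ≡⟨ geometric-sum (pred (base m)) (ℓ ^ M) ⟩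
      suc (pred (base m) * geometric (suc (pred (base m))) (ℓ ^ M)) ≡⟨ cong (λ t → suc (pred (base m) * geometric t (ℓ ^ M))) (suc-pred-base m) ⟩
      suc (pred (base m) * geometric (base m) (ℓ ^ M)) ∎)
      where open ≡-Reasoning

    -- G collects the common divisor of A₀ and of the quotients A₀ / (M^(K/ℓᴹ) - 1), over the
    -- divisors ℓ of M with 2 ≤ ℓ ≤ n. P is the product of the denominators and S the sum of their
    -- exponents K/ℓᴹ. From A₀ ∣ G P it follows that G ≠ 1 once P < A₀, which is what the bound on S
    -- provides.
    record Partial (n : ℕ) : Set where
      field
        G P S    : ℕ
        G∣A      : G ∣ A₀
        G∣       : ∀ ℓ m → 2 ≤ ℓ → ℓ ≤ n → M ≡ ℓ * m → G ∣ geometric (base m) (ℓ ^ M)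
        A∣GP     : A₀ ∣ G * P
        P>0      : 0 < P
        P≤       : P ≤ M ^ S
        S≤       : S * suc M ≤ n * K

    2≤M^m : ∀ m → .{{NonZero m}} → 2 ≤ M ^ m
    2≤M^m (suc m) = ≤-trans 2≤M (m≤m*n M (M ^ m) {{m^n≢0 M m}})

    partial : ∀ n → Partial n
    partial zero = record { G = A₀ ; P = 1 ; S = 0 ; G∣A = ∣-refl
      ; G∣ = λ { ℓ m 2≤ℓ z≤n e → ⊥-elim (<⇒≱ 2≤ℓ z≤n) }
      ; A∣GP = m∣m*n 1 ; P>0 = s≤s z≤n ; P≤ = ≤-refl ; S≤ = z≤n }
    partial (suc n) with partial n | 2 ≤? suc n | suc n ∣? M
    ... | r | no ℓ<2 | _ = record { Partial r
      ; G∣ = λ ℓ m 2≤ℓ ℓ≤ e → ⊥-elim (ℓ<2 (≤-trans 2≤ℓ ℓ≤)) ; S≤ = ≤-trans (Partial.S≤ r) (m≤n+m (n * K) K) }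
    ... | r | yes _ | no ℓ∤M = record { Partial r ; G∣ = G∣′ ; S≤ = ≤-trans (Partial.S≤ r) (m≤n+m (n * K) K) }
      where
      G∣′ : ∀ ℓ m → 2 ≤ ℓ → ℓ ≤ suc n → M ≡ ℓ * m → Partial.G r ∣ geometric (base m) (ℓ ^ M)
      G∣′ ℓ m 2≤ℓ ℓ≤ e with m≤n⇒m<n∨m≡n ℓ≤
      ... | inj₁ (s≤s ℓ≤n) = Partial.G∣ r ℓ m 2≤ℓ ℓ≤n e
      ... | inj₂ refl = ⊥-elim (ℓ∤M (divides m (trans e (*-comm ℓ m))))
    ... | r | yes 2≤ℓ₀ | yes (divides m₀ eq) = record
      { G = gcd G g ; P = z * P ; S = exponent m₀ + S
      ; G∣A = ∣-trans (gcd[m,n]∣m G g) G∣A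
      ; G∣ = G∣′
      ; A∣GP = subst (A₀ ∣_) (trans (sym (c*gcd[m,n]≡gcd[cm,cn] (z * P) G g)) (*-comm (z * P) (gcd G g)))
          (gcd-greatest (subst (A₀ ∣_) (solve 3 (λ g p z → z :* (g :* p) := z :* p :* g) refl G P z) (∣n⇒∣m*n z A∣GP))
            (subst (A₀ ∣_) (solve 3 (λ g p z → z :* g :* p := z :* p :* g) refl g P z) (∣m⇒∣m*n P (∣-reflexive Af))))
      ; P>0 = *-mono-≤ z>0 P>0
      ; P≤ = ≤-trans (*-mono-≤ (pred[n]≤n {base m₀}) P≤) (≤-reflexive (sym (^-distribˡ-+-* M (exponent m₀) S)))
      ; S≤ = ≤-trans (≤-reflexive (*-distribʳ-+ (suc M) (exponent m₀) S)) (+-mono-≤ e≤ S≤)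
      }
      where
      open Partial r
      open +-*-Solver
      ℓ₀ = suc n
      z = pred (base m₀)
      g = geometric (base m₀) (ℓ₀ ^ M)
      M≡ : M ≡ ℓ₀ * m₀
      M≡ = trans eq (*-comm m₀ ℓ₀)
      Af : A₀ ≡ z * g
      Af = A-factor M≡
      instance
        m₀≢0 : NonZero m₀
        m₀≢0 = m*n≢0⇒n≢0 ℓ₀ {{subst NonZero M≡ M≢0}}
        e≢0 : NonZero (exponent m₀)
        e≢0 = m*n≢0 (m₀ ^ M) M {{m^n≢0 m₀ M}}
      z>0 : 0 < z
      z>0 = s≤s⁻¹ (≤-trans (2≤M^m (exponent m₀)) (≤-reflexive (sym (suc-pred-base m₀))))
      -- The power ℓᴹ serves this estimate: M + 1 ≤ 2ᴹ ≤ ℓᴹ, so up to M exponents K/ℓᴹ still add up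
      -- to less than K.
      e≤ : exponent m₀ * suc M ≤ K
      e≤ = ≤-trans (*-monoʳ-≤ (exponent m₀) (≤-trans (n<2^n M) (^-monoˡ-≤ M 2≤ℓ₀))) (≤-reflexive (sym (K≡ M≡)))
      G∣′ : ∀ ℓ m → 2 ≤ ℓ → ℓ ≤ suc n → M ≡ ℓ * m → gcd G g ∣ geometric (base m) (ℓ ^ M)
      G∣′ ℓ m 2≤ℓ ℓ≤ e with m≤n⇒m<n∨m≡n ℓ≤
      ... | inj₁ (s≤s ℓ≤n) = ∣-trans (gcd[m,n]∣m G g) (G∣ ℓ m 2≤ℓ ℓ≤n e)
      ... | inj₂ refl with *-cancelˡ-≡ m m₀ ℓ₀ (trans (sym e) M≡)
      ...   | refl = gcd[m,n]∣n G g

    open Partial (partial M)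

    A>0 : 0 < A₀
    A>0 = s≤s⁻¹ (≤-trans (2≤M^m K) (≤-reflexive (sym sucA)))

    -- For n = M the bound reads S (M + 1) ≤ M K, hence S < K and P ≤ M^(K-1), which is below M^K -
    -- 1.
    P<A : P < A₀
    P<A = s≤s⁻¹ (begin-strict
      suc P                       ≤⟨ s≤s P≤ ⟩
      suc (M ^ S)                 <⟨ s≤s (s≤s ≤-refl) ⟩
      2 + M ^ S                   ≤⟨ +-mono-≤ (2≤M^m (pred K) {{predK≢0}}) (^-monoʳ-≤ M S≤predK) ⟩
      M ^ pred K + M ^ pred K     ≡⟨ cong (M ^ pred K +_) (sym (+-identityʳ _)) ⟩
      2 * M ^ pred K              ≤⟨ *-monoˡ-≤ (M ^ pred K) 2≤M ⟩
      M ^ suc (pred K)            ≡⟨ cong (M ^_) (suc-pred K) ⟩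
      M ^ K                       ≡⟨ sym sucA ⟩
      suc A₀ ∎)
      where
      open ≤-Reasoning
      2≤K : 2 ≤ K
      2≤K = ≤-trans 2≤M (m≤m*n M (M ^ M))
      predK≢0 : NonZero (pred K)
      predK≢0 = >-nonZero (s≤s⁻¹ (≤-trans 2≤K (≤-reflexive (sym (suc-pred K)))))
      S<K : S < K
      S<K = *-cancelʳ-< (suc M) S K (≤-<-trans S≤ (≤-<-trans (≤-reflexive (*-comm M K)) (*-monoʳ-< K (n<1+n M))))
      S≤predK : S ≤ pred K
      S≤predK = s≤s⁻¹ (≤-trans S<K (≤-reflexive (sym (suc-pred K))))

    G≢1 : G ≢ 1
    G≢1 e = <⇒≱ P<A (∣⇒≤ {{>-nonZero P>0}} (subst (A₀ ∣_) (trans (cong (_* P) e) (+-identityʳ P)) A∣GP))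

    G≢0 : NonZero G
    G≢0 = ≢-nonZero λ e → <⇒≢ A>0 (sym (0∣⇒≡0 (subst (_∣ A₀) e G∣A)))

    prime-one-mod : ∃[ q ] (Prime q × M ∣ pred q)
    prime-one-mod with ∃-prime-divisor G {{G≢0}} G≢1
    ... | q , pr , q∣G = q , pr , M∣D⇒
      where
      instance _ = prime⇒nonZero pr
      q∤M : ¬ q ∣ M
      q∤M q∣M = ¬prime[1] (subst Prime (∣1⇒≡1 (∣m+n∣m⇒∣n (subst (q ∣_) (trans (sym sucA) (+-comm 1 A₀)) q∣M^K) (∣-trans q∣G G∣A))) pr)
        where
        q∣M^K : q ∣ M ^ K
        q∣M^K = subst (λ t → q ∣ M ^ t) (suc-pred K) (∣m⇒∣m*n (M ^ pred K) q∣M)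
      -- If q divided the denominator, the quotient would be ℓᴹ modulo q. As q divides the quotient,
      -- it would divide ℓ and therefore M.
      q∤base : ∀ ℓ m → 2 ≤ ℓ → ℓ ≤ M → M ≡ ℓ * m → ¬ q ∣ pred (base m)
      q∤base ℓ m 2≤ℓ ℓ≤M e h with geometric-≡-length (pred (base m)) (ℓ ^ M)
      ... | s , geq = q∤M (∣-trans (prime∣^⇒∣ ℓ M pr q∣ℓᴹ) (divides m (trans e (*-comm ℓ m))))
        where
        q∣geo : q ∣ ℓ ^ M + pred (base m) * s
        q∣geo = subst (q ∣_) (trans (cong (λ t → geometric t (ℓ ^ M)) (sym (suc-pred-base m))) geq) (∣-trans q∣G (G∣ ℓ m 2≤ℓ ℓ≤M e))
        q∣ℓᴹ : q ∣ ℓ ^ M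
        q∣ℓᴹ = ∣m+n∣m⇒∣n (subst (q ∣_) (+-comm (ℓ ^ M) _) q∣geo) (∣m⇒∣m*n s h)

      open ResidueField (residueField pr)
      q′ = pred q
      -- Both K and q - 1 are exponents that send M to 1 modulo q, the latter by Fermat; hence so is
      -- their greatest common divisor.
      D = gcd K q′
      M^D : ∀ {e} → D ∣ e → q ∣ pred (M ^ e)
      M^D = go
        where
        module FP = FieldProperties field′
        module RP = Roots field′
        []-^ : ∀ n → [ M ] FP.^ n ≡ [ M ^ n ]
        []-^ zero = sym [1]≡1
        []-^ (suc n) = trans (cong ([ M ] FP.*_) ([]-^ n)) ([]-* M (M ^ n))
        pred⇒1 : ∀ n → q ∣ pred n → .{{NonZero n}} → [ n ] ≡ FP.1#
        pred⇒1 (suc n) h = trans (sym ([]-+ 1 n)) (trans (cong₂ FP._+_ [1]≡1 (∣⇒[]≡0 h)) (FP.+-identityʳ FP.1#))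
        1⇒pred : ∀ n → .{{NonZero n}} → [ n ] ≡ FP.1# → q ∣ pred n
        1⇒pred (suc n) h = []≡0⇒∣ (FP.x+y≡x⇒y≡0 FP.1# [ n ] (trans (cong (FP._+ [ n ]) (sym [1]≡1)) (trans ([]-+ 1 n) h)))
        fermat′ : ∀ {q} → .{{_ : NonZero q}} → (F : FiniteField q) → ∀ x → x ≢ FiniteField.0# F →
                  FieldProperties._^_ F x (pred q) ≡ FiniteField.1# F
        fermat′ {suc q} F x x≢0 = MultiplicativeGroup.fermat F x≢0
        go : ∀ {e} → D ∣ e → q ∣ pred (M ^ e)
        go {e} D∣e = 1⇒pred (M ^ e) {{m^n≢0 M e}} (trans (sym ([]-^ e)) (RP.^-∣ {[ M ]} {D} (RP.^-gcd K q′
          (trans ([]-^ K) (pred⇒1 (M ^ K) (∣-trans q∣G G∣A)))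
          (fermat′ field′ [ M ] λ h → q∤M ([]≡0⇒∣ h))) D∣e))

      D∤exponent : ∀ ℓ m → 2 ≤ ℓ → ℓ ≤ M → M ≡ ℓ * m → ¬ D ∣ exponent m
      D∤exponent ℓ m 2≤ℓ ℓ≤M e h = q∤base ℓ m 2≤ℓ ℓ≤M e (M^D h)

      -- Otherwise some prime ℓ divides M / gcd(D,M), and then ℓ does not divide D / gcd(D,M).
      -- Comparing powers of ℓ in K = M · Mᴹ shows ℓᴹ ∣ K / D, that is D ∣ K / ℓᴹ, which
      -- `D∤exponent` forbids.
      M∣D : M ∣ D
      M∣D with gcd[m,n]∣m D M | gcd[m,n]∣n D M | gcd[m,n]∣m K q′
      ... | divides D′ D≡ | divides M′ M≡ | divides J K≡JD with M′ ≟ 1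
      ...   | yes refl = ∣-trans (∣-reflexive (trans M≡ (+-identityʳ _))) (gcd[m,n]∣m D M)
      ...   | no M′≢1 with ∃-prime-divisor M′ {{m*n≢0⇒m≢0 M′ {{subst NonZero M≡ M≢0}}}} M′≢1
      ...     | ℓ , prℓ , divides m′ M′≡ = ⊥-elim (D∤exponent ℓ m (nonTrivial⇒n>1 ℓ {{prime⇒nonTrivial prℓ}}) ℓ≤M M≡ℓm D∣e)
        where
        open +-*-Solver
        g₁ = gcd D M
        instance
          _ = prime⇒nonZero prℓ
          g₁≢0 : NonZero g₁
          g₁≢0 = m*n≢0⇒n≢0 M′ {{subst NonZero M≡ M≢0}}
          ℓᴹ≢0 : NonZero (ℓ ^ M)
          ℓᴹ≢0 = m^n≢0 ℓ M
        m = m′ * g₁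
        M≡ℓm : M ≡ ℓ * m
        M≡ℓm = trans M≡ (trans (cong (_* g₁) (trans M′≡ (*-comm m′ ℓ))) (*-assoc ℓ m′ g₁))
        ℓ∣M : ℓ ∣ M
        ℓ∣M = divides m (trans M≡ℓm (*-comm ℓ m))
        ℓ≤M : ℓ ≤ M
        ℓ≤M = ∣⇒≤ ℓ∣M
        ℓ∤D′ : ¬ ℓ ∣ D′
        ℓ∤D′ (divides d e) = ¬prime[1] (subst Prime ℓ≡1 prℓ)
          where
          ℓg∣g : ℓ * g₁ ∣ g₁
          ℓg∣g = gcd-greatest
            (subst (ℓ * g₁ ∣_) (sym (trans D≡ (trans (cong (_* g₁) e) (*-assoc d ℓ g₁)))) (n∣m*n d))
            (subst (ℓ * g₁ ∣_) (sym (trans M≡ (trans (cong (_* g₁) M′≡) (*-assoc m′ ℓ g₁)))) (n∣m*n m′))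
          ℓ≡1 : ℓ ≡ 1
          ℓ≡1 = ∣1⇒≡1 (*-cancelʳ-∣ g₁ (subst (ℓ * g₁ ∣_) (sym (+-identityʳ g₁)) ℓg∣g))
        D′J : D′ * J ≡ M′ * M ^ M
        D′J = *-cancelʳ-≡ _ _ g₁ (begin
          D′ * J * g₁      ≡⟨ solve 3 (λ a b c → a :* b :* c := b :* (a :* c)) refl D′ J g₁ ⟩
          J * (D′ * g₁)    ≡⟨ cong (J *_) (sym D≡) ⟩
          J * D            ≡⟨ sym K≡JD ⟩
          M * M ^ M        ≡⟨ cong (_* M ^ M) M≡ ⟩
          M′ * g₁ * M ^ M  ≡⟨ solve 3 (λ a b c → a :* b :* c := a :* c :* b) refl M′ g₁ (M ^ M) ⟩
          M′ * M ^ M * g₁ ∎)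
          where open ≡-Reasoning
        ^-∣-mono : ∀ n → ℓ ^ n ∣ M ^ n
        ^-∣-mono zero = ∣-refl
        ^-∣-mono (suc n) = *-pres-∣ ℓ∣M (^-∣-mono n)
        ∣J⇒ : ℓ ^ M ∣ J → D ∣ exponent m
        ∣J⇒ (divides J′ J≡) = divides J′ (*-cancelʳ-≡ _ _ (ℓ ^ M) (begin
          exponent m * ℓ ^ M    ≡⟨ sym (K≡ M≡ℓm) ⟩
          K                     ≡⟨ K≡JD ⟩
          J * D                 ≡⟨ cong (_* D) J≡ ⟩
          J′ * ℓ ^ M * D        ≡⟨ solve 3 (λ a b c → a :* b :* c := a :* c :* b) refl J′ (ℓ ^ M) D ⟩
          J′ * D * ℓ ^ M ∎))
          where open ≡-Reasoning
        D∣e : D ∣ exponent m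
        D∣e = ∣J⇒ (coprime-divisor (coprime-^ˡ M prℓ ℓ∤D′) (subst (ℓ ^ M ∣_) (sym D′J) (∣n⇒∣m*n M′ (^-∣-mono M))))

      M∣D⇒ : M ∣ pred q
      M∣D⇒ = ∣-trans M∣D (gcd[m,n]∣n K q′)

  -- The modulus M (2 + B) yields primes that are 1 modulo M, and it forces q - 1 ≥ M (2 + B) > B.
  ∃-prime≡1mod : ∀ M → .{{NonZero M}} → ∀ B → ∃[ p ] (Prime (suc p) × M ∣ p × B < p)
  ∃-prime≡1mod M B = restate (PrimeOneMod.prime-one-mod (M * (2 + B)) (≤-trans (s≤s (s≤s z≤n)) (m≤n*m (2 + B) M)))
    where
    restate : ∃[ q ] (Prime q × M * (2 + B) ∣ pred q) → ∃[ p ] (Prime (suc p) × M ∣ p × B < p)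
    restate (zero , pr , _) = ⊥-elim (¬prime[0] pr)
    restate (suc zero , pr , _) = ⊥-elim (¬prime[1] pr)
    restate (suc p@(suc _) , pr , h) = p , pr , ∣-trans (m∣m*n (2 + B)) h ,
      ≤-trans (≤-trans (n≤1+n (suc B)) (m≤n*m (2 + B) M)) (∣⇒≤ h)

-- Elements whose differences lie in prescribed cyclotomic classes.

module CyclotomicClasses where
  open FiniteFields
  open FieldLemmas
  open Counting
  open MultiplicativeGroups
  open import Data.Nat as ℕ using (ℕ; zero; suc; _≤_; _<_; s≤s; z≤n; NonZero; _<?_)
  import Data.Nat.Properties as ℕₚ
  open import Data.Nat.Divisibility
  open import Data.Nat.DivMod using (_%_; m%n<n; m≡m%n+[m/n]*n)
  import Data.Nat.DivMod as DivMod
  open import Data.Nat.Solver using (module +-*-Solver)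
  open import Data.Fin as Fin using (Fin; zero; suc; toℕ; fromℕ<)
  open import Data.Fin.Properties using (toℕ<n; toℕ-injective; toℕ-fromℕ<) renaming (_≟_ to _≟F_)
  open import Data.List using (allFin)
  open import Data.List.Properties using (length-tabulate)
  open import Data.List.Membership.Propositional.Properties using (∈-allFin)
  open import Data.Sum using (inj₁; inj₂)
  open import Data.Product using (_×_; _,_; ∃-syntax; Σ-syntax; proj₁; proj₂)
  open import Function using (_∘_; id)
  open import Relation.Nullary
  open import Relation.Nullary.Decidable using (¬?; _×-dec_)
  open import Relation.Binary.PropositionalEquality

  module _ where
    open +-*-Solver
    -- (m - 2a)² ≥ 0 in general, and (m - 2a)² ≥ a² if m < a.
    deviation : ∀ m a → 4 ℕ.* a ℕ.* m ℕ.+ ind (m <? a) ℕ.* (a ℕ.* a) ≤ m ℕ.* m ℕ.+ 4 ℕ.* (a ℕ.* a)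
    deviation m a with m <? a
    ... | yes m<a with ℕₚ.m≤n⇒∃[o]m+o≡n (ℕₚ.<⇒≤ m<a)
    ...   | d , refl = ℕₚ.≤-trans (ℕₚ.m≤m+n _ (2 ℕ.* m ℕ.* d ℕ.+ 3 ℕ.* (d ℕ.* d))) (ℕₚ.≤-reflexive
            (solve 2 (λ m d → con 4 :* (m :+ d) :* m :+ con 1 :* ((m :+ d) :* (m :+ d)) :+ (con 2 :* m :* d :+ con 3 :* (d :* d))
              := m :* m :+ con 4 :* ((m :+ d) :* (m :+ d))) refl m d))
    deviation m a | no m≮a with ℕₚ.≤-total m (2 ℕ.* a)
    ... | inj₁ h with ℕₚ.m≤n⇒∃[o]m+o≡n h
    ...   | d , e = begin
      4 ℕ.* a ℕ.* m ℕ.+ 0                   ≡⟨ solve 2 (λ a m → con 4 :* a :* m :+ con 0 := con 2 :* m :* (con 2 :* a)) refl a m ⟩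
      2 ℕ.* m ℕ.* (2 ℕ.* a)                 ≡⟨ cong (2 ℕ.* m ℕ.*_) (sym e) ⟩
      2 ℕ.* m ℕ.* (m ℕ.+ d)                 ≤⟨ ℕₚ.m≤m+n _ (d ℕ.* d) ⟩
      2 ℕ.* m ℕ.* (m ℕ.+ d) ℕ.+ d ℕ.* d     ≡⟨ solve 2 (λ m d → con 2 :* m :* (m :+ d) :+ d :* d := m :* m :+ (m :+ d) :* (m :+ d)) refl m d ⟩
      m ℕ.* m ℕ.+ (m ℕ.+ d) ℕ.* (m ℕ.+ d)   ≡⟨ cong (λ t → m ℕ.* m ℕ.+ t ℕ.* t) e ⟩
      m ℕ.* m ℕ.+ 2 ℕ.* a ℕ.* (2 ℕ.* a)     ≡⟨ cong (m ℕ.* m ℕ.+_) (solve 1 (λ a → con 2 :* a :* (con 2 :* a) := con 4 :* (a :* a)) refl a) ⟩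
      m ℕ.* m ℕ.+ 4 ℕ.* (a ℕ.* a) ∎
      where
      open ℕₚ.≤-Reasoning
    deviation m a | no m≮a | inj₂ h with ℕₚ.m≤n⇒∃[o]m+o≡n h
    ... | d , refl = ℕₚ.≤-trans (ℕₚ.m≤m+n _ (d ℕ.* d)) (ℕₚ.≤-reflexive
            (solve 2 (λ a d → con 4 :* a :* (con 2 :* a :+ d) :+ con 0 :+ d :* d := (con 2 :* a :+ d) :* (con 2 :* a :+ d) :+ con 4 :* (a :* a)) refl a d))


  -- The Chebyshev bound proved in `count-bad`, for a set with at least q / D elements.
  bad-bound : ℕ → ℕ → ℕ
  bad-bound E D = 4 ℕ.* E ℕ.* E ℕ.* D ℕ.+ 4 ℕ.* E

  -- The second argument of bad-bound and the third of threshold bound q / |A| for the candidate sets A.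
  threshold : ℕ → ℕ → ℕ → ℕ
  threshold E zero D = 0
  threshold E (suc m) D = suc (D ℕ.* (m ℕ.* bad-bound E D)) ℕ.+ threshold E m (D ℕ.* (2 ℕ.* E))

  module Differences {q : ℕ} (F : FiniteField q) (E f : ℕ) {{E≢0 : NonZero E}} {{f≢0 : NonZero f}} (q≡ : q ≡ suc (E ℕ.* f))
                     (ζ : Fin E → Fin q) (ζ-injective : ∀ {e e′} → ζ e ≡ ζ e′ → e ≡ e′)
                     (ζ≢0 : ∀ e → ζ e ≢ FiniteField.0# F)
                     (∃-ζ : ∀ {x} → x ≢ FiniteField.0# F → ∃[ e ] ζ e ≡ FieldProperties._^_ F x f) where
    open FieldProperties F
    open Roots F

    χ : Fin q → Fin q
    χ x = x ^ f

    module SecondMoment {A : Fin q → Set} (A? : ∀ x → Dec (A x)) where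
      a : ℕ
      a = count A?

      α : Fin q → ℕ
      α x = ind (A? x)

      c : Fin E → Fin q → Fin q → ℕ
      c e x y = ind (χ (y - x) ≟F ζ e)

      N-in : Fin E → Fin q → ℕ
      N-in e x = count (λ y → A? y ×-dec (χ (y - x) ≟F ζ e))

      -- On average over x and e, about a / E points y of A have y - x in class e. A point is bad
      -- when it sees less than half of that.
      bad : Fin E → Fin q → ℕ
      bad e x = ind (2 ℕ.* E ℕ.* N-in e x <? a)

      N-in≡ : ∀ e x → N-in e x ≡ ∑[ y < q ] (α y ℕ.* c e x y)
      N-in≡ e x = sum-cong-≗ λ y → ind-× (A? y) (χ (y - x) ≟F ζ e)

      ∑c : ∀ x y → ∑[ e < E ] c e x y ≡ ind (¬? (x ≟F y))
      ∑c x y with x ≟F y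
      ... | yes refl = count-none {n = E} (λ e → χ (x - x) ≟F ζ e) λ e h → ζ≢0 e
              (trans (sym h) (trans (cong χ (-‿inverseʳ x)) (0^n≡0 f)))
      ... | no x≢y = ℕₚ.≤-antisym
              (count-unique {n = E} (λ e → χ (y - x) ≟F ζ e) λ e e′ h h′ → ζ-injective (trans (sym h) h′))
              (ℕₚ.≤-trans (ℕₚ.≤-reflexive (sym (ind-yes (χ (y - x) ≟F ζ e₀) (sym (proj₂ ∃e)))))
                (term≤sum (λ e → c e x y) e₀))
        where
        ∃e = ∃-ζ (x≢y⇒x-y≢0 (x≢y ∘ sym))
        e₀ = proj₁ ∃e

      ∑c≤1 : ∀ x y → ∑[ e < E ] c e x y ≤ 1
      ∑c≤1 x y = ℕₚ.≤-trans (ℕₚ.≤-reflexive (∑c x y)) (ind-mono (¬? (x ≟F y)) (yes refl) λ _ → refl {x = x})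

      ∑≢ : ∀ y → ∑[ x < q ] ind (¬? (x ≟F y)) ≡ E ℕ.* f
      ∑≢ y = ℕₚ.suc-injective (trans (cong (ℕ._+ count (λ x → ¬? (x ≟F y))) (sym (count-≡ y))) (trans (count+count¬ (_≟F y)) q≡))

      ∑∑N : ∑[ x < q ] ∑[ e < E ] N-in e x ≡ a ℕ.* (E ℕ.* f)
      ∑∑N = begin
        ∑[ x < q ] ∑[ e < E ] N-in e x
          ≡⟨ sum-cong-≗ (λ x → sum-cong-≗ λ e → N-in≡ e x) ⟩
        ∑[ x < q ] ∑[ e < E ] ∑[ y < q ] (α y ℕ.* c e x y)
          ≡⟨ sum-cong-≗ (λ x → ∑-comm (λ e y → α y ℕ.* c e x y)) ⟩
        ∑[ x < q ] ∑[ y < q ] ∑[ e < E ] (α y ℕ.* c e x y)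
          ≡⟨ sum-cong-≗ (λ x → sum-cong-≗ λ y → trans (sym (*-distribˡ-sum (α y) (λ e → c e x y))) (cong (α y ℕ.*_) (∑c x y))) ⟩
        ∑[ x < q ] ∑[ y < q ] (α y ℕ.* ind (¬? (x ≟F y)))
          ≡⟨ ∑-comm (λ x y → α y ℕ.* ind (¬? (x ≟F y))) ⟩
        ∑[ y < q ] ∑[ x < q ] (α y ℕ.* ind (¬? (x ≟F y)))
          ≡⟨ sum-cong-≗ (λ y → trans (sym (*-distribˡ-sum (α y) (λ x → ind (¬? (x ≟F y))))) (cong (α y ℕ.*_) (∑≢ y))) ⟩
        ∑[ y < q ] (α y ℕ.* (E ℕ.* f))
          ≡⟨ sym (*-distribʳ-sum (E ℕ.* f) α) ⟩
        a ℕ.* (E ℕ.* f) ∎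
        where open ≡-Reasoning

      -- For y ≠ y′, the map x ↦ (y - x) / (y′ - x) is injective, and its value is an f-th root of unity
      -- when y - x and y′ - x lie in the same class.
      same-class : ∀ {y y′} → y ≢ y′ → ∑[ x < q ] ∑[ e < E ] (c e x y ℕ.* c e x y′) ≤ f
      same-class {y} {y′} y≢y′ = ℕₚ.≤-trans (sum-mono inner) (ℕₚ.≤-trans
        (count-injective S? (λ u → u ^ f ≟F 1#) ψ (λ x (_ , y′-x≢0 , h) → S⇒ x y′-x≢0 h)
          (λ i j (_ , i≢ , _) (_ , j≢ , _) → möbius-injective y≢y′ i≢ j≢)) (count-^≡ f 1#))
        where
        S? = λ x → ¬? (y - x ≟F 0#) ×-dec (¬? (y′ - x ≟F 0#) ×-dec (χ (y - x) ≟F χ (y′ - x)))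
        ψ : Fin q → Fin q
        ψ x = (y - x) / (y′ - x)
        S⇒ : ∀ x → y′ - x ≢ 0# → χ (y - x) ≡ χ (y′ - x) → ψ x ^ f ≡ 1#
        S⇒ x y′-x≢0 h = trans (^-/ (y - x) f y′-x≢0) (trans (cong (_/ χ (y′ - x)) h) (⁻¹-inverseʳ _ (^-≢0 f y′-x≢0)))
        inner : ∀ x → ∑[ e < E ] (c e x y ℕ.* c e x y′) ≤ ind (S? x)
        inner x = ℕₚ.≤-trans (ℕₚ.≤-reflexive (sum-cong-≗ {E} λ e → sym (ind-× (χ (y - x) ≟F ζ e) (χ (y′ - x) ≟F ζ e))))
          (lem (S? x))
          where
          both? : ∀ e → Dec (χ (y - x) ≡ ζ e × χ (y′ - x) ≡ ζ e)
          both? e = (χ (y - x) ≟F ζ e) ×-dec (χ (y′ - x) ≟F ζ e)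
          χ≡ζ⇒≢0 : ∀ {z e} → χ z ≡ ζ e → z ≢ 0#
          χ≡ζ⇒≢0 {e = e} h z≡0 = ζ≢0 e (trans (sym h) (trans (cong χ z≡0) (0^n≡0 f)))
          lem : (s : Dec (y - x ≢ 0# × y′ - x ≢ 0# × χ (y - x) ≡ χ (y′ - x))) → count both? ≤ ind s
          lem (yes _) = count-unique both? λ e e′ (h , _) (h′ , _) → ζ-injective (trans (sym h) h′)
          lem (no ¬s) = ℕₚ.≤-reflexive (count-none both? λ e (h , h′) → ¬s (χ≡ζ⇒≢0 {e = e} h , χ≡ζ⇒≢0 {e = e} h′ , trans h (sym h′)))

      pair-bound : ∀ y y′ → ∑[ x < q ] ∑[ e < E ] (c e x y ℕ.* c e x y′) ≤ ind (y′ ≟F y) ℕ.* q ℕ.+ f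
      pair-bound y y′ with y′ ≟F y
      ... | no y′≢y = same-class (y′≢y ∘ sym)
      ... | yes refl = ℕₚ.≤-trans (sum-mono λ x → ℕₚ.≤-trans (ℕₚ.≤-reflexive (sum-cong-≗ λ e → ind-idem (χ (y - x) ≟F ζ e))) (∑c≤1 x y))
              (ℕₚ.≤-trans (ℕₚ.≤-reflexive (trans (sum-const q 1) (sym (ℕₚ.*-comm 1 q)))) (ℕₚ.m≤m+n (1 ℕ.* q) f))

      -- The square counts pairs y, y′ in A lying in the same class as seen from x. Each pair
      -- contributes at most f by `same-class`, and a diagonal pair at most q more.
      ∑∑N² : ∑[ x < q ] ∑[ e < E ] (N-in e x ℕ.* N-in e x) ≤ a ℕ.* q ℕ.+ a ℕ.* a ℕ.* f
      ∑∑N² = begin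
        ∑[ x < q ] ∑[ e < E ] (N-in e x ℕ.* N-in e x)
          ≡⟨ sum-cong-≗ (λ x → sum-cong-≗ λ e → square e x) ⟩
        ∑[ x < q ] ∑[ e < E ] ∑[ y < q ] ∑[ y′ < q ] (α y ℕ.* α y′ ℕ.* (c e x y ℕ.* c e x y′))
          ≡⟨ sum-cong-≗ (λ x → trans (∑-comm (λ e y → ∑[ y′ < q ] (α y ℕ.* α y′ ℕ.* (c e x y ℕ.* c e x y′))))
               (sum-cong-≗ λ y → trans (∑-comm (λ e y′ → α y ℕ.* α y′ ℕ.* (c e x y ℕ.* c e x y′)))
                 (sum-cong-≗ λ y′ → sym (*-distribˡ-sum (α y ℕ.* α y′) (λ e → c e x y ℕ.* c e x y′))))) ⟩
        ∑[ x < q ] ∑[ y < q ] ∑[ y′ < q ] (α y ℕ.* α y′ ℕ.* ∑[ e < E ] (c e x y ℕ.* c e x y′))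
          ≡⟨ trans (∑-comm (λ x y → ∑[ y′ < q ] (α y ℕ.* α y′ ℕ.* ∑[ e < E ] (c e x y ℕ.* c e x y′))))
               (sum-cong-≗ λ y → trans (∑-comm (λ x y′ → α y ℕ.* α y′ ℕ.* ∑[ e < E ] (c e x y ℕ.* c e x y′)))
                 (sum-cong-≗ λ y′ → sym (*-distribˡ-sum (α y ℕ.* α y′) (λ x → ∑[ e < E ] (c e x y ℕ.* c e x y′))))) ⟩
        ∑[ y < q ] ∑[ y′ < q ] (α y ℕ.* α y′ ℕ.* ∑[ x < q ] ∑[ e < E ] (c e x y ℕ.* c e x y′))
          ≤⟨ sum-mono (λ y → sum-mono λ y′ → ℕₚ.*-monoʳ-≤ (α y ℕ.* α y′) (pair-bound y y′)) ⟩
        ∑[ y < q ] ∑[ y′ < q ] (α y ℕ.* α y′ ℕ.* (ind (y′ ≟F y) ℕ.* q ℕ.+ f))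
          ≡⟨ sum-cong-≗ row ⟩
        ∑[ y < q ] (α y ℕ.* (q ℕ.+ a ℕ.* f))
          ≡⟨ sym (*-distribʳ-sum (q ℕ.+ a ℕ.* f) α) ⟩
        a ℕ.* (q ℕ.+ a ℕ.* f)
          ≡⟨ trans (ℕₚ.*-distribˡ-+ a q (a ℕ.* f)) (cong (a ℕ.* q ℕ.+_) (sym (ℕₚ.*-assoc a a f))) ⟩
        a ℕ.* q ℕ.+ a ℕ.* a ℕ.* f ∎
        where
        open ℕₚ.≤-Reasoning
        module S = +-*-Solver
        square : ∀ e x → N-in e x ℕ.* N-in e x ≡ ∑[ y < q ] ∑[ y′ < q ] (α y ℕ.* α y′ ℕ.* (c e x y ℕ.* c e x y′))
        square e x = trans (cong₂ ℕ._*_ (N-in≡ e x) (N-in≡ e x))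
          (trans (*-distribʳ-sum (∑[ y′ < q ] (α y′ ℕ.* c e x y′)) (λ y → α y ℕ.* c e x y))
            (sum-cong-≗ λ y → trans (*-distribˡ-sum (α y ℕ.* c e x y) (λ y′ → α y′ ℕ.* c e x y′))
              (sum-cong-≗ λ y′ → S.solve 4 (λ a c a′ c′ → a S.:* c S.:* (a′ S.:* c′) S.:= a S.:* a′ S.:* (c S.:* c′)) refl
                (α y) (c e x y) (α y′) (c e x y′))))
        row : ∀ y → ∑[ y′ < q ] (α y ℕ.* α y′ ℕ.* (ind (y′ ≟F y) ℕ.* q ℕ.+ f)) ≡ α y ℕ.* (q ℕ.+ a ℕ.* f)
        row y = begin-equality
          ∑[ y′ < q ] (α y ℕ.* α y′ ℕ.* (ind (y′ ≟F y) ℕ.* q ℕ.+ f))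
            ≡⟨ sum-cong-≗ (λ y′ → S.solve 5 (λ a a′ i q f → a S.:* a′ S.:* (i S.:* q S.:+ f) S.:= i S.:* (a S.:* a′ S.:* q) S.:+ a′ S.:* (a S.:* f)) refl
                 (α y) (α y′) (ind (y′ ≟F y)) q f) ⟩
          ∑[ y′ < q ] (ind (y′ ≟F y) ℕ.* (α y ℕ.* α y′ ℕ.* q) ℕ.+ α y′ ℕ.* (α y ℕ.* f))
            ≡⟨ ∑-distrib-+ (λ y′ → ind (y′ ≟F y) ℕ.* (α y ℕ.* α y′ ℕ.* q)) (λ y′ → α y′ ℕ.* (α y ℕ.* f)) ⟩
          ∑[ y′ < q ] (ind (y′ ≟F y) ℕ.* (α y ℕ.* α y′ ℕ.* q)) ℕ.+ ∑[ y′ < q ] (α y′ ℕ.* (α y ℕ.* f))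
            ≡⟨ cong₂ ℕ._+_ (sum-δ (λ y′ → α y ℕ.* α y′ ℕ.* q) y) (sym (*-distribʳ-sum (α y ℕ.* f) α)) ⟩
          α y ℕ.* α y ℕ.* q ℕ.+ a ℕ.* (α y ℕ.* f)
            ≡⟨ cong (λ t → t ℕ.* q ℕ.+ a ℕ.* (α y ℕ.* f)) (ind-idem (A? y)) ⟩
          α y ℕ.* q ℕ.+ a ℕ.* (α y ℕ.* f)
            ≡⟨ S.solve 4 (λ α q a f → α S.:* q S.:+ a S.:* (α S.:* f) S.:= α S.:* (q S.:+ a S.:* f)) refl (α y) q a f ⟩
          α y ℕ.* (q ℕ.+ a ℕ.* f) ∎

      ∑∑bad : ℕ
      ∑∑bad = ∑[ x < q ] ∑[ e < E ] bad e x

      -- `deviation` with m = 2 E `N-in` and the size a of A, summed over all x and e. The first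
      -- moment is exact by `∑∑N`, the second is bounded by `∑∑N²`.
      variance : 8 ℕ.* E ℕ.* a ℕ.* (a ℕ.* (E ℕ.* f)) ℕ.+ ∑∑bad ℕ.* (a ℕ.* a) ≤
                 4 ℕ.* E ℕ.* E ℕ.* (a ℕ.* q ℕ.+ a ℕ.* a ℕ.* f) ℕ.+ q ℕ.* (E ℕ.* (4 ℕ.* (a ℕ.* a)))
      variance = begin
        8 ℕ.* E ℕ.* a ℕ.* (a ℕ.* (E ℕ.* f)) ℕ.+ ∑∑bad ℕ.* (a ℕ.* a)
          ≡⟨ cong₂ ℕ._+_ (trans (cong (8 ℕ.* E ℕ.* a ℕ.*_) (sym ∑∑N)) (sum₂-*ˡ (8 ℕ.* E ℕ.* a) (λ x e → N-in e x)))
               (trans (ℕₚ.*-comm ∑∑bad (a ℕ.* a)) (sum₂-*ˡ (a ℕ.* a) (λ x e → bad e x))) ⟩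
        ∑[ x < q ] ∑[ e < E ] (8 ℕ.* E ℕ.* a ℕ.* N-in e x) ℕ.+ ∑[ x < q ] ∑[ e < E ] (a ℕ.* a ℕ.* bad e x)
          ≡⟨ sym (sum₂-+ (λ x e → 8 ℕ.* E ℕ.* a ℕ.* N-in e x) (λ x e → a ℕ.* a ℕ.* bad e x)) ⟩
        ∑[ x < q ] ∑[ e < E ] (8 ℕ.* E ℕ.* a ℕ.* N-in e x ℕ.+ a ℕ.* a ℕ.* bad e x)
          ≤⟨ sum-mono (λ x → sum-mono λ e → pointwise e x) ⟩
        ∑[ x < q ] ∑[ e < E ] (4 ℕ.* E ℕ.* E ℕ.* (N-in e x ℕ.* N-in e x) ℕ.+ 4 ℕ.* (a ℕ.* a))
          ≡⟨ sum₂-+ (λ x e → 4 ℕ.* E ℕ.* E ℕ.* (N-in e x ℕ.* N-in e x)) (λ x e → 4 ℕ.* (a ℕ.* a)) ⟩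
        ∑[ x < q ] ∑[ e < E ] (4 ℕ.* E ℕ.* E ℕ.* (N-in e x ℕ.* N-in e x)) ℕ.+ ∑[ x < q ] ∑[ e < E ] (4 ℕ.* (a ℕ.* a))
          ≡⟨ cong₂ ℕ._+_ (sym (sum₂-*ˡ (4 ℕ.* E ℕ.* E) (λ x e → N-in e x ℕ.* N-in e x)))
               (trans (sum-cong-≗ {q} λ x → sum-const E (4 ℕ.* (a ℕ.* a))) (sum-const q (E ℕ.* (4 ℕ.* (a ℕ.* a))))) ⟩
        4 ℕ.* E ℕ.* E ℕ.* (∑[ x < q ] ∑[ e < E ] (N-in e x ℕ.* N-in e x)) ℕ.+ q ℕ.* (E ℕ.* (4 ℕ.* (a ℕ.* a)))
          ≤⟨ ℕₚ.+-monoˡ-≤ _ (ℕₚ.*-monoʳ-≤ (4 ℕ.* E ℕ.* E) ∑∑N²) ⟩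
        4 ℕ.* E ℕ.* E ℕ.* (a ℕ.* q ℕ.+ a ℕ.* a ℕ.* f) ℕ.+ q ℕ.* (E ℕ.* (4 ℕ.* (a ℕ.* a))) ∎
        where
        open ℕₚ.≤-Reasoning
        module S = +-*-Solver
        sum₂-*ˡ : ∀ t (h : Fin q → Fin E → ℕ) → t ℕ.* ∑[ x < q ] ∑[ e < E ] h x e ≡ ∑[ x < q ] ∑[ e < E ] (t ℕ.* h x e)
        sum₂-*ˡ t h = trans (*-distribˡ-sum t (λ x → ∑[ e < E ] h x e)) (sum-cong-≗ λ x → *-distribˡ-sum t (h x))
        sum₂-+ : ∀ (h h′ : Fin q → Fin E → ℕ) → ∑[ x < q ] ∑[ e < E ] (h x e ℕ.+ h′ x e) ≡ ∑[ x < q ] ∑[ e < E ] h x e ℕ.+ ∑[ x < q ] ∑[ e < E ] h′ x e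
        sum₂-+ h h′ = trans (sum-cong-≗ λ x → ∑-distrib-+ (h x) (h′ x)) (∑-distrib-+ (λ x → ∑[ e < E ] h x e) (λ x → ∑[ e < E ] h′ x e))
        pointwise : ∀ e x → 8 ℕ.* E ℕ.* a ℕ.* N-in e x ℕ.+ a ℕ.* a ℕ.* bad e x ≤ 4 ℕ.* E ℕ.* E ℕ.* (N-in e x ℕ.* N-in e x) ℕ.+ 4 ℕ.* (a ℕ.* a)
        pointwise e x = begin
          8 ℕ.* E ℕ.* a ℕ.* N-in e x ℕ.+ a ℕ.* a ℕ.* bad e x
            ≡⟨ S.solve 4 (λ E a n b → S.con 8 S.:* E S.:* a S.:* n S.:+ a S.:* a S.:* b S.:= S.con 4 S.:* a S.:* (S.con 2 S.:* E S.:* n) S.:+ b S.:* (a S.:* a)) refl E a (N-in e x) (bad e x) ⟩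
          4 ℕ.* a ℕ.* (2 ℕ.* E ℕ.* N-in e x) ℕ.+ bad e x ℕ.* (a ℕ.* a)
            ≤⟨ deviation (2 ℕ.* E ℕ.* N-in e x) a ⟩
          2 ℕ.* E ℕ.* N-in e x ℕ.* (2 ℕ.* E ℕ.* N-in e x) ℕ.+ 4 ℕ.* (a ℕ.* a)
            ≡⟨ S.solve 3 (λ E n s → S.con 2 S.:* E S.:* n S.:* (S.con 2 S.:* E S.:* n) S.:+ s S.:= S.con 4 S.:* E S.:* E S.:* (n S.:* n) S.:+ s) refl E (N-in e x) (4 ℕ.* (a ℕ.* a)) ⟩
          4 ℕ.* E ℕ.* E ℕ.* (N-in e x ℕ.* N-in e x) ℕ.+ 4 ℕ.* (a ℕ.* a) ∎

      -- With q = E f + 1 the main terms 8 E² a² f cancel from both sides of `variance`. What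
      -- remains on the right is at most (4 E² D + 4 E) a², and a² can be divided out.
      count-bad : ∀ D → q ≤ D ℕ.* a → ∀ e → count (λ x → 2 ℕ.* E ℕ.* N-in e x <? a) ≤ 4 ℕ.* E ℕ.* E ℕ.* D ℕ.+ 4 ℕ.* E
      count-bad D q≤Da e = ℕₚ.≤-trans (sum-mono λ x → term≤sum (λ e → bad e x) e)
        (ℕₚ.*-cancelʳ-≤ ∑∑bad (4 ℕ.* E ℕ.* E ℕ.* D ℕ.+ 4 ℕ.* E) (a ℕ.* a) {{ℕₚ.m*n≢0 a a}} (ℕₚ.+-cancelˡ-≤ (8 ℕ.* E ℕ.* a ℕ.* (a ℕ.* (E ℕ.* f))) _ _ (begin
          8 ℕ.* E ℕ.* a ℕ.* (a ℕ.* (E ℕ.* f)) ℕ.+ ∑∑bad ℕ.* (a ℕ.* a)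
            ≤⟨ variance ⟩
          4 ℕ.* E ℕ.* E ℕ.* (a ℕ.* q ℕ.+ a ℕ.* a ℕ.* f) ℕ.+ q ℕ.* (E ℕ.* (4 ℕ.* (a ℕ.* a)))
            ≡⟨ cong (λ t → 4 ℕ.* E ℕ.* E ℕ.* (a ℕ.* q ℕ.+ a ℕ.* a ℕ.* f) ℕ.+ t ℕ.* (E ℕ.* (4 ℕ.* (a ℕ.* a)))) q≡ ⟩
          4 ℕ.* E ℕ.* E ℕ.* (a ℕ.* q ℕ.+ a ℕ.* a ℕ.* f) ℕ.+ suc (E ℕ.* f) ℕ.* (E ℕ.* (4 ℕ.* (a ℕ.* a)))
            ≤⟨ ℕₚ.+-monoˡ-≤ _ (ℕₚ.*-monoʳ-≤ (4 ℕ.* E ℕ.* E) (ℕₚ.+-monoˡ-≤ (a ℕ.* a ℕ.* f) (ℕₚ.*-monoʳ-≤ a q≤Da))) ⟩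
          4 ℕ.* E ℕ.* E ℕ.* (a ℕ.* (D ℕ.* a) ℕ.+ a ℕ.* a ℕ.* f) ℕ.+ suc (E ℕ.* f) ℕ.* (E ℕ.* (4 ℕ.* (a ℕ.* a)))
            ≡⟨ S.solve 4 (λ E f a D → S.con 4 S.:* E S.:* E S.:* (a S.:* (D S.:* a) S.:+ a S.:* a S.:* f) S.:+ (S.con 1 S.:+ E S.:* f) S.:* (E S.:* (S.con 4 S.:* (a S.:* a)))
                 S.:= S.con 8 S.:* E S.:* a S.:* (a S.:* (E S.:* f)) S.:+ (S.con 4 S.:* E S.:* E S.:* D S.:+ S.con 4 S.:* E) S.:* (a S.:* a)) refl E f a D ⟩
          8 ℕ.* E ℕ.* a ℕ.* (a ℕ.* (E ℕ.* f)) ℕ.+ (4 ℕ.* E ℕ.* E ℕ.* D ℕ.+ 4 ℕ.* E) ℕ.* (a ℕ.* a) ∎)))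
        where
        open ℕₚ.≤-Reasoning
        module S = +-*-Solver
        instance
          a≢0 : NonZero a
          a≢0 = ℕ.≢-nonZero λ a≡0 → ℕₚ.<⇒≱ (s≤s z≤n) (ℕₚ.≤-trans (ℕₚ.≤-trans (ℕₚ.≤-reflexive (sym q≡)) q≤Da) (ℕₚ.≤-reflexive (trans (cong (D ℕ.*_) a≡0) (ℕₚ.*-zeroʳ D))))

    -- One x has to be good for all m later sets at once. Each of them rules out at most
    -- `bad-bound E D` points, in total fewer than the q / D points guaranteed in A₀.
    next-point : ∀ m D → D ℕ.* (m ℕ.* bad-bound E D) < q →
      {A₀ : Fin q → Set} (A₀? : ∀ x → Dec (A₀ x)) {A : Fin m → Fin q → Set} (A? : ∀ j x → Dec (A j x)) →
      q ≤ D ℕ.* count A₀? → (∀ j → q ≤ D ℕ.* count (A? j)) → (κ : Fin m → Fin E) →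
      Σ[ x ∈ Fin q ] (A₀ x × (∀ j → count (A? j) ≤ 2 ℕ.* E ℕ.* count (λ y → A? j y ×-dec (χ (y - x) ≟F ζ (κ j)))))
    next-point m D big A₀? A? large₀ large κ = proj₁ choice , proj₁ (proj₂ choice) , λ j → ℕₚ.≮⇒≥ (proj₂ (proj₂ choice) (∈-allFin j))
      where
      bad? : ∀ j x → Dec (2 ℕ.* E ℕ.* count (λ y → A? j y ×-dec (χ (y - x) ≟F ζ (κ j))) < count (A? j))
      bad? j x = 2 ℕ.* E ℕ.* count (λ y → A? j y ×-dec (χ (y - x) ≟F ζ (κ j))) <? count (A? j)
      room : m ℕ.* bad-bound E D < count A₀?
      room = ℕₚ.*-cancelˡ-< D _ _ (ℕₚ.<-≤-trans big large₀)
      choice = avoid A₀? bad? (bad-bound E D) (λ j → SecondMoment.count-bad (A? j) D (large j) (κ j)) (allFin m)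
        (subst (λ t → t ℕ.* bad-bound E D < count A₀?) (sym (length-tabulate {n = m} id)) room)

    Prescribable : ℕ → ℕ → Set₁
    Prescribable m D = (A : Fin m → Fin q → Set) (A? : ∀ j x → Dec (A j x)) →
      (∀ j → q ≤ D ℕ.* count (A? j)) → (κ : Fin m → Fin m → Fin E) →
      Σ[ b ∈ (Fin m → Fin q) ] ((∀ j → A j (b j)) × (∀ i j → i Fin.< j → χ (b j - b i) ≡ ζ (κ i j)))

    -- After x is chosen as first point, each later set is cut down to the y for which y - x lies in
    -- the prescribed class. This divides its size by at most 2 E, so D grows to 2 E D.
    prescribable-suc : ∀ m D → D ℕ.* (m ℕ.* bad-bound E D) < q → Prescribable m (D ℕ.* (2 ℕ.* E)) → Prescribable (suc m) D
    prescribable-suc m D big prescribe A A? large κ = b , b∈A , b-class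
      where
      point : Σ[ x ∈ Fin q ] (A zero x × (∀ j → count (A? (suc j)) ≤ 2 ℕ.* E ℕ.* count (λ y → A? (suc j) y ×-dec (χ (y - x) ≟F ζ (κ zero (suc j))))))
      point = next-point m D big (A? zero) (λ j → A? (suc j)) (large zero) (λ j → large (suc j)) (λ j → κ zero (suc j))
      x : Fin q
      x = proj₁ point
      A′ : Fin m → Fin q → Set
      A′ j y = A (suc j) y × χ (y - x) ≡ ζ (κ zero (suc j))
      A′? : ∀ j y → Dec (A′ j y)
      A′? j y = A? (suc j) y ×-dec (χ (y - x) ≟F ζ (κ zero (suc j)))
      large′ : ∀ j → q ≤ D ℕ.* (2 ℕ.* E) ℕ.* count (A′? j)
      large′ j = ℕₚ.≤-trans (large (suc j)) (ℕₚ.≤-trans (ℕₚ.*-monoʳ-≤ D (proj₂ (proj₂ point) j))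
        (ℕₚ.≤-reflexive (sym (ℕₚ.*-assoc D (2 ℕ.* E) (count (A′? j))))))
      rest : Σ[ b ∈ (Fin m → Fin q) ] ((∀ j → A′ j (b j)) × (∀ i j → i Fin.< j → χ (b j - b i) ≡ ζ (κ (suc i) (suc j))))
      rest = prescribe A′ A′? large′ (λ i j → κ (suc i) (suc j))
      b : Fin (suc m) → Fin q
      b zero = x
      b (suc j) = proj₁ rest j
      b∈A : ∀ j → A j (b j)
      b∈A zero = proj₁ (proj₂ point)
      b∈A (suc j) = proj₁ (proj₁ (proj₂ rest) j)
      b-class : ∀ i j → i Fin.< j → χ (b j - b i) ≡ ζ (κ i j)
      b-class zero (suc j) _ = proj₂ (proj₁ (proj₂ rest) j)
      b-class (suc i) (suc j) (s≤s i<j) = proj₂ (proj₂ rest) i j i<j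

    prescribable : ∀ m D → threshold E m D ≤ q → Prescribable m D
    prescribable zero D _ A A? _ κ = (λ ()) , (λ ()) , λ ()
    prescribable (suc m) D big = prescribable-suc m D (ℕₚ.m+n≤o⇒m≤o (suc (D ℕ.* (m ℕ.* bad-bound E D))) big)
      (prescribable m (D ℕ.* (2 ℕ.* E)) (ℕₚ.m+n≤o⇒n≤o (suc (D ℕ.* (m ℕ.* bad-bound E D))) big))

  module Cyclotomy {N : ℕ} (F : FiniteField (suc N)) (root : MultiplicativeGroup.PrimitiveRoot F)
                   (E f : ℕ) {{E≢0 : NonZero E}} {{f≢0 : NonZero f}} (N≡ : N ≡ E ℕ.* f) where
    open FieldProperties F
    open Roots F
    open MultiplicativeGroup F using (fermat; module PrimitiveRoot)
    open PrimitiveRoot root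

    q : ℕ
    q = suc N

    χ : Fin q → Fin q
    χ x = x ^ f

    χ^E≡1 : ∀ {x} → x ≢ 0# → χ x ^ E ≡ 1#
    χ^E≡1 {x} x≢0 = trans (^-assocʳ x f E) (trans (cong (x ^_) (trans (ℕₚ.*-comm f E) (sym N≡))) (fermat x≢0))

    ζ : Fin E → Fin q
    ζ e = g ^ (f ℕ.* toℕ e)

    ζ-injective : ∀ {e e′} → ζ e ≡ ζ e′ → e ≡ e′
    ζ-injective {e} {e′} h = toℕ-injective (ℕₚ.*-cancelˡ-≡ (toℕ e) (toℕ e′) f (^-injective (bound e) (bound e′) h))
      where
      bound : ∀ (e : Fin E) → f ℕ.* toℕ e < N
      bound e = subst (f ℕ.* toℕ e <_) (trans (ℕₚ.*-comm f E) (sym N≡)) (ℕₚ.*-monoʳ-< f (toℕ<n e))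

    ζ^E≡1 : ∀ e → ζ e ^ E ≡ 1#
    ζ^E≡1 e = trans (cong (_^ E) (trans (cong (g ^_) (ℕₚ.*-comm f (toℕ e))) (sym (^-assocʳ g (toℕ e) f)))) (χ^E≡1 (^-≢0 (toℕ e) g≢0))

    ∃-χ≡ : ∀ {y} → y ^ E ≡ 1# → ∃[ x ] (x ≢ 0# × χ x ≡ y)
    ∃-χ≡ {y} y^E with log y (x^n≡1⇒x≢0 E y^E)
    ... | m , refl with order (m ℕ.* E) (trans (sym (^-assocʳ g m E)) y^E)
    ...   | divides s e = g ^ s , ^-≢0 s g≢0 , trans (^-assocʳ g s f) (cong (g ^_) (sym (ℕₚ.*-cancelʳ-≡ m (s ℕ.* f) E
              (trans e (trans (cong (s ℕ.*_) (trans N≡ (ℕₚ.*-comm E f))) (sym (ℕₚ.*-assoc s f E)))))))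

    ∃-ζ≡ : ∀ {y} → y ^ E ≡ 1# → ∃[ e ] ζ e ≡ y
    ∃-ζ≡ {y} y^E with ∃-χ≡ y^E
    ... | x , x≢0 , refl with log x x≢0
    ...   | s , refl = fromℕ< (m%n<n s E) , (begin
      g ^ (f ℕ.* toℕ (fromℕ< (m%n<n s E)))   ≡⟨ cong (λ t → g ^ (f ℕ.* t)) (toℕ-fromℕ< (m%n<n s E)) ⟩
      g ^ (f ℕ.* (s % E))                    ≡⟨ sym (*-identityʳ _) ⟩
      g ^ (f ℕ.* (s % E)) * 1#               ≡⟨ cong (g ^ (f ℕ.* (s % E)) *_) (sym (^-∣ {g} {N} g^N≡1 (divides (s DivMod./ E) eq))) ⟩
      g ^ (f ℕ.* (s % E)) * g ^ (f ℕ.* (s DivMod./ E ℕ.* E)) ≡⟨ sym (^-homo-* g (f ℕ.* (s % E)) _) ⟩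
      g ^ (f ℕ.* (s % E) ℕ.+ f ℕ.* (s DivMod./ E ℕ.* E))     ≡⟨ cong (g ^_) (sym (ℕₚ.*-distribˡ-+ f (s % E) _)) ⟩
      g ^ (f ℕ.* (s % E ℕ.+ s DivMod./ E ℕ.* E))             ≡⟨ cong (λ t → g ^ (f ℕ.* t)) (sym (m≡m%n+[m/n]*n s E)) ⟩
      g ^ (f ℕ.* s)                          ≡⟨ cong (g ^_) (ℕₚ.*-comm f s) ⟩
      g ^ (s ℕ.* f)                          ≡⟨ sym (^-assocʳ g s f) ⟩
      (g ^ s) ^ f ∎)
      where
      open ≡-Reasoning
      eq : f ℕ.* (s DivMod./ E ℕ.* E) ≡ s DivMod./ E ℕ.* N
      eq = trans (ℕₚ.*-comm f _) (trans (ℕₚ.*-assoc (s DivMod./ E) E f) (cong (s DivMod./ E ℕ.*_) (sym N≡)))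

    open Differences F E f (cong suc N≡) ζ ζ-injective (λ e → ^-≢0 (f ℕ.* toℕ e) g≢0) (λ x≢0 → ∃-ζ≡ (χ^E≡1 x≢0))
      using (prescribable)

    prescribed-differences : ∀ m → threshold E m 1 ≤ q → (κ : Fin m → Fin m → Fin q) → (∀ i j → κ i j ^ E ≡ 1#) →
      Σ[ b ∈ (Fin m → Fin q) ] (∀ i j → i Fin.< j → χ (b j - b i) ≡ κ i j)
    prescribed-differences m big κ κ^E = proj₁ r , λ i j i<j → trans (proj₂ (proj₂ r) i j i<j) (proj₂ (∃-ζ≡ (κ^E i j)))
      where
      -- At the start every set is the whole field, given by the trivial predicate `x ≡ x`, hence D
      -- = 1.
      r = prescribable m 1 big (λ _ x → x ≡ x) (λ _ x → yes refl)
        (λ j → ℕₚ.≤-reflexive (sym (trans (ℕₚ.+-identityʳ _) (count-all {n = q} (λ x → yes (refl {x = x})) λ _ → refl))))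
        (λ i j → proj₁ (∃-ζ≡ (κ^E i j)))

-- The homomorphism λ and the greedy choice of starter positions.

module StarterPositions where
  open FiniteFields
  open FieldLemmas
  open Counting
  open MultiplicativeGroups
  open CyclotomicClasses
  open import Data.Nat as ℕ using (ℕ; zero; suc; _≤_; _<_; s≤s; z≤n; NonZero)
  import Data.Nat.Properties as ℕₚ
  open import Data.Nat.Divisibility
  open import Data.Nat.Solver using (module +-*-Solver)
  open import Data.Fin as Fin using (Fin; zero; suc; toℕ; fromℕ<)
  open import Data.Fin.Patterns
  open import Data.Fin.Properties using (toℕ<n; toℕ-injective; toℕ-fromℕ<) renaming (_≟_ to _≟F_)
  open import Data.List using (List; allFin; length; cartesianProduct)
  open import Data.List.Properties using (length-tabulate)
  open import Data.List.Membership.Propositional using (_∈_)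
  open import Data.List.Membership.Propositional.Properties using (∈-allFin; ∈-cartesianProduct⁺)
  open import Data.Sum using (_⊎_; inj₁; inj₂)
  open import Data.Product using (_×_; _,_; ∃-syntax; Σ-syntax; proj₁; proj₂)
  open import Data.Empty using (⊥; ⊥-elim)
  open import Function using (_∘_; id)
  open import Relation.Nullary
  open import Relation.Nullary.Decidable using (¬?; _×-dec_)
  open import Relation.Binary.PropositionalEquality

  module Transfer {M N s : ℕ} (FQ : FiniteField (suc M)) (FP : FiniteField (suc N))
                  (rootQ : MultiplicativeGroup.PrimitiveRoot FQ) (rootP : MultiplicativeGroup.PrimitiveRoot FP)
                  {{s≢0 : NonZero s}} (N≡ : N ≡ M ℕ.* s) where
    module K = FieldProperties FQ
    module L = FieldProperties FP
    module RK = Roots FQ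
    module RL = Roots FP
    module rK = MultiplicativeGroup.PrimitiveRoot rootQ
    module rL = MultiplicativeGroup.PrimitiveRoot rootP

    -- An element of order exactly M = Q - 1 in the multiplicative group of the larger field, the
    -- image under λ of the primitive root modulo Q.
    θ : Fin (suc N)
    θ = rL.g L.^ s

    θ≢0 : θ ≢ L.0#
    θ≢0 = L.^-≢0 s rL.g≢0

    θ^M≡1 : θ L.^ M ≡ L.1#
    θ^M≡1 = trans (L.^-assocʳ rL.g s M) (trans (cong (rL.g L.^_) (trans (ℕₚ.*-comm s M) (sym N≡))) rL.g^N≡1)

    θ-order : ∀ i → θ L.^ i ≡ L.1# → M ∣ i
    θ-order i e = *-cancelʳ-∣ s (subst₂ _∣_ N≡ (ℕₚ.*-comm s i) (rL.order (s ℕ.* i) (trans (sym (L.^-assocʳ rL.g s i)) e)))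

    module _ {m n} (F : FiniteField (suc m)) (G : FiniteField (suc n)) where
      private
        module F = FieldProperties F
        module G = FieldProperties G

      same-power-≤ : ∀ {x y} → x ≢ F.0# → (∀ i → x F.^ i ≡ F.1# → y G.^ i ≡ G.1#) →
                     ∀ {i j} → i ≤ j → x F.^ i ≡ x F.^ j → y G.^ i ≡ y G.^ j
      same-power-≤ {x} {y} x≢0 h {i} {j} i≤j e = sym (begin
        y G.^ j                        ≡⟨ cong (y G.^_) (sym (ℕₚ.m+[n∸m]≡n i≤j)) ⟩
        y G.^ (i ℕ.+ (j ℕ.∸ i))        ≡⟨ G.^-homo-* y i (j ℕ.∸ i) ⟩
        y G.^ i G.* y G.^ (j ℕ.∸ i)    ≡⟨ cong (y G.^ i G.*_) (h (j ℕ.∸ i) x^[j∸i]≡1) ⟩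
        y G.^ i G.* G.1#               ≡⟨ G.*-identityʳ (y G.^ i) ⟩
        y G.^ i ∎)
        where
        open ≡-Reasoning
        x^[j∸i]≡1 : x F.^ (j ℕ.∸ i) ≡ F.1#
        x^[j∸i]≡1 = F.*-cancelˡ {x = x F.^ i} (F.^-≢0 i x≢0) (trans (sym (F.^-homo-* x i (j ℕ.∸ i)))
          (trans (cong (x F.^_) (ℕₚ.m+[n∸m]≡n i≤j)) (trans (sym e) (sym (F.*-identityʳ (x F.^ i))))))

      -- From `FQ` to `FP` it makes λ independent of the choice of a logarithm, hence
      -- multiplicative; from `FP` to `FQ` it makes λ injective.
      same-power : ∀ {x y} → x ≢ F.0# → (∀ i → x F.^ i ≡ F.1# → y G.^ i ≡ G.1#) →
                   ∀ i j → x F.^ i ≡ x F.^ j → y G.^ i ≡ y G.^ j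
      same-power x≢0 h i j e with ℕₚ.≤-total i j
      ... | inj₁ i≤j = same-power-≤ x≢0 h i≤j e
      ... | inj₂ j≤i = sym (same-power-≤ x≢0 h j≤i (sym e))

    lg : Fin (suc M) → ℕ
    lg u with u ≟F K.0#
    ... | yes _ = 0
    ... | no u≢0 = proj₁ (rK.log u u≢0)

    g^lg : ∀ {u} → u ≢ K.0# → rK.g K.^ lg u ≡ u
    g^lg {u} u≢0 with u ≟F K.0#
    ... | yes e = ⊥-elim (u≢0 e)
    ... | no ne = proj₂ (rK.log u ne)

    -- Since `lg` is 0 at zero, λ is extended by the value 1, so that it is always nonzero and
    -- always an M-th root of unity. Multiplicativity and injectivity concern nonzero arguments
    -- only.
    λ′ : Fin (suc M) → Fin (suc N)
    λ′ u = θ L.^ lg u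

    λ≢0 : ∀ u → λ′ u ≢ L.0#
    λ≢0 u = L.^-≢0 (lg u) θ≢0

    λ^M≡1 : ∀ u → λ′ u L.^ M ≡ L.1#
    λ^M≡1 u = trans (L.^-assocʳ θ (lg u) M) (RL.^-∣ {θ} {M} θ^M≡1 (n∣m*n (lg u)))

    g⇒θ : ∀ i j → rK.g K.^ i ≡ rK.g K.^ j → θ L.^ i ≡ θ L.^ j
    g⇒θ = same-power FQ FP rK.g≢0 λ i e → RL.^-∣ {θ} {M} θ^M≡1 (rK.order i e)

    θ⇒g : ∀ i j → θ L.^ i ≡ θ L.^ j → rK.g K.^ i ≡ rK.g K.^ j
    θ⇒g = same-power FP FQ θ≢0 λ i e → RK.^-∣ {rK.g} {M} rK.g^N≡1 (θ-order i e)

    λ-* : ∀ {u v} → u ≢ K.0# → v ≢ K.0# → λ′ (u K.* v) ≡ λ′ u L.* λ′ v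
    λ-* {u} {v} u≢0 v≢0 = trans (g⇒θ (lg (u K.* v)) (lg u ℕ.+ lg v)
      (trans (g^lg (K.*-≢0 u≢0 v≢0)) (sym (trans (K.^-homo-* rK.g (lg u) (lg v)) (cong₂ K._*_ (g^lg u≢0) (g^lg v≢0))))))
      (L.^-homo-* θ (lg u) (lg v))

    λ-injective : ∀ {u v} → u ≢ K.0# → v ≢ K.0# → λ′ u ≡ λ′ v → u ≡ v
    λ-injective {u} {v} u≢0 v≢0 e = trans (sym (g^lg u≢0)) (trans (θ⇒g (lg u) (lg v) e) (g^lg v≢0))

    λ-surjective : ∀ {y} → y L.^ M ≡ L.1# → .{{NonZero M}} → ∃[ u ] (u ≢ K.0# × λ′ u ≡ y)
    λ-surjective {y} y^M with rL.log y (L.x^n≡1⇒x≢0 M y^M)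
    ... | i , refl with rL.order (i ℕ.* M) (trans (sym (L.^-assocʳ rL.g i M)) y^M)
    ...   | divides m e = rK.g K.^ m , K.^-≢0 m rK.g≢0 ,
            trans (g⇒θ (lg (rK.g K.^ m)) m (g^lg (K.^-≢0 m rK.g≢0))) (trans (L.^-assocʳ rL.g s m) (cong (rL.g L.^_) i≡))
      where
      i≡ : s ℕ.* m ≡ i
      i≡ = ℕₚ.*-cancelʳ-≡ (s ℕ.* m) i M (trans (solve 3 (λ s m M → s :* m :* M := m :* (M :* s)) refl s m M)
             (trans (cong (m ℕ.*_) (sym N≡)) (sym e)))
        where open +-*-Solver

  -- The number 2 j + 1, in a form in which pattern matching separates the two positions added at
  -- each step from the old ones.
  size : ℕ → ℕ
  size zero = 1
  size (suc j) = suc (suc (size j))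

  size≡ : ∀ j → size j ≡ suc (2 ℕ.* j)
  size≡ zero = refl
  size≡ (suc j) = cong suc (trans (cong suc (size≡ j)) (cong suc (sym (ℕₚ.+-suc j (j ℕ.+ 0)))))

  module Starters {M N : ℕ} (FQ : FiniteField (suc M)) (FP : FiniteField (suc N))
                  (rootQ : MultiplicativeGroup.PrimitiveRoot FQ) (rootP : MultiplicativeGroup.PrimitiveRoot FP)
                  (r h : ℕ) {{M≢0 : NonZero M}} {{r≢0 : NonZero r}} {{h≢0 : NonZero h}}
                  (N≡ : N ≡ (r ℕ.* M) ℕ.* (h ℕ.* 2))
                  (2≢0-Q : FiniteField._+_ FQ (FiniteField.1# FQ) (FiniteField.1# FQ) ≢ FiniteField.0# FQ)
                  (2≢0-P : FiniteField._+_ FP (FiniteField.1# FP) (FiniteField.1# FP) ≢ FiniteField.0# FP) where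
    f : ℕ
    f = h ℕ.* 2
    E : ℕ
    E = r ℕ.* M
    instance
      f≢0 : NonZero f
      f≢0 = ℕₚ.m*n≢0 h 2
      E≢0 : NonZero E
      E≢0 = ℕₚ.m*n≢0 r M
      rf≢0 : NonZero (r ℕ.* f)
      rf≢0 = ℕₚ.m*n≢0 r f
      Mf≢0 : NonZero (M ℕ.* f)
      Mf≢0 = ℕₚ.m*n≢0 M f
    N≡M : N ≡ M ℕ.* (r ℕ.* f)
    N≡M = trans N≡ (solve 3 (λ r M f → r :* M :* f := M :* (r :* f)) refl r M f)
      where open +-*-Solver
    N≡r : N ≡ r ℕ.* (M ℕ.* f)
    N≡r = trans N≡ (ℕₚ.*-assoc r M f)

    open Transfer FQ FP rootQ rootP N≡M public using (λ′; λ≢0; λ^M≡1; λ-*; λ-injective; λ-surjective; module K; module L)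
    module Cyc = Cyclotomy FP rootP E f N≡
    -- The coarser map `χ′` is χᴹ. It takes r values and ignores factors λ(u), so its classes
    -- correspond to the cosets of the image of λ in the E-th roots of unity.
    module Cyc′ = Cyclotomy FP rootP r (M ℕ.* f) N≡r
    module RL = Roots FP
    open Cyc public using (χ; χ^E≡1)
    open Cyc′ using (ζ; ζ-injective) renaming (χ to χ′)

    χ-neg : ∀ y → χ (L.- y) ≡ χ y
    χ-neg y = L.-x^2m≡x^2m y h

    χ-swap : ∀ x y → χ (x L.- y) ≡ χ (y L.- x)
    χ-swap x y = trans (cong χ (L.x-y≡-[y-x] x y)) (χ-neg (y L.- x))

    χ≢0 : ∀ {x} → x ≢ L.0# → χ x ≢ L.0#
    χ≢0 = L.^-≢0 f

    χ^M : ∀ x → χ x L.^ M ≡ χ′ x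
    χ^M x = trans (L.^-assocʳ x f M) (cong (x L.^_) (ℕₚ.*-comm f M))

    λ-neg : ∀ {u} → u ≢ K.0# → λ′ (K.- u) ≡ λ′ (K.- K.1#) L.* λ′ u
    λ-neg {u} u≢0 = trans (cong λ′ (K.solve 1 (λ u → K.:- u K.:= (K.:- K.:1) K.:* u) refl u)) (λ-* (K.-‿≢0 K.1≢0) u≢0)

    λ-swap : ∀ {z z′} → z ≢ z′ → λ′ (z K.- z′) ≡ λ′ (K.- K.1#) L.* λ′ (z′ K.- z)
    λ-swap {z} {z′} z≢z′ = trans (cong λ′ (K.x-y≡-[y-x] z z′)) (λ-neg (K.x≢y⇒x-y≢0 (z≢z′ ∘ sym)))

    -- As χ is even, only λ can tell a pair of positions from its reverse. It does so because it is
    -- injective and u ≠ -u in odd characteristic.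
    λ-swap-≢ : ∀ {z z′} → z ≢ z′ → λ′ (z K.- z′) ≢ λ′ (z′ K.- z)
    λ-swap-≢ {z} {z′} z≢z′ e = K.OddCharacteristic.x≢-x 2≢0-Q (K.x≢y⇒x-y≢0 z≢z′)
      (trans (λ-injective (K.x≢y⇒x-y≢0 z≢z′) (K.x≢y⇒x-y≢0 (z≢z′ ∘ sym)) e) (K.x-y≡-[y-x] z′ z))

    count-χ-shift : ∀ β {y y′} → y ≢ L.0# → count (λ x → χ (β L.- x) L.* y ≟F y′) ≤ f
    count-χ-shift β {y} {y′} y≢0 = ℕₚ.≤-trans
      (count-injective (λ x → χ (β L.- x) L.* y ≟F y′) (λ u → u L.^ f ≟F y′ L./ y) (λ x → β L.- x)
        (λ x e → L.x*y≡z⇒x≡z/y y≢0 e)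
        (λ i j _ _ e → trans (L.solve 2 (λ β i → i L.:= β L.:- (β L.:- i)) refl β i) (trans (cong (λ t → β L.- t) e)
          (L.solve 2 (λ β j → β L.:- (β L.:- j) L.:= j) refl β j))))
      (RL.count-^≡ f (y′ L./ y))

    -- The injective substitution u = (β - x) / (β′ - x) turns the equation into uᶠ = y′ / y, which
    -- has at most f solutions. The point x = β′ is not a solution, because χ vanishes only at 0.
    count-χ-ratio : ∀ {β β′} → β ≢ β′ → ∀ {y y′} → y ≢ L.0# → y′ ≢ L.0# →
                    count (λ x → χ (β L.- x) L.* y ≟F χ (β′ L.- x) L.* y′) ≤ f
    count-χ-ratio {β} {β′} β≢β′ {y} {y′} y≢0 y′≢0 = ℕₚ.≤-trans
      (count-injective (λ x → χ (β L.- x) L.* y ≟F χ (β′ L.- x) L.* y′) (λ u → u L.^ f ≟F y′ L./ y) (λ x → (β L.- x) L./ (β′ L.- x))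
        (λ x e → to x (β′-x≢0 x e) e)
        (λ i j ei ej e → L.möbius-injective β≢β′ (β′-x≢0 i ei) (β′-x≢0 j ej) e))
      (RL.count-^≡ f (y′ L./ y))
      where
      χ0 : χ L.0# ≡ L.0#
      χ0 = L.0^n≡0 f
      β′-x≢0 : ∀ x → χ (β L.- x) L.* y ≡ χ (β′ L.- x) L.* y′ → β′ L.- x ≢ L.0#
      β′-x≢0 x e e0 = L.*-≢0 (χ≢0 (L.x≢y⇒x-y≢0 {β} {x} (λ β≡x → β≢β′ (trans β≡x (sym (L.x-y≡0⇒x≡y e0)))))) y≢0
        (trans e (trans (cong (L._* y′) (trans (cong χ e0) χ0)) (L.zeroˡ y′)))
      to : ∀ x → β′ L.- x ≢ L.0# → χ (β L.- x) L.* y ≡ χ (β′ L.- x) L.* y′ → χ ((β L.- x) L./ (β′ L.- x)) ≡ y′ L./ y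
      to x ne e = L.x*y≡z⇒x≡z/y y≢0 (L.*-cancelˡ (χ≢0 ne) (begin
        X′ L.* (χ ((β L.- x) L./ (β′ L.- x)) L.* y) ≡⟨ cong (λ t → X′ L.* (t L.* y)) (L.^-/ (β L.- x) f ne) ⟩
        X′ L.* (χ (β L.- x) L./ X′ L.* y)          ≡⟨ L.solve 3 (λ a b c → a L.:* (b L.:* c) L.:= b L.:* a L.:* c) refl X′ (χ (β L.- x) L./ X′) y ⟩
        χ (β L.- x) L./ X′ L.* X′ L.* y            ≡⟨ cong (L._* y) (L.[x/y]*y≡x (χ (β L.- x)) (χ≢0 ne)) ⟩
        χ (β L.- x) L.* y                          ≡⟨ e ⟩
        X′ L.* y′ ∎))
        where
        open ≡-Reasoning
        X′ = χ (β′ L.- x)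

    -- The class is a coset of the subgroup generated by gʳ, which has M f elements.
    count-χ′≡ζ : ∀ i → M ℕ.* f ≤ count (λ x → χ′ x ≟F ζ i)
    count-χ′≡ζ i = ℕₚ.≤-trans (ℕₚ.≤-reflexive (sym (count-all always (λ _ → refl))))
      (count-injective always (λ x → χ′ x ≟F ζ i) translate translate-class translate-injective)
      where
      open MultiplicativeGroup.PrimitiveRoot rootP
      unit : ∀ (e : Fin (M ℕ.* f)) → (g L.^ (r ℕ.* toℕ e)) L.^ (M ℕ.* f) ≡ L.1#
      unit e = trans (L.^-assocʳ g (r ℕ.* toℕ e) (M ℕ.* f)) (RL.^-∣ {g} {N} g^N≡1 (divides (toℕ e)
        (trans (solve 3 (λ r e m → r :* e :* m := e :* (r :* m)) refl r (toℕ e) (M ℕ.* f)) (cong (toℕ e ℕ.*_) (sym N≡r)))))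
        where open +-*-Solver
      bound : ∀ (e : Fin (M ℕ.* f)) → r ℕ.* toℕ e < N
      bound e = subst (r ℕ.* toℕ e <_) (sym N≡r) (ℕₚ.*-monoʳ-< r (toℕ<n e))
      always : ∀ (e : Fin (M ℕ.* f)) → Dec (e ≡ e)
      always _ = yes refl
      ∃x₀ : Σ[ x ∈ Fin (suc N) ] (x ≢ L.0# × χ′ x ≡ ζ i)
      ∃x₀ = Cyc′.∃-χ≡ {ζ i} (Cyc′.ζ^E≡1 i)
      x₀ : Fin (suc N)
      x₀ = proj₁ ∃x₀
      translate : Fin (M ℕ.* f) → Fin (suc N)
      translate e = x₀ L.* g L.^ (r ℕ.* toℕ e)
      translate-class : ∀ e → e ≡ e → χ′ (translate e) ≡ ζ i
      translate-class e _ = trans (L.^-distrib-* x₀ (g L.^ (r ℕ.* toℕ e)) (M ℕ.* f)) (trans (cong₂ L._*_ (proj₂ (proj₂ ∃x₀)) (unit e)) (L.*-identityʳ (ζ i)))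
      translate-injective : ∀ e e′ → e ≡ e → e′ ≡ e′ → translate e ≡ translate e′ → e ≡ e′
      translate-injective e e′ _ _ h = toℕ-injective (ℕₚ.*-cancelˡ-≡ (toℕ e) (toℕ e′) r
        (^-injective (bound e) (bound e′) (L.*-cancelˡ {x = x₀} (proj₁ (proj₂ ∃x₀)) h)))

    Pos : Set
    Pos = Fin (suc M) × Fin (suc N)

    neg : Pos → Pos
    neg (z , b) = z , L.- b

    -- A common change of sign corresponds to replacing d by -d, which leaves a starter block
    -- unchanged. Pairs of positions can and need only be separated up to this relation.
    _≈_ : Pos × Pos → Pos × Pos → Set
    (P , P′) ≈ (R , R′) = (P ≡ R × P′ ≡ R′) ⊎ (P ≡ neg R × P′ ≡ neg R′)

    neg-neg : ∀ P → neg (neg P) ≡ P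
    neg-neg (z , b) = cong (z ,_) (L.-‿involutive b)

    ≈-sym : ∀ {X Y} → X ≈ Y → Y ≈ X
    ≈-sym (inj₁ (refl , refl)) = inj₁ (refl , refl)
    ≈-sym (inj₂ (refl , refl)) = inj₂ (sym (neg-neg _) , sym (neg-neg _))

    ≈-trans : ∀ {X Y Z} → X ≈ Y → Y ≈ Z → X ≈ Z
    ≈-trans (inj₁ (refl , refl)) q = q
    ≈-trans (inj₂ (refl , refl)) (inj₁ (refl , refl)) = inj₂ (refl , refl)
    ≈-trans (inj₂ (refl , refl)) (inj₂ (refl , refl)) = inj₁ (neg-neg _ , neg-neg _)

    -- Equality of the classes χ (b′ - b) / λ (z′ - z) attached to two pairs of positions.
    SameClass : Pos × Pos → Pos × Pos → Set
    SameClass ((z , b) , (z′ , b′)) ((w , c) , (w′ , c′)) = χ (b′ L.- b) L.* λ′ (w′ K.- w) ≡ χ (c′ L.- c) L.* λ′ (z′ K.- z)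

    SameClass-resp : ∀ {X Y Z} → X ≈ Y → SameClass X Z → SameClass Y Z
    SameClass-resp (inj₁ (refl , refl)) e = e
    SameClass-resp {Y = (z , b) , (z′ , b′)} {(w , c) , (w′ , c′)} (inj₂ (refl , refl)) e =
      trans (cong (L._* λ′ (w′ K.- w)) (trans (χ-swap b′ b) (cong χ (L.solve 2 (λ b b′ → b L.:- b′ L.:= (L.:- b′) L.:- (L.:- b)) refl b b′)))) e

    -- Reversing both pairs multiplies both sides by λ(-1).
    SameClass-swap : ∀ {P P′ R R′} → proj₁ P ≢ proj₁ P′ → proj₁ R ≢ proj₁ R′ → SameClass (P , P′) (R , R′) → SameClass (P′ , P) (R′ , R)
    SameClass-swap {z , b} {z′ , b′} {w , c} {w′ , c′} z≢ w≢ e = begin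
      χ (b L.- b′) L.* λ′ (w K.- w′)                 ≡⟨ cong₂ L._*_ (χ-swap b b′) (λ-swap w≢) ⟩
      χ (b′ L.- b) L.* (κ L.* λ′ (w′ K.- w))         ≡⟨ move (χ (b′ L.- b)) κ (λ′ (w′ K.- w)) ⟩
      κ L.* (χ (b′ L.- b) L.* λ′ (w′ K.- w))         ≡⟨ cong (κ L.*_) e ⟩
      κ L.* (χ (c′ L.- c) L.* λ′ (z′ K.- z))         ≡⟨ sym (move (χ (c′ L.- c)) κ (λ′ (z′ K.- z))) ⟩
      χ (c′ L.- c) L.* (κ L.* λ′ (z′ K.- z))         ≡⟨ sym (cong₂ L._*_ (χ-swap c c′) (λ-swap z≢)) ⟩
      χ (c L.- c′) L.* λ′ (z K.- z′) ∎
      where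
      open ≡-Reasoning
      κ = λ′ (K.- K.1#)
      move : ∀ a b c → a L.* (b L.* c) ≡ b L.* (a L.* c)
      move = L.solve 3 (λ a b c → a L.:* (b L.:* c) L.:= b L.:* (a L.:* c)) refl

    module _ (t : Fin r → Fin (suc M)) (t-injective : ∀ {i j} → t i ≡ t j → i ≡ j) (t≢0 : ∀ i → t i ≢ K.0#) where

      -- The state of the greedy construction after j columns: the position (0 , 0) and two
      -- positions (tᵢ , ±cᵢ) with `χ′` cᵢ = ζᵢ for each i < j. The prescribed values of `χ′` take
      -- care of pairs inside a column, `class-injective` of pairs between columns; `cross` ensures
      -- that the latter never have equal second coordinates.
      record Starter (j : ℕ) : Set where
        field
          z        : Fin (size j) → Fin (suc M)
          b        : Fin (size j) → Fin (suc N)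
          mirror   : Fin (size j) → Fin (size j)
          mirror-z : ∀ s → z (mirror s) ≡ z s
          mirror-b : ∀ s → b (mirror s) ≡ L.- b s
          column   : ∀ s → (z s ≡ K.0# × b s ≡ L.0#) ⊎ Σ[ i ∈ Fin r ] (toℕ i < j × z s ≡ t i × χ′ (b s) ≡ ζ i)
          occupied : ∀ i → toℕ i < j → Σ[ s ∈ Fin (size j) ] z s ≡ t i
          distinct : ∀ {s s′} → z s ≡ z s′ → b s ≡ b s′ → s ≡ s′
          same-col : ∀ {s s′} → z s ≡ z s′ → b s′ ≡ b s ⊎ b s′ ≡ L.- b s
          cross    : ∀ {s s′} → z s ≢ z s′ → b s ≢ b s′
        pos : Fin (size j) → Pos
        pos s = z s , b s
        field
          class-injective : ∀ {s s′ σ σ′} → z s ≢ z s′ → z σ ≢ z σ′ →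
            SameClass (pos s , pos s′) (pos σ , pos σ′) → (pos σ , pos σ′) ≈ (pos s , pos s′)

      starter-0 : Starter 0
      starter-0 = record
        { z = λ _ → K.0# ; b = λ _ → L.0# ; mirror = id ; mirror-z = λ _ → refl ; mirror-b = λ _ → sym L.-0#≈0#
        ; column = λ _ → inj₁ (refl , refl) ; occupied = λ _ () ; distinct = λ { {zero} {zero} _ _ → refl }
        ; same-col = λ _ → inj₁ refl ; cross = λ z≢ → ⊥-elim (z≢ refl) ; class-injective = λ z≢ → ⊥-elim (z≢ refl) }

      module Step {j : ℕ} (j<r : j < r) (S : Starter j) (room : (size j ℕ.* size j ℕ.* size j) ℕ.* 4 < M) where
        open Starter S
        n = size j
        i₀ : Fin r
        i₀ = fromℕ< j<r
        t₀ : Fin (suc M)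
        t₀ = t i₀

        z≢t₀ : ∀ τ → z τ ≢ t₀
        z≢t₀ τ e with column τ
        ... | inj₁ (z≡0 , _) = t≢0 i₀ (trans (sym e) z≡0)
        ... | inj₂ (i , i<j , z≡ , _) = ℕₚ.<⇒≢ i<j (trans (cong toℕ (t-injective (trans (sym z≡) e))) (toℕ-fromℕ< j<r))

        Index : Set
        Index = ((Fin n × Fin n) × Fin n) × Fin 4

        indices : List Index
        indices = cartesianProduct (cartesianProduct (cartesianProduct (allFin n) (allFin n)) (allFin n)) (allFin 4)

        -- The ways in which a candidate x can fail: it repeats an old second coordinate (0); a new
        -- pair has the class of an old pair (1); two new pairs with the same orientation (2) or
        -- with opposite orientations (3) have equal classes. The guards exclude the cases in which
        -- the equation could hold for too many x.
        Bad : Index → Fin (suc N) → Set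
        Bad (((τ , s) , s′) , 0F) x = x ≡ b τ
        Bad (((τ , s) , s′) , 1F) x = z s ≢ z s′ × χ (b τ L.- x) L.* λ′ (z s′ K.- z s) ≡ χ (b s′ L.- b s) L.* λ′ (t₀ K.- z τ)
        Bad (((τ , τ′) , _) , 2F) x = b τ ≢ b τ′ × χ (b τ L.- x) L.* λ′ (t₀ K.- z τ′) ≡ χ (b τ′ L.- x) L.* λ′ (t₀ K.- z τ)
        Bad (((τ , τ′) , _) , 3F) x = b τ ≢ b τ′ × χ (b τ L.- x) L.* λ′ (z τ′ K.- t₀) ≡ χ (b τ′ L.- x) L.* λ′ (t₀ K.- z τ)

        Bad? : ∀ i x → Dec (Bad i x)
        Bad? (((τ , s) , s′) , 0F) x = x ≟F b τ
        Bad? (((τ , s) , s′) , 1F) x = ¬? (z s ≟F z s′) ×-dec (χ (b τ L.- x) L.* λ′ (z s′ K.- z s) ≟F χ (b s′ L.- b s) L.* λ′ (t₀ K.- z τ))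
        Bad? (((τ , τ′) , _) , 2F) x = ¬? (b τ ≟F b τ′) ×-dec (χ (b τ L.- x) L.* λ′ (t₀ K.- z τ′) ≟F χ (b τ′ L.- x) L.* λ′ (t₀ K.- z τ))
        Bad? (((τ , τ′) , _) , 3F) x = ¬? (b τ ≟F b τ′) ×-dec (χ (b τ L.- x) L.* λ′ (z τ′ K.- t₀) ≟F χ (b τ′ L.- x) L.* λ′ (t₀ K.- z τ))

        guarded : ∀ {A : Set} {B : Fin (suc N) → Set} (A? : Dec A) (B? : ∀ x → Dec (B x)) → (A → count B? ≤ f) →
                  count (λ x → A? ×-dec B? x) ≤ f
        guarded (no ¬a) B? h = ℕₚ.≤-trans (ℕₚ.≤-reflexive (count-none (λ x → no ¬a ×-dec B? x) λ i (a , _) → ¬a a)) z≤n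
        guarded (yes a) B? h = ℕₚ.≤-trans (count-mono (λ x → yes a ×-dec B? x) B? λ i → proj₂) (h a)

        count-Bad : ∀ i → count (Bad? i) ≤ f
        count-Bad (((τ , s) , s′) , 0F) = ℕₚ.≤-trans (ℕₚ.≤-reflexive (count-≡ (b τ))) (ℕ.>-nonZero⁻¹ f)
        count-Bad (((τ , s) , s′) , 1F) = guarded (¬? (z s ≟F z s′)) (λ x → χ (b τ L.- x) L.* λ′ (z s′ K.- z s) ≟F χ (b s′ L.- b s) L.* λ′ (t₀ K.- z τ))
          λ _ → count-χ-shift (b τ) (λ≢0 (z s′ K.- z s))
        count-Bad (((τ , τ′) , _) , 2F) = guarded (¬? (b τ ≟F b τ′)) (λ x → χ (b τ L.- x) L.* λ′ (t₀ K.- z τ′) ≟F χ (b τ′ L.- x) L.* λ′ (t₀ K.- z τ))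
          λ ne → count-χ-ratio ne (λ≢0 (t₀ K.- z τ′)) (λ≢0 (t₀ K.- z τ))
        count-Bad (((τ , τ′) , _) , 3F) = guarded (¬? (b τ ≟F b τ′)) (λ x → χ (b τ L.- x) L.* λ′ (z τ′ K.- t₀) ≟F χ (b τ′ L.- x) L.* λ′ (t₀ K.- z τ))
          λ ne → count-χ-ratio ne (λ≢0 (z τ′ K.- t₀)) (λ≢0 (t₀ K.- z τ))

        length-indices : length indices ≡ n ℕ.* n ℕ.* n ℕ.* 4
        length-indices = trans (length-cartesianProduct (cartesianProduct (cartesianProduct (allFin n) (allFin n)) (allFin n)) (allFin 4))
          (cong (ℕ._* 4) (trans (length-cartesianProduct (cartesianProduct (allFin n) (allFin n)) (allFin n))
            (cong₂ ℕ._*_ (trans (length-cartesianProduct (allFin n) (allFin n)) (cong₂ ℕ._*_ len len)) len)))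
          where
          len : length (allFin n) ≡ n
          len = length-tabulate {n = n} id

        ∈-indices : ∀ i → i ∈ indices
        ∈-indices (((τ , s) , s′) , k) = ∈-cartesianProduct⁺ (∈-cartesianProduct⁺ (∈-cartesianProduct⁺ (∈-allFin τ) (∈-allFin s)) (∈-allFin s′)) (∈-allFin k)

        -- The 4 n³ conditions exclude at most f elements each, while the class `χ′` x = ζ i₀ has M
        -- f elements; `room` says 4 n³ < M.
        choice : Σ[ x ∈ Fin (suc N) ] (χ′ x ≡ ζ i₀ × (∀ {i} → i ∈ indices → ¬ Bad i x))
        choice = avoid (λ x → χ′ x ≟F ζ i₀) Bad? f count-Bad indices
          (ℕₚ.<-≤-trans (subst (λ m → m ℕ.* f < M ℕ.* f) (sym length-indices) (ℕₚ.*-monoˡ-< f room)) (count-χ′≡ζ i₀))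

        x : Fin (suc N)
        x = proj₁ choice
        χ′x : χ′ x ≡ ζ i₀
        χ′x = proj₁ (proj₂ choice)
        ¬Bad : ∀ i → ¬ Bad i x
        ¬Bad i = proj₂ (proj₂ choice) (∈-indices i)

        x≢0 : x ≢ L.0#
        x≢0 = L.x^n≡1⇒x≢0 (M ℕ.* f ℕ.* r) (trans (sym (L.^-assocʳ x (M ℕ.* f) r)) (trans (cong (L._^ r) χ′x) (Cyc′.ζ^E≡1 i₀)))
          where instance _ = ℕₚ.m*n≢0 (M ℕ.* f) r

        x≢-x : x ≢ L.- x
        x≢-x = L.OddCharacteristic.x≢-x 2≢0-P x≢0

        x≢b : ∀ τ → x ≢ b τ
        x≢b τ = ¬Bad (((τ , τ) , τ) , 0F)

        -x≢b : ∀ τ → L.- x ≢ b τ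
        -x≢b τ e = x≢b (mirror τ) (trans (sym (L.-‿involutive x)) (trans (cong L.-_ e) (sym (mirror-b τ))))

        z⁺ : Fin (suc (suc n)) → Fin (suc M)
        z⁺ zero = t₀
        z⁺ (suc zero) = t₀
        z⁺ (suc (suc s)) = z s

        b⁺ : Fin (suc (suc n)) → Fin (suc N)
        b⁺ zero = x
        b⁺ (suc zero) = L.- x
        b⁺ (suc (suc s)) = b s

        pos⁺ : Fin (suc (suc n)) → Pos
        pos⁺ s = z⁺ s , b⁺ s

        mirror⁺ : Fin (suc (suc n)) → Fin (suc (suc n))
        mirror⁺ zero = suc zero
        mirror⁺ (suc zero) = zero
        mirror⁺ (suc (suc s)) = suc (suc (mirror s))

        new : Pos
        new = t₀ , x

        -- A pair containing (t₀ , -x) is negated; by mirror symmetry its other member remains an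
        -- old position. Thus -x itself never has to be discussed.
        data Normal : Pos → Pos → Set where
          old-old : ∀ s s′ → z s ≢ z s′ → Normal (pos s) (pos s′)
          old-new : ∀ τ → Normal (pos τ) new
          new-old : ∀ τ → Normal new (pos τ)

        mirrored : ∀ τ → pos τ ≡ neg (pos (mirror τ))
        mirrored τ = cong₂ _,_ (sym (mirror-z τ)) (sym (trans (cong L.-_ (mirror-b τ)) (L.-‿involutive (b τ))))

        normalise : ∀ s s′ → z⁺ s ≢ z⁺ s′ → Σ[ P ∈ Pos ] Σ[ P′ ∈ Pos ] (Normal P P′ × (pos⁺ s , pos⁺ s′) ≈ (P , P′))
        normalise zero zero ne = ⊥-elim (ne refl)
        normalise zero (suc zero) ne = ⊥-elim (ne refl)
        normalise (suc zero) zero ne = ⊥-elim (ne refl)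
        normalise (suc zero) (suc zero) ne = ⊥-elim (ne refl)
        normalise zero (suc (suc τ)) _ = new , pos τ , new-old τ , inj₁ (refl , refl)
        normalise (suc zero) (suc (suc τ)) _ = new , pos (mirror τ) , new-old (mirror τ) , inj₂ (refl , mirrored τ)
        normalise (suc (suc τ)) zero _ = pos τ , new , old-new τ , inj₁ (refl , refl)
        normalise (suc (suc τ)) (suc zero) _ = pos (mirror τ) , new , old-new (mirror τ) , inj₂ (mirrored τ , refl)
        normalise (suc (suc s)) (suc (suc s′)) ne = pos s , pos s′ , old-old s s′ ne , inj₁ (refl , refl)

        b≡⇒pos≡ : ∀ {τ τ′} → b τ ≡ b τ′ → pos τ ≡ pos τ′
        b≡⇒pos≡ {τ} {τ′} e with z τ ≟F z τ′
        ... | yes e′ = cong₂ _,_ e′ e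
        ... | no ne = ⊥-elim (cross ne e)

        old-new≢old-old : ∀ {τ s s′} → z s ≢ z s′ → ¬ SameClass (pos τ , new) (pos s , pos s′)
        old-new≢old-old {τ} {s} {s′} ne e =
          ¬Bad (((τ , s) , s′) , 1F) (ne , trans (cong (L._* λ′ (z s′ K.- z s)) (χ-swap (b τ) x)) e)

        new-old≢old-old : ∀ {τ s s′} → z s ≢ z s′ → ¬ SameClass (new , pos τ) (pos s , pos s′)
        new-old≢old-old {τ} {s} {s′} ne e =
          old-new≢old-old {τ} {s′} {s} (ne ∘ sym) (SameClass-swap {new} {pos τ} {pos s} {pos s′} (z≢t₀ τ ∘ sym) ne e)

        old-new-injective : ∀ τ τ′ → SameClass (pos τ , new) (pos τ′ , new) → pos τ′ ≡ pos τ
        old-new-injective τ τ′ e = decide (b τ ≟F b τ′)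
          where
          bad : χ (b τ L.- x) L.* λ′ (t₀ K.- z τ′) ≡ χ (b τ′ L.- x) L.* λ′ (t₀ K.- z τ)
          bad = trans (cong (L._* λ′ (t₀ K.- z τ′)) (χ-swap (b τ) x)) (trans e (cong (L._* λ′ (t₀ K.- z τ)) (χ-swap x (b τ′))))
          decide : Dec (b τ ≡ b τ′) → pos τ′ ≡ pos τ
          decide (yes bb) = sym (b≡⇒pos≡ bb)
          decide (no ne) = ⊥-elim (¬Bad (((τ , τ′) , τ) , 2F) (ne , bad))

        -- For b τ ≠ b τ′ the choice of x excludes it. For b τ = b τ′ both positions agree by
        -- `cross`, the factors χ cancel, and λ would take equal values at a step and at its
        -- negative.
        old-new≢new-old : ∀ τ τ′ → ¬ SameClass (pos τ , new) (new , pos τ′)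
        old-new≢new-old τ τ′ e = decide (b τ ≟F b τ′)
          where
          bad : χ (b τ L.- x) L.* λ′ (z τ′ K.- t₀) ≡ χ (b τ′ L.- x) L.* λ′ (t₀ K.- z τ)
          bad = trans (cong (L._* λ′ (z τ′ K.- t₀)) (χ-swap (b τ) x)) e
          λ≡ : b τ ≡ b τ′ → λ′ (z τ′ K.- t₀) ≡ λ′ (t₀ K.- z τ)
          λ≡ bb = L.*-cancelˡ {x = χ (x L.- b τ)} (χ≢0 (L.x≢y⇒x-y≢0 (x≢b τ)))
            (trans e (cong (L._* λ′ (t₀ K.- z τ)) (trans (cong (λ u → χ (u L.- x)) (sym bb)) (χ-swap (b τ) x))))
          decide : Dec (b τ ≡ b τ′) → ⊥
          decide (yes bb) = λ-swap-≢ (z≢t₀ τ) (trans (cong (λ u → λ′ (u K.- t₀)) (cong proj₁ (b≡⇒pos≡ bb))) (λ≡ bb))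
          decide (no ne) = ¬Bad (((τ , τ′) , τ) , 3F) (ne , bad)

        class-injective-normal : ∀ {P P′ R R′} → Normal P P′ → Normal R R′ → SameClass (P , P′) (R , R′) → (R , R′) ≈ (P , P′)
        class-injective-normal (old-old s s′ ne) (old-old σ σ′ ne′) e = class-injective ne ne′ e
        class-injective-normal (old-new τ) (old-old s s′ ne) e = ⊥-elim (old-new≢old-old {τ} {s} {s′} ne e)
        class-injective-normal (new-old τ) (old-old s s′ ne) e = ⊥-elim (new-old≢old-old {τ} {s} {s′} ne e)
        class-injective-normal (old-old s s′ ne) (old-new τ) e = ⊥-elim (old-new≢old-old {τ} {s} {s′} ne (sym e))
        class-injective-normal (old-old s s′ ne) (new-old τ) e = ⊥-elim (new-old≢old-old {τ} {s} {s′} ne (sym e))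
        class-injective-normal (old-new τ) (old-new τ′) e = inj₁ (old-new-injective τ τ′ e , refl)
        class-injective-normal (new-old τ) (new-old τ′) e = inj₁ (refl , old-new-injective τ τ′
          (SameClass-swap {new} {pos τ} {new} {pos τ′} (z≢t₀ τ ∘ sym) (z≢t₀ τ′ ∘ sym) e))
        class-injective-normal (old-new τ) (new-old τ′) e = ⊥-elim (old-new≢new-old τ τ′ e)
        class-injective-normal (new-old τ) (old-new τ′) e = ⊥-elim (old-new≢new-old τ′ τ (sym e))

        column⁺ : ∀ s → (z⁺ s ≡ K.0# × b⁺ s ≡ L.0#) ⊎ Σ[ i ∈ Fin r ] (toℕ i < suc j × z⁺ s ≡ t i × χ′ (b⁺ s) ≡ ζ i)
        column⁺ zero = inj₂ (i₀ , s≤s (ℕₚ.≤-reflexive (toℕ-fromℕ< j<r)) , refl , χ′x)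
        column⁺ (suc zero) = inj₂ (i₀ , s≤s (ℕₚ.≤-reflexive (toℕ-fromℕ< j<r)) , refl , trans (trans (sym (χ^M (L.- x))) (trans (cong (L._^ M) (χ-neg x)) (χ^M x))) χ′x)
        column⁺ (suc (suc s)) with column s
        ... | inj₁ h = inj₁ h
        ... | inj₂ (i , i<j , rest) = inj₂ (i , ℕₚ.m≤n⇒m≤1+n i<j , rest)

        starter⁺ : Starter (suc j)
        starter⁺ = record
          { z = z⁺ ; b = b⁺ ; mirror = mirror⁺
          ; mirror-z = λ { zero → refl ; (suc zero) → refl ; (suc (suc s)) → mirror-z s }
          ; mirror-b = λ { zero → refl ; (suc zero) → sym (L.-‿involutive x) ; (suc (suc s)) → mirror-b s }
          ; column = column⁺
          ; occupied = occupied⁺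
          ; distinct = λ {s} {s′} → distinct⁺ s s′
          ; same-col = λ {s} {s′} → same-col⁺ s s′
          ; cross = λ {s} {s′} → cross⁺ s s′
          ; class-injective = λ {s} {s′} {σ} {σ′} → class-injective⁺ s s′ σ σ′
          }
          where
          occupied⁺ : ∀ i → toℕ i < suc j → Σ[ s ∈ Fin (suc (suc n)) ] z⁺ s ≡ t i
          occupied⁺ i (s≤s i≤j) with ℕₚ.m≤n⇒m<n∨m≡n i≤j
          ... | inj₁ i<j with occupied i i<j
          ...   | s , e = suc (suc s) , e
          occupied⁺ i (s≤s i≤j) | inj₂ i≡j = zero , cong t (toℕ-injective (trans (toℕ-fromℕ< j<r) (sym i≡j)))
          distinct⁺ : ∀ s s′ → z⁺ s ≡ z⁺ s′ → b⁺ s ≡ b⁺ s′ → s ≡ s′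
          distinct⁺ zero zero _ _ = refl
          distinct⁺ zero (suc zero) _ e = ⊥-elim (x≢-x e)
          distinct⁺ (suc zero) zero _ e = ⊥-elim (x≢-x (sym e))
          distinct⁺ (suc zero) (suc zero) _ _ = refl
          distinct⁺ zero (suc (suc τ)) e _ = ⊥-elim (z≢t₀ τ (sym e))
          distinct⁺ (suc zero) (suc (suc τ)) e _ = ⊥-elim (z≢t₀ τ (sym e))
          distinct⁺ (suc (suc τ)) zero e _ = ⊥-elim (z≢t₀ τ e)
          distinct⁺ (suc (suc τ)) (suc zero) e _ = ⊥-elim (z≢t₀ τ e)
          distinct⁺ (suc (suc s)) (suc (suc s′)) e e′ = cong (λ i → Fin.suc (Fin.suc i)) (distinct e e′)
          same-col⁺ : ∀ s s′ → z⁺ s ≡ z⁺ s′ → b⁺ s′ ≡ b⁺ s ⊎ b⁺ s′ ≡ L.- b⁺ s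
          same-col⁺ zero zero _ = inj₁ refl
          same-col⁺ zero (suc zero) _ = inj₂ refl
          same-col⁺ (suc zero) zero _ = inj₂ (sym (L.-‿involutive x))
          same-col⁺ (suc zero) (suc zero) _ = inj₁ refl
          same-col⁺ zero (suc (suc τ)) e = ⊥-elim (z≢t₀ τ (sym e))
          same-col⁺ (suc zero) (suc (suc τ)) e = ⊥-elim (z≢t₀ τ (sym e))
          same-col⁺ (suc (suc τ)) zero e = ⊥-elim (z≢t₀ τ e)
          same-col⁺ (suc (suc τ)) (suc zero) e = ⊥-elim (z≢t₀ τ e)
          same-col⁺ (suc (suc s)) (suc (suc s′)) e = same-col e
          cross⁺ : ∀ s s′ → z⁺ s ≢ z⁺ s′ → b⁺ s ≢ b⁺ s′
          cross⁺ zero zero ne _ = ne refl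
          cross⁺ zero (suc zero) ne _ = ne refl
          cross⁺ (suc zero) zero ne _ = ne refl
          cross⁺ (suc zero) (suc zero) ne _ = ne refl
          cross⁺ zero (suc (suc τ)) _ e = x≢b τ e
          cross⁺ (suc zero) (suc (suc τ)) _ e = -x≢b τ e
          cross⁺ (suc (suc τ)) zero _ e = x≢b τ (sym e)
          cross⁺ (suc (suc τ)) (suc zero) _ e = -x≢b τ (sym e)
          cross⁺ (suc (suc s)) (suc (suc s′)) ne e = cross ne e
          class-injective⁺ : ∀ s s′ σ σ′ → z⁺ s ≢ z⁺ s′ → z⁺ σ ≢ z⁺ σ′ →
            SameClass (pos⁺ s , pos⁺ s′) (pos⁺ σ , pos⁺ σ′) → (pos⁺ σ , pos⁺ σ′) ≈ (pos⁺ s , pos⁺ s′)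
          class-injective⁺ s s′ σ σ′ ne ne′ e with normalise s s′ ne | normalise σ σ′ ne′
          ... | P , P′ , nP , s≈ | R , R′ , nR , σ≈ = ≈-trans {Y = R , R′} σ≈ (≈-trans {Y = P , P′} (class-injective-normal nP nR
                (sym (SameClass-resp {Y = R , R′} {Z = P , P′} σ≈ (sym (SameClass-resp {Y = P , P′} s≈ e))))) (≈-sym {Y = P , P′} s≈))

      starter : ∀ j → j ≤ r → (size r ℕ.* size r ℕ.* size r) ℕ.* 4 < M → Starter j
      starter zero _ _ = starter-0
      starter (suc j) j<r room = Step.starter⁺ j<r (starter j (ℕₚ.<⇒≤ j<r) room)
        (ℕₚ.≤-<-trans (ℕₚ.*-monoˡ-≤ 4 (ℕₚ.*-mono-≤ (ℕₚ.*-mono-≤ size≤ size≤) size≤)) room)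
        where
        size≤ : size j ≤ size r
        size≤ = subst₂ _≤_ (sym (size≡ j)) (sym (size≡ r)) (s≤s (ℕₚ.*-monoʳ-≤ 2 (ℕₚ.<⇒≤ j<r)))

      module Complete (S : Starter r) where
        open Starter S

        -- The r-th root of unity ξᴹ selects the column i with `χ′` cᵢ = ξᴹ. Then ξ / χ(cᵢ) is an
        -- M-th root of unity, hence a value of λ.
        vertical-cover : ∀ {ξ} → ξ L.^ E ≡ L.1# → ∃[ s ] ∃[ u ] (b s ≢ L.0# × u ≢ K.0# × χ (b s) L.* λ′ u ≡ ξ)
        vertical-cover {ξ} ξ^E with Cyc′.∃-ζ≡ {ξ L.^ M} (trans (L.^-assocʳ ξ M r) (trans (cong (ξ L.^_) (ℕₚ.*-comm M r)) ξ^E))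
        ... | i , ζi with occupied i (toℕ<n i)
        ...   | s , z≡ with column s
        ...     | inj₁ (z≡0 , _) = ⊥-elim (t≢0 i (trans (sym z≡) z≡0))
        ...     | inj₂ (i′ , _ , z≡′ , χ′b) with t-injective (trans (sym z≡′) z≡)
        ...       | refl = s , finish (λ-surjective y^M)
          where
          χb^M : χ (b s) L.^ M ≡ ξ L.^ M
          χb^M = trans (χ^M (b s)) (trans χ′b ζi)
          ξ^M≢0 : ξ L.^ M ≢ L.0#
          ξ^M≢0 = L.^-≢0 M (L.x^n≡1⇒x≢0 E ξ^E)
          b≢0 : b s ≢ L.0#
          b≢0 e = ξ^M≢0 (trans (sym χb^M) (trans (cong (λ t → χ t L.^ M) e) (trans (cong (L._^ M) (L.0^n≡0 f)) (L.0^n≡0 M))))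
          y^M : (ξ L./ χ (b s)) L.^ M ≡ L.1#
          y^M = trans (L.^-/ ξ M (χ≢0 b≢0)) (trans (cong (ξ L.^ M L./_) χb^M) (L.⁻¹-inverseʳ (ξ L.^ M) ξ^M≢0))
          finish : ∃[ u ] (u ≢ K.0# × λ′ u ≡ ξ L./ χ (b s)) → ∃[ u ] (b s ≢ L.0# × u ≢ K.0# × χ (b s) L.* λ′ u ≡ ξ)
          finish (u , u≢0 , e) = u , b≢0 , u≢0 , trans (cong (χ (b s) L.*_) e) (trans (L.*-comm (χ (b s)) (ξ L./ χ (b s))) (L.[x/y]*y≡x ξ (χ≢0 b≢0)))

        -- The M-th power removes λ and determines the column through `χ′`. Inside a column b is
        -- unique up to sign and χ is even, so the factors χ cancel and λ is injective.
        vertical-unique : ∀ {s s′ u u′} → b s ≢ L.0# → b s′ ≢ L.0# → u ≢ K.0# → u′ ≢ K.0# →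
                          χ (b s) L.* λ′ u ≡ χ (b s′) L.* λ′ u′ → z s ≡ z s′ × u ≡ u′
        vertical-unique {s} {s′} {u} {u′} b≢0 b′≢0 u≢0 u′≢0 e with column s | column s′
        ... | inj₁ (_ , b≡0) | _ = ⊥-elim (b≢0 b≡0)
        ... | inj₂ _ | inj₁ (_ , b≡0) = ⊥-elim (b′≢0 b≡0)
        ... | inj₂ (i , _ , z≡ , χ′b) | inj₂ (i′ , _ , z≡′ , χ′b′) = zz , λ-injective u≢0 u′≢0 (L.*-cancelˡ (χ≢0 b≢0) (trans e (cong (L._* λ′ u′) χ≡)))
          where
          power : ∀ s u → (χ (b s) L.* λ′ u) L.^ M ≡ χ′ (b s)
          power s u = trans (L.^-distrib-* (χ (b s)) (λ′ u) M) (trans (cong₂ L._*_ (χ^M (b s)) (λ^M≡1 u)) (L.*-identityʳ (χ′ (b s))))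
          zz : z s ≡ z s′
          zz = trans z≡ (trans (cong t (ζ-injective (trans (sym χ′b) (trans (trans (sym (power s u)) (trans (cong (L._^ M) e) (power s′ u′))) χ′b′)))) (sym z≡′))
          χ≡ : χ (b s′) ≡ χ (b s)
          χ≡ with same-col zz
          ... | inj₁ bb = cong χ bb
          ... | inj₂ bb = trans (cong χ bb) (χ-neg (b s))

-- Wilson's difference family and the design on the field with Q elements.

module DifferenceFamilies where
  open FiniteFields
  open FieldLemmas
  open Counting
  open MultiplicativeGroups
  open CyclotomicClasses
  open import Data.Nat as ℕ using (ℕ; zero; suc; _≤_; _<_; s≤s; z≤n; NonZero)
  import Data.Nat.Properties as ℕₚ
  open import Data.Fin as Fin using (Fin; zero; suc; toℕ; splitAt; _↑ˡ_; _↑ʳ_)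
  open import Data.Fin.Properties using (toℕ-injective; ↑ˡ-injective; ↑ʳ-injective; splitAt-↑ˡ; splitAt-↑ʳ; splitAt⁻¹-↑ˡ; splitAt⁻¹-↑ʳ; <-cmp; <-asym) renaming (_≟_ to _≟F_; _<?_ to _<F?_)
  open import Data.Sum using (_⊎_; inj₁; inj₂)
  open import Data.Product using (_×_; _,_; ∃-syntax; Σ-syntax; proj₁; proj₂; swap)
  open import Data.Empty using (⊥-elim)
  open import Function using (_∘_)
  open import Relation.Binary using (Tri; tri<; tri≈; tri>)
  open import Relation.Nullary
  open import Relation.Nullary.Decidable using (_×-dec_)
  open import Relation.Binary.PropositionalEquality

  -- The binomial coefficient k (k - 1) / 2; the recursion separates the pairs whose smaller index
  -- is zero, as `code` does.
  pairs : ℕ → ℕ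
  pairs zero = 0
  pairs (suc k) = k ℕ.+ pairs k

  code : ∀ {k} {i j : Fin k} → i Fin.< j → Fin (pairs k)
  code {suc k} {zero} {suc j} _ = j ↑ˡ pairs k
  code {suc k} {suc i} {suc j} (s≤s i<j) = k ↑ʳ code i<j

  decode : ∀ {k} (e : Fin (pairs k)) → Σ[ i ∈ Fin k ] Σ[ j ∈ Fin k ] Σ[ i<j ∈ i Fin.< j ] code i<j ≡ e
  decode {suc k} e with splitAt k e in eq
  ... | inj₁ j = zero , suc j , s≤s z≤n , splitAt⁻¹-↑ˡ eq
  ... | inj₂ e′ with decode {k} e′
  ...   | i , j , i<j , refl = suc i , suc j , s≤s i<j , splitAt⁻¹-↑ʳ {k} {pairs k} {e} eq

  code-injective : ∀ {k} {i j i′ j′ : Fin k} (h : i Fin.< j) (h′ : i′ Fin.< j′) → code h ≡ code h′ → i ≡ i′ × j ≡ j′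
  code-injective {suc k} {zero} {suc j} {zero} {suc j′} _ _ e = refl , cong suc (↑ˡ-injective (pairs k) j j′ e)
  code-injective {suc k} {suc i} {suc j} {suc i′} {suc j′} (s≤s h) (s≤s h′) e
    with code-injective h h′ (↑ʳ-injective k (code h) (code h′) e)
  ... | refl , refl = refl , refl
  code-injective {suc k} {zero} {suc j} {suc i′} {suc j′} _ (s≤s h′) e
    with trans (sym (splitAt-↑ˡ k j (pairs k))) (trans (cong (splitAt k) e) (splitAt-↑ʳ k (pairs k) (code h′)))
  ... | ()
  code-injective {suc k} {suc i} {suc j} {zero} {suc j′} (s≤s h) _ e
    with trans (sym (splitAt-↑ˡ k j′ (pairs k))) (trans (cong (splitAt k) (sym e)) (splitAt-↑ʳ k (pairs k) (code h)))
  ... | ()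

  -- A design with indexed and ordered blocks. Uniqueness includes the positions of the two points
  -- in the block, since the coefficients of a transverse block depend on these positions.
  record LinearSpace (v k : ℕ) : Set₁ where
    field
      Index   : Fin v × Fin v → Set
      Index?  : ∀ β → Dec (Index β)
      block   : Fin v × Fin v → Fin k → Fin v
      cover   : ∀ {x y} → x ≢ y → ∃[ β ] (Index β × ∃[ i ] ∃[ j ] (block β i ≡ x × block β j ≡ y))
      unique  : ∀ {β β′ i j i′ j′} → Index β → Index β′ → i ≢ j → block β i ≡ block β′ i′ → block β j ≡ block β′ j′ →
                β ≡ β′ × i ≡ i′ × j ≡ j′
      block-injective : ∀ {β i j} → Index β → block β i ≡ block β j → i ≡ j

  module DifferenceFamily {M : ℕ} (F : FiniteField (suc M)) (root : MultiplicativeGroup.PrimitiveRoot F) (k h : ℕ)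
                          {{E≢0 : NonZero (pairs k)}} {{h≢0 : NonZero h}} (M≡ : M ≡ pairs k ℕ.* (h ℕ.* 2))
                          (2≢0 : FiniteField._+_ F (FiniteField.1# F) (FiniteField.1# F) ≢ FiniteField.0# F) where
    open FieldProperties F
    open OddCharacteristic 2≢0
    f : ℕ
    f = h ℕ.* 2
    instance
      f≢0 : NonZero f
      f≢0 = ℕₚ.m*n≢0 h 2
    open Cyclotomy F root (pairs k) f M≡ using (χ; χ^E≡1; ζ; ζ-injective; ζ^E≡1; ∃-ζ≡; prescribed-differences)

    χ-neg : ∀ y → χ (- y) ≡ χ y
    χ-neg y = -x^2m≡x^2m y h

    χ-swap : ∀ x y → χ (x - y) ≡ χ (y - x)
    χ-swap x y = trans (cong χ (x-y≡-[y-x] x y)) (χ-neg (y - x))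

    -- Only i < j carries information. The other entries are set to 1, so that every entry is a root
    -- of unity as `prescribed-differences` demands.
    κ : Fin k → Fin k → Fin (suc M)
    κ i j with i <F? j
    ... | yes i<j = ζ (code i<j)
    ... | no _ = 1#

    κ^E≡1 : ∀ i j → κ i j ^ pairs k ≡ 1#
    κ^E≡1 i j with i <F? j
    ... | yes i<j = ζ^E≡1 (code i<j)
    ... | no _ = 1^n≡1 (pairs k)

    κ≡ζ : ∀ {i j} (i<j : i Fin.< j) → κ i j ≡ ζ (code i<j)
    κ≡ζ {i} {j} i<j with i <F? j
    ... | yes i<j′ = cong (λ h → ζ (code h)) (ℕₚ.≤-irrelevant i<j′ i<j)
    ... | no ≮ = ⊥-elim (≮ i<j)

    module _ (big : threshold (pairs k) k 1 ≤ suc M) where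
      -- Wilson's base block: its k (k - 1) / 2 differences represent all classes once. Its
      -- multiples by half of the f-th roots of unity, together with all translates, therefore cover
      -- every nonzero difference exactly once.
      base : Σ[ e ∈ (Fin k → Fin (suc M)) ] (∀ i j → i Fin.< j → χ (e j - e i) ≡ κ i j)
      base = prescribed-differences k big κ κ^E≡1

      e : Fin k → Fin (suc M)
      e = proj₁ base

      χe : ∀ {i j} (i<j : i Fin.< j) → χ (e j - e i) ≡ ζ (code i<j)
      χe {i} {j} i<j = trans (proj₂ base i j i<j) (κ≡ζ i<j)

      e-<-≢ : ∀ {i j} → i Fin.< j → e j - e i ≢ 0#
      e-<-≢ {i} {j} i<j = x^n≡1⇒x≢0 (f ℕ.* pairs k) (trans (sym (^-assocʳ (e j - e i) f (pairs k)))
        (trans (cong (_^ pairs k) (χe i<j)) (ζ^E≡1 (code i<j))))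
        where instance _ = ℕₚ.m*n≢0 f (pairs k)

      e-injective : ∀ {i j} → e i ≡ e j → i ≡ j
      e-injective {i} {j} eq = decide (<-cmp i j)
        where
        decide : Tri (i Fin.< j) (i ≡ j) (j Fin.< i) → i ≡ j
        decide (tri< i<j _ _) = ⊥-elim (e-<-≢ i<j (trans (cong (_- e i) (sym eq)) (-‿inverseʳ (e i))))
        decide (tri≈ _ i≡j _) = i≡j
        decide (tri> _ _ j<i) = ⊥-elim (e-<-≢ j<i (trans (cong (_- e j) eq) (-‿inverseʳ (e j))))

      e-≢ : ∀ {i j} → i ≢ j → e j - e i ≢ 0#
      e-≢ i≢j = x≢y⇒x-y≢0 (i≢j ∘ sym ∘ e-injective)

      class-pair : ∀ {i j i′ j′} → i ≢ j → i′ ≢ j′ → χ (e j - e i) ≡ χ (e j′ - e i′) → (i ≡ i′ × j ≡ j′) ⊎ (i ≡ j′ × j ≡ i′)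
      class-pair {i} {j} {i′} {j′} i≢j i′≢j′ eq = decide (<-cmp i j) (<-cmp i′ j′)
        where
        ordered : ∀ a b c d → a Fin.< b → c Fin.< d → χ (e b - e a) ≡ χ (e d - e c) → a ≡ c × b ≡ d
        ordered a b c d a<b c<d eq = code-injective a<b c<d (ζ-injective (trans (sym (χe a<b)) (trans eq (χe c<d))))
        decide : Tri (i Fin.< j) (i ≡ j) (j Fin.< i) → Tri (i′ Fin.< j′) (i′ ≡ j′) (j′ Fin.< i′) → (i ≡ i′ × j ≡ j′) ⊎ (i ≡ j′ × j ≡ i′)
        decide (tri≈ _ i≡j _) _ = ⊥-elim (i≢j i≡j)
        decide (tri< _ _ _) (tri≈ _ e _) = ⊥-elim (i′≢j′ e)
        decide (tri> _ _ _) (tri≈ _ e _) = ⊥-elim (i′≢j′ e)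
        decide (tri< h _ _) (tri< h′ _ _) = inj₁ (ordered i j i′ j′ h h′ eq)
        decide (tri< h _ _) (tri> _ _ h′) = inj₂ (ordered i j j′ i′ h h′ (trans eq (χ-swap (e j′) (e i′))))
        decide (tri> _ _ h) (tri< h′ _ _) = inj₂ (swap (ordered j i i′ j′ h h′ (trans (χ-swap (e i) (e j)) eq)))
        decide (tri> _ _ h) (tri> _ _ h′) = inj₁ (swap (ordered j i j′ i′ h h′ (trans (χ-swap (e i) (e j)) (trans eq (χ-swap (e j′) (e i′))))))

      -- One multiplier is taken from each pair {s , -s}.
      Half : Fin (suc M) → Set
      Half s = χ s ≡ 1# × toℕ s < toℕ (- s)

      half≢0 : ∀ {s} → χ s ≡ 1# → s ≢ 0#
      half≢0 = x^n≡1⇒x≢0 f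

      half-or-neg : ∀ {s} → χ s ≡ 1# → Half s ⊎ Half (- s)
      half-or-neg {s} χs = decide (ℕₚ.<-cmp (toℕ s) (toℕ (- s)))
        where
        decide : Tri (toℕ s < toℕ (- s)) (toℕ s ≡ toℕ (- s)) (toℕ (- s) < toℕ s) → Half s ⊎ Half (- s)
        decide (tri< h _ _) = inj₁ (χs , h)
        decide (tri≈ _ eq _) = ⊥-elim (x≢-x (half≢0 χs) (toℕ-injective eq))
        decide (tri> _ _ h) = inj₂ (trans (χ-neg s) χs , subst (λ t → toℕ (- s) < toℕ t) (sym (-‿involutive s)) h)

      Block : Fin (suc M) × Fin (suc M) → Fin k → Fin (suc M)
      Block (α , s) i = α + s * e i

      Block-diff : ∀ α s i j → Block (α , s) j - Block (α , s) i ≡ s * (e j - e i)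
      Block-diff α s i j = solve 4 (λ α s a b → (α :+ s :* b) :- (α :+ s :* a) := s :* (b :- a)) refl α s (e i) (e j)

      through : ∀ {x y} s i j → s * (e j - e i) ≡ y - x → Block (x - s * e i , s) i ≡ x × Block (x - s * e i , s) j ≡ y
      through {x} {y} s i j eq =
        solve 3 (λ x s a → (x :- s :* a) :+ s :* a := x) refl x s (e i) ,
        trans (solve 4 (λ x s a b → (x :- s :* a) :+ s :* b := x :+ s :* (b :- a)) refl x s (e i) (e j))
          (trans (cong (x +_) eq) (solve 2 (λ x y → x :+ (y :- x) := y) refl x y))

      -- The class of y - x picks the pair i < j, and the quotient by e j - e i is an f-th root of
      -- unity s. If s lies in the wrong half, -s is used with i and j exchanged.
      cover′ : ∀ {x y} → x ≢ y → ∃[ β ] (Half (proj₂ β) × ∃[ i ] ∃[ j ] (Block β i ≡ x × Block β j ≡ y))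
      cover′ {x} {y} x≢y = find (∃-ζ≡ (χ^E≡1 δ≢0))
        where
        δ = y - x
        δ≢0 : δ ≢ 0#
        δ≢0 = x≢y⇒x-y≢0 (x≢y ∘ sym)
        result = ∃[ β ] (Half (proj₂ β) × ∃[ i ] ∃[ j ] (Block β i ≡ x × Block β j ≡ y))
        assemble : ∀ i j → Σ[ s ∈ Fin (suc M) ] (χ s ≡ 1# × s * (e j - e i) ≡ y - x) → result
        assemble i j (s , χs , seq) = decide (half-or-neg χs)
          where
          decide : Half s ⊎ Half (- s) → result
          decide (inj₁ hs) = (x - s * e i , s) , hs , i , j , through s i j seq
          decide (inj₂ hs) = (x - (- s) * e j , - s) , hs , j , i ,
            through (- s) j i (trans (solve 3 (λ s a b → (:- s) :* (a :- b) := s :* (b :- a)) refl s (e i) (e j)) seq)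
        find : Σ[ c ∈ Fin (pairs k) ] ζ c ≡ χ δ → result
        find (c , ζc) = go (decode c)
          where
          go : Σ[ i ∈ Fin k ] Σ[ j ∈ Fin k ] Σ[ i<j ∈ i Fin.< j ] code i<j ≡ c → result
          go (i , j , i<j , cc) = assemble i j (δ / d , χs , [x/y]*y≡x δ d≢0)
            where
            d = e j - e i
            d≢0 : d ≢ 0#
            d≢0 = e-<-≢ i<j
            χs : χ (δ / d) ≡ 1#
            χs = trans (^-/ δ f d≢0) (trans (cong (_/ χ d) (trans (sym ζc) (trans (cong ζ (sym cc)) (sym (χe i<j))))) (⁻¹-inverseʳ (χ d) (^-≢0 f d≢0)))

      block-injective′ : ∀ {β i j} → Half (proj₂ β) → Block β i ≡ Block β j → i ≡ j
      block-injective′ {α , s} {i} {j} (χs , _) eq = e-injective (sym (x-y≡0⇒x≡y (*-cancelˡ (half≢0 χs) (trans (sym (Block-diff α s i j))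
        (trans (cong (λ t → Block (α , s) j - t) eq) (trans (-‿inverseʳ (Block (α , s) j)) (sym (zeroʳ s))))))))

      -- Multipliers have χ s = 1, so the class of the common difference determines the pair of
      -- positions up to order. Reversed order would give s′ = -s, but only one of the two belongs
      -- to `Half`.
      unique′ : ∀ {β β′ i j i′ j′} → Half (proj₂ β) → Half (proj₂ β′) → i ≢ j → Block β i ≡ Block β′ i′ → Block β j ≡ Block β′ j′ →
                β ≡ β′ × i ≡ i′ × j ≡ j′
      unique′ {α , s} {α′ , s′} {i} {j} {i′} {j′} hs@(χs , lt) hs′@(χs′ , lt′) i≢j ei ej = decide (class-pair i≢j i′≢j′ same)
        where
        i′≢j′ : i′ ≢ j′
        i′≢j′ refl = i≢j (block-injective′ {α , s} hs (trans ei (sym ej)))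
        diff : s * (e j - e i) ≡ s′ * (e j′ - e i′)
        diff = trans (sym (Block-diff α s i j)) (trans (cong₂ _-_ ej ei) (Block-diff α′ s′ i′ j′))
        χ-* : ∀ {s} → χ s ≡ 1# → ∀ x → χ (s * x) ≡ χ x
        χ-* {s} χs x = trans (^-distrib-* s x f) (trans (cong (_* χ x) χs) (*-identityˡ (χ x)))
        same : χ (e j - e i) ≡ χ (e j′ - e i′)
        same = trans (sym (χ-* χs (e j - e i))) (trans (cong χ diff) (χ-* χs′ (e j′ - e i′)))
        decide : (i ≡ i′ × j ≡ j′) ⊎ (i ≡ j′ × j ≡ i′) → (α , s) ≡ (α′ , s′) × i ≡ i′ × j ≡ j′
        decide (inj₁ (refl , refl)) = cong₂ _,_ α≡ s≡ , refl , refl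
          where
          s≡ : s ≡ s′
          s≡ = *-cancelʳ (e-≢ i≢j) diff
          α≡ : α ≡ α′
          α≡ = trans (solve 2 (λ α t → α := (α :+ t) :- t) refl α (s * e i)) (trans (cong₂ _-_ ei (cong (_* e i) s≡))
                 (solve 2 (λ α t → (α :+ t) :- t := α) refl α′ (s′ * e i)))
        decide (inj₂ (refl , refl)) = ⊥-elim (ℕₚ.<-asym (subst (toℕ s <_) (cong toℕ -s≡s′) lt)
            (subst (toℕ s′ <_) (cong toℕ (trans (cong -_ (sym -s≡s′)) (-‿involutive s))) lt′))
          where
          -s≡s′ : - s ≡ s′
          -s≡s′ = *-cancelʳ (e-≢ i′≢j′) (trans (solve 3 (λ s a b → (:- s) :* (b :- a) := s :* (a :- b)) refl s (e j) (e i)) diff)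

      linearSpace : LinearSpace (suc M) k
      linearSpace = record
        { Index = λ β → Half (proj₂ β)
        ; Index? = λ β → (χ (proj₂ β) ≟F 1#) ×-dec (toℕ (proj₂ β) ℕₚ.<? toℕ (- proj₂ β))
        ; block = Block
        ; cover = cover′
        ; unique = unique′
        ; block-injective = λ {β} → block-injective′ {β}
        }

-- The regular representation of G and the invariant extension of χ.

module LinearActions where
  open import Defs
  open FiniteFields
  open FieldLemmas
  open import Level using (Level)
  open import Data.Nat as ℕ using (ℕ; zero; suc; _≤_; _<_; s≤s; NonZero; _!)
  import Data.Nat.Properties as ℕₚ
  open import Data.Nat.Divisibility
  open import Data.Fin as Fin using (Fin; zero; suc; toℕ; finToFun; funToFin)
  open import Data.Fin.Properties using (toℕ<n; any?; pigeonhole; <-cmp; finToFun-funToFin; funToFin-finToFin) renaming (_≟_ to _≟F_)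
  open import Data.Product using (_×_; _,_; ∃-syntax; Σ-syntax; proj₁; proj₂)
  open import Data.Empty using (⊥-elim)
  open import Function using (_∘_)
  open import Algebra.Bundles using (Group)
  import Algebra.Properties.Group as GroupProperties
  open import Relation.Binary using (tri<; tri≈; tri>)
  open import Relation.Nullary
  open import Relation.Nullary.Decidable using (¬?; _×-dec_)
  open import Relation.Binary.PropositionalEquality

  least : ∀ {n} {P : Fin n → Set} → (∀ i → Dec (P i)) → ∃[ i ] P i → Σ[ i ∈ Fin n ] (P i × (∀ j → j Fin.< i → ¬ P j))
  least {suc n} {P} P? (i , pi) with P? zero
  ... | yes p = zero , p , λ _ ()
  ... | no ¬p = shift (least (λ i → P? (suc i)) (pred-witness i pi))
    where
    pred-witness : ∀ i → P i → ∃[ j ] P (suc j)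
    pred-witness zero p = ⊥-elim (¬p p)
    pred-witness (suc j) p = j , p
    shift : Σ[ i ∈ Fin n ] (P (suc i) × (∀ j → j Fin.< i → ¬ P (suc j))) → Σ[ i ∈ Fin (suc n) ] (P i × (∀ j → j Fin.< i → ¬ P j))
    shift (i , p , minimal) = suc i , p , λ { zero _ → ¬p ; (suc j) (s≤s j<i) → minimal j j<i }

  least-unique : ∀ {n} {P R : Fin n → Set} → (∀ i → P i → R i) → (∀ i → R i → P i) → ∀ {i j} →
                 P i → (∀ l → l Fin.< i → ¬ P l) → R j → (∀ l → l Fin.< j → ¬ R l) → i ≡ j
  least-unique PR RP {i} {j} pi mi rj mj with <-cmp i j
  ... | tri< i<j _ _ = ⊥-elim (mj i i<j (PR i pi))
  ... | tri≈ _ i≡j _ = i≡j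
  ... | tri> _ _ j<i = ⊥-elim (mi j j<i (RP j rj))

  module VectorSpace {q : ℕ} (F : FiniteField q) (n : ℕ) where
    open FieldProperties F

    -- Coding vectors as numbers makes V finite with decidable equality, and its order supplies
    -- canonical orbit representatives.
    V : Set
    V = Fin (q ℕ.^ n)

    at : V → Fin n → Fin q
    at = finToFun

    vec : (Fin n → Fin q) → V
    vec = funToFin

    at-vec : ∀ h i → at (vec h) i ≡ h i
    at-vec = finToFun-funToFin

    vec-cong : ∀ {m} {h h′ : Fin m → Fin q} → (∀ i → h i ≡ h′ i) → funToFin h ≡ funToFin h′
    vec-cong {zero} e = refl
    vec-cong {suc m} e = cong₂ Fin.combine (e zero) (vec-cong (e ∘ suc))

    ext : ∀ {u v} → (∀ i → at u i ≡ at v i) → u ≡ v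
    ext {u} {v} e = trans (sym (funToFin-finToFin {n} u)) (trans (vec-cong e) (funToFin-finToFin {n} v))

    infixl 6 _⊞_ _⊟_
    infixr 7 _◃_

    _⊞_ _⊟_ : V → V → V
    u ⊞ v = vec λ i → at u i + at v i
    u ⊟ v = vec λ i → at u i - at v i
    _◃_ : Fin q → V → V
    c ◃ v = vec λ i → c * at v i
    𝟎 : V
    𝟎 = vec λ _ → 0#

    at-⊞ : ∀ u v i → at (u ⊞ v) i ≡ at u i + at v i
    at-⊞ u v = at-vec _
    at-⊟ : ∀ u v i → at (u ⊟ v) i ≡ at u i - at v i
    at-⊟ u v = at-vec _
    at-◃ : ∀ c v i → at (c ◃ v) i ≡ c * at v i
    at-◃ c v = at-vec _
    at-𝟎 : ∀ i → at 𝟎 i ≡ 0#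
    at-𝟎 = at-vec _

    at-⊞◃ : ∀ a b d i → at (a ⊞ b ◃ d) i ≡ at a i + b * at d i
    at-⊞◃ a b d i = trans (at-⊞ a (b ◃ d) i) (cong (at a i +_) (at-◃ b d i))

    ◃-◃ : ∀ s t v → s ◃ t ◃ v ≡ (s * t) ◃ v
    ◃-◃ s t v = ext λ i → trans (at-◃ s (t ◃ v) i) (trans (cong (s *_) (at-◃ t v i)) (trans (sym (*-assoc s t (at v i))) (sym (at-◃ (s * t) v i))))

    1◃ : ∀ v → 1# ◃ v ≡ v
    1◃ v = ext λ i → trans (at-◃ 1# v i) (*-identityˡ (at v i))

    ◃𝟎 : ∀ t → t ◃ 𝟎 ≡ 𝟎
    ◃𝟎 t = ext λ i → trans (at-◃ t 𝟎 i) (trans (cong (t *_) (at-𝟎 i)) (trans (zeroʳ t) (sym (at-𝟎 i))))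

    0◃ : ∀ v → 0# ◃ v ≡ 𝟎
    0◃ v = ext λ i → trans (at-◃ 0# v i) (trans (zeroˡ (at v i)) (sym (at-𝟎 i)))

    ⊟≡𝟎⇒≡ : ∀ {u v} → u ⊟ v ≡ 𝟎 → u ≡ v
    ⊟≡𝟎⇒≡ {u} {v} e = ext λ i → x-y≡0⇒x≡y (trans (sym (at-⊟ u v i)) (trans (cong (λ w → at w i) e) (at-𝟎 i)))

    ◃-cancelˡ : ∀ {c u v} → c ≢ 0# → c ◃ u ≡ c ◃ v → u ≡ v
    ◃-cancelˡ {c} {u} {v} c≢0 e = ext λ i → *-cancelˡ c≢0 (trans (sym (at-◃ c u i)) (trans (cong (λ w → at w i) e) (at-◃ c v i)))

    ≢𝟎⇒∃ : ∀ {v} → v ≢ 𝟎 → ∃[ i ] at v i ≢ 0#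
    ≢𝟎⇒∃ {v} v≢𝟎 with any? (λ i → ¬? (at v i ≟F 0#))
    ... | yes r = r
    ... | no none = ⊥-elim (v≢𝟎 (ext λ i → trans (zero-at i (at v i ≟F 0#)) (sym (at-𝟎 i))))
      where
      zero-at : ∀ i → Dec (at v i ≡ 0#) → at v i ≡ 0#
      zero-at i (yes e) = e
      zero-at i (no ne) = ⊥-elim (none (i , ne))

    ◃-cancelʳ : ∀ {c c′ v} → v ≢ 𝟎 → c ◃ v ≡ c′ ◃ v → c ≡ c′
    ◃-cancelʳ {c} {c′} {v} v≢𝟎 e = cancel-at (≢𝟎⇒∃ v≢𝟎)
      where
      cancel-at : ∃[ i ] at v i ≢ 0# → c ≡ c′
      cancel-at (i , ne) = *-cancelʳ ne (trans (sym (at-◃ c v i)) (trans (cong (λ w → at w i) e) (at-◃ c′ v i)))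

    ◃-≢𝟎 : ∀ {c v} → c ≢ 0# → v ≢ 𝟎 → c ◃ v ≢ 𝟎
    ◃-≢𝟎 {c} c≢0 v≢𝟎 e = v≢𝟎 (◃-cancelˡ c≢0 (trans e (sym (◃𝟎 c))))

  module GroupAction {c ℓ : Level} (G : Group c ℓ) (n : ℕ) (H : HasOrder G n) {q : ℕ} (F : FiniteField q)
                     (f : ℕ) (n!∣f : n ! ∣ f) where
    open Group G using (Carrier; _∙_; ε; ∙-congˡ; ∙-congʳ; assoc; identityˡ; identityʳ; inverseˡ; inverseʳ)
      renaming (_≈_ to _≈ᴳ_; _⁻¹ to _⁻¹ᴳ; refl to ≈refl; sym to ≈sym; trans to ≈trans; ⁻¹-cong to ⁻¹-congᴳ)
    open GroupProperties G using (⁻¹-anti-homo-∙; ε⁻¹≈ε)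
    open HasOrder H
    open FieldProperties F
    open VectorSpace F n

    idx : Carrier → Fin n
    idx g = proj₁ (enum-surj g)

    enum-idx : ∀ g → enum (idx g) ≈ᴳ g
    enum-idx g = proj₂ (enum-surj g)

    idx-cong : ∀ {g h} → g ≈ᴳ h → idx g ≡ idx h
    idx-cong {g} {h} e = enum-inj _ _ (≈trans (enum-idx g) (≈trans e (≈sym (enum-idx h))))

    idx-injective : ∀ {g h} → idx g ≡ idx h → g ≈ᴳ h
    idx-injective {g} {h} e = ≈trans (≈sym (enum-idx g)) (subst (λ i → enum i ≈ᴳ h) (sym e) (enum-idx h))

    idx-enum : ∀ i → idx (enum i) ≡ i
    idx-enum i = enum-inj _ _ (enum-idx (enum i))

    -- The regular representation by permutation of coordinates; the inverse makes it a left action.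
    act : Carrier → V → V
    act g v = vec λ i → at v (idx (g ⁻¹ᴳ ∙ enum i))

    at-act : ∀ g v i → at (act g v) i ≡ at v (idx (g ⁻¹ᴳ ∙ enum i))
    at-act g v = at-vec _

    act-cong : ∀ {g h} → g ≈ᴳ h → ∀ v → act g v ≡ act h v
    act-cong {g} {h} e v = vec-cong {n} λ i → cong (at v) (idx-cong (∙-congʳ (⁻¹-congᴳ e)))

    act-ε : ∀ v → act ε v ≡ v
    act-ε v = ext λ i → trans (at-act ε v i) (cong (at v) (trans (idx-cong (≈trans (∙-congʳ ε⁻¹≈ε) (identityˡ (enum i)))) (idx-enum i)))

    act-∙ : ∀ g h v → act (g ∙ h) v ≡ act g (act h v)
    act-∙ g h v = ext λ i → trans (at-act (g ∙ h) v i) (trans (cong (at v) (idx-cong (eq i)))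
      (trans (sym (at-act h v (idx (g ⁻¹ᴳ ∙ enum i)))) (sym (at-act g (act h v) i))))
      where
      eq : ∀ i → (g ∙ h) ⁻¹ᴳ ∙ enum i ≈ᴳ h ⁻¹ᴳ ∙ enum (idx (g ⁻¹ᴳ ∙ enum i))
      eq i = ≈trans (∙-congʳ (⁻¹-anti-homo-∙ g h)) (≈trans (assoc _ _ _) (∙-congˡ (≈sym (enum-idx _))))

    act-inverse : ∀ g v → act (g ⁻¹ᴳ) (act g v) ≡ v
    act-inverse g v = trans (sym (act-∙ (g ⁻¹ᴳ) g v)) (trans (act-cong (inverseˡ g) v) (act-ε v))

    act-◃ : ∀ g t v → act g (t ◃ v) ≡ t ◃ act g v
    act-◃ g t v = ext λ i → trans (at-act g (t ◃ v) i) (trans (at-◃ t v _) (trans (cong (t *_) (sym (at-act g v i))) (sym (at-◃ t (act g v) i))))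

    act-⊞ : ∀ g u v → act g (u ⊞ v) ≡ act g u ⊞ act g v
    act-⊞ g u v = ext λ i → trans (at-act g (u ⊞ v) i) (trans (at-⊞ u v _)
      (trans (cong₂ _+_ (sym (at-act g u i)) (sym (at-act g v i))) (sym (at-⊞ (act g u) (act g v) i))))

    act-≢𝟎 : ∀ g {v} → v ≢ 𝟎 → act g v ≢ 𝟎
    act-≢𝟎 g {v} v≢𝟎 e = v≢𝟎 (trans (sym (act-inverse g v)) (trans (cong (act (g ⁻¹ᴳ)) e) act-𝟎))
      where
      act-𝟎 : act (g ⁻¹ᴳ) 𝟎 ≡ 𝟎
      act-𝟎 = ext λ i → trans (at-act (g ⁻¹ᴳ) 𝟎 i) (trans (at-𝟎 _) (sym (at-𝟎 i)))

    -- The test vector is the basis vector at the identity. Its image under g is 1 at coordinate g,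
    -- and its image under h has the value δ(h⁻¹ g) there.
    act-faithful : ∀ g h → (∀ v → act g v ≡ act h v) → g ≈ᴳ h
    act-faithful g h same = ≈sym (≈trans (≈sym (identityʳ h)) (≈trans (∙-congˡ (≈sym (idx-injective (decide (idx (h ⁻¹ᴳ ∙ g) ≟F idx ε)))))
        (≈trans (≈sym (assoc h (h ⁻¹ᴳ) g)) (≈trans (∙-congʳ (inverseʳ h)) (identityˡ g)))))
      where
      δ : Fin n → Fin q
      δ i with i ≟F idx ε
      ... | yes _ = 1#
      ... | no _ = 0#
      δ-ε : δ (idx ε) ≡ 1#
      δ-ε with idx ε ≟F idx ε
      ... | yes _ = refl
      ... | no ne = ⊥-elim (ne refl)
      δ-other : ∀ {i} → i ≢ idx ε → δ i ≡ 0#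
      δ-other {i} ne with i ≟F idx ε
      ... | yes e = ⊥-elim (ne e)
      ... | no _ = refl
      value : ∀ k → at (act k (vec δ)) (idx g) ≡ δ (idx (k ⁻¹ᴳ ∙ g))
      value k = trans (at-act k (vec δ) (idx g)) (trans (at-vec δ _) (cong δ (idx-cong (∙-congˡ (enum-idx g)))))
      decide : Dec (idx (h ⁻¹ᴳ ∙ g) ≡ idx ε) → idx (h ⁻¹ᴳ ∙ g) ≡ idx ε
      decide (yes e) = e
      decide (no ne) = ⊥-elim (1≢0 (trans (sym δ-ε) (trans (cong δ (idx-cong (≈sym (inverseˡ g)))) (trans (sym (value g))
        (trans (cong (λ w → at w (idx g)) (same (vec δ))) (trans (value h) (δ-other ne)))))))

    power : Carrier → ℕ → Carrier
    power g zero = ε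
    power g (suc m) = g ∙ power g m

    act-power : ∀ g {t v} → act g v ≡ t ◃ v → ∀ m → act (power g m) v ≡ (t ^ m) ◃ v
    act-power g {t} {v} e zero = trans (act-ε v) (sym (1◃ v))
    act-power g {t} {v} e (suc m) = trans (act-∙ g (power g m) v) (trans (cong (act g) (act-power g e m)) (trans (act-◃ g (t ^ m) v)
      (trans (cong ((t ^ m) ◃_) e) (trans (◃-◃ (t ^ m) t v) (cong (_◃ v) (*-comm (t ^ m) t))))))

    -- Two of the powers g⁰, …, gⁿ coincide.
    eigenvalue-order : ∀ g {t v} → v ≢ 𝟎 → act g v ≡ t ◃ v → t ≢ 0# → t ^ f ≡ 1#
    eigenvalue-order g {t} {v} v≢𝟎 e t≢0 = conclude (pigeonhole (ℕₚ.n<1+n n) (λ i → idx (power g (toℕ i))))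
      where
      conclude : ∃[ i ] ∃[ j ] (i Fin.< j × idx (power g (toℕ i)) ≡ idx (power g (toℕ j))) → t ^ f ≡ 1#
      conclude (i , j , i<j , same) = divisible (m≤n⇒m∣n! d≤n)
        where
        d : ℕ
        d = toℕ j ℕ.∸ toℕ i
        instance
          d≢0 : NonZero d
          d≢0 = ℕ.>-nonZero (ℕₚ.m<n⇒0<n∸m i<j)
        d≤n : d ≤ n
        d≤n = ℕₚ.≤-trans (ℕₚ.m∸n≤m (toℕ j) (toℕ i)) (ℕₚ.≤-pred (toℕ<n j))
        t^i≡t^j : t ^ toℕ i ≡ t ^ toℕ j
        t^i≡t^j = ◃-cancelʳ v≢𝟎 (trans (sym (act-power g e (toℕ i))) (trans (act-cong (idx-injective same) v) (act-power g e (toℕ j))))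
        t^d≡1 : t ^ d ≡ 1#
        t^d≡1 = *-cancelˡ {x = t ^ toℕ i} (^-≢0 (toℕ i) t≢0) (trans (sym (^-homo-* t (toℕ i) d))
          (trans (cong (t ^_) (ℕₚ.m+[n∸m]≡n (ℕₚ.<⇒≤ i<j))) (trans (sym t^i≡t^j) (sym (*-identityʳ (t ^ toℕ i))))))
        m≤n⇒m∣n! : ∀ {m n} → .{{NonZero m}} → m ≤ n → m ∣ n !
        m≤n⇒m∣n! {suc m} h = ∣-trans (m∣m*n (m !)) (m≤n⇒m!∣n! h)
        divisible : d ∣ n ! → t ^ f ≡ 1#
        divisible d∣n! with ∣-trans d∣n! n!∣f
        ... | divides m f≡ = trans (cong (t ^_) (trans f≡ (ℕₚ.*-comm m d))) (trans (sym (^-assocʳ t d m)) (trans (cong (_^ m) t^d≡1) (1^n≡1 m)))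

    χ : Fin q → Fin q
    χ x = x ^ f

    -- Orbits under G together with all nonzero scalars; searching t and an index of G keeps the
    -- relation decidable.
    Orbit : V → V → Set
    Orbit v z = Σ[ t ∈ Fin q ] (t ≢ 0# × Σ[ i ∈ Fin n ] v ≡ t ◃ act (enum i) z)

    Orbit? : ∀ v z → Dec (Orbit v z)
    Orbit? v z = any? λ t → ¬? (t ≟F 0#) ×-dec any? λ i → v ≟F t ◃ act (enum i) z

    orbit : ∀ {v z t} g → t ≢ 0# → v ≡ t ◃ act g z → Orbit v z
    orbit {v} {z} {t} g t≢0 e = t , t≢0 , idx g , trans e (cong (t ◃_) (act-cong (≈sym (enum-idx g)) z))

    representative : ∀ v → Σ[ z ∈ V ] (Orbit v z × (∀ z′ → z′ Fin.< z → ¬ Orbit v z′))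
    representative v = least (Orbit? v) (v , orbit ε 1≢0 (sym (trans (1◃ (act ε v)) (act-ε v))))

    -- v = t g z, with z the first vector of the orbit of v, is sent to tᶠ; the scalars t′ with t′ z = g′ z for
    -- some g′ satisfy t′ᶠ = 1.
    χ̂ : V → Fin q
    χ̂ v = χ (proj₁ (proj₁ (proj₂ (representative v))))

    Orbit-shift : ∀ {v z s} g → s ≢ 0# → Orbit v z → Orbit (s ◃ act g v) z
    Orbit-shift {v} {z} {s} g s≢0 (t , t≢0 , i , e) = orbit (g ∙ enum i) (*-≢0 s≢0 t≢0) (begin
      s ◃ act g v                          ≡⟨ cong (λ w → s ◃ act g w) e ⟩
      s ◃ act g (t ◃ act (enum i) z)       ≡⟨ cong (s ◃_) (act-◃ g t (act (enum i) z)) ⟩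
      s ◃ t ◃ act g (act (enum i) z)       ≡⟨ ◃-◃ s t _ ⟩
      (s * t) ◃ act g (act (enum i) z)     ≡⟨ cong ((s * t) ◃_) (sym (act-∙ g (enum i) z)) ⟩
      (s * t) ◃ act (g ∙ enum i) z ∎)
      where open ≡-Reasoning

    Orbit-unshift : ∀ {v z s} g → s ≢ 0# → Orbit (s ◃ act g v) z → Orbit v z
    Orbit-unshift {v} {z} {s} g s≢0 o = subst (λ w → Orbit w z) (begin
      s ⁻¹ ◃ act (g ⁻¹ᴳ) (s ◃ act g v)    ≡⟨ cong (s ⁻¹ ◃_) (act-◃ (g ⁻¹ᴳ) s (act g v)) ⟩
      s ⁻¹ ◃ s ◃ act (g ⁻¹ᴳ) (act g v)    ≡⟨ ◃-◃ (s ⁻¹) s _ ⟩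
      (s ⁻¹ * s) ◃ act (g ⁻¹ᴳ) (act g v)  ≡⟨ cong₂ _◃_ (⁻¹-inverseˡ s s≢0) (act-inverse g v) ⟩
      1# ◃ v                              ≡⟨ 1◃ v ⟩
      v ∎) (Orbit-shift (g ⁻¹ᴳ) (⁻¹-≢0 s≢0) o)
      where open ≡-Reasoning

    -- Both vectors have the same first orbit representative z. Comparing the two expressions in
    -- terms of z shows that s t / t′ is an eigenvalue of a group element at z, so its f-th power is
    -- 1.
    χ̂-shift : ∀ {v s} g → v ≢ 𝟎 → s ≢ 0# → χ̂ (s ◃ act g v) ≡ χ s * χ̂ v
    χ̂-shift {v} {s} g v≢𝟎 s≢0 = compare (representative v) (representative (s ◃ act g v))
      where
      compare : (X : Σ[ z ∈ V ] (Orbit v z × (∀ z′ → z′ Fin.< z → ¬ Orbit v z′)))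
                (Y : Σ[ z ∈ V ] (Orbit (s ◃ act g v) z × (∀ z′ → z′ Fin.< z → ¬ Orbit (s ◃ act g v) z′))) →
                χ (proj₁ (proj₁ (proj₂ Y))) ≡ χ s * χ (proj₁ (proj₁ (proj₂ X)))
      compare (z , o@(t , t≢0 , i , v≡) , minimal) (z′ , o′@(t′ , t′≢0 , i′ , w≡) , minimal′) = begin
        χ t′               ≡⟨ sym (*-identityʳ (χ t′)) ⟩
        χ t′ * 1#          ≡⟨ cong (χ t′ *_) (sym χα≡1) ⟩
        χ t′ * χ (s * t / t′) ≡⟨ sym (^-distrib-* t′ (s * t / t′) f) ⟩
        χ (t′ * (s * t / t′)) ≡⟨ cong χ (trans (*-comm t′ _) ([x/y]*y≡x (s * t) t′≢0)) ⟩
        χ (s * t)          ≡⟨ ^-distrib-* s t f ⟩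
        χ s * χ t ∎
        where
        open ≡-Reasoning
        z≡z′ : z ≡ z′
        z≡z′ = least-unique {P = Orbit v} {R = Orbit (s ◃ act g v)} (λ _ → Orbit-shift g s≢0) (λ _ → Orbit-unshift g s≢0) o minimal o′ minimal′
        z≢𝟎 : z ≢ 𝟎
        z≢𝟎 z≡𝟎 = v≢𝟎 (trans v≡ (trans (cong (λ w → t ◃ act (enum i) w) z≡𝟎)
          (trans (sym (act-◃ (enum i) t 𝟎)) (trans (cong (act (enum i)) (trans (◃𝟎 t) (sym (0◃ 𝟎)))) (trans (act-◃ (enum i) 0# 𝟎) (0◃ _))))))
        k : Carrier
        k = (g ∙ enum i) ⁻¹ᴳ ∙ enum i′
        same : t′ ◃ act (enum i′) z ≡ (s * t) ◃ act (g ∙ enum i) z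
        same = begin
          t′ ◃ act (enum i′) z                 ≡⟨ cong (λ w → t′ ◃ act (enum i′) w) z≡z′ ⟩
          t′ ◃ act (enum i′) z′                ≡⟨ sym w≡ ⟩
          s ◃ act g v                          ≡⟨ cong (λ w → s ◃ act g w) v≡ ⟩
          s ◃ act g (t ◃ act (enum i) z)       ≡⟨ cong (s ◃_) (act-◃ g t (act (enum i) z)) ⟩
          s ◃ t ◃ act g (act (enum i) z)       ≡⟨ ◃-◃ s t _ ⟩
          (s * t) ◃ act g (act (enum i) z)     ≡⟨ cong ((s * t) ◃_) (sym (act-∙ g (enum i) z)) ⟩
          (s * t) ◃ act (g ∙ enum i) z ∎
        eigen : act k z ≡ (s * t / t′) ◃ z
        eigen = ◃-cancelˡ {c = t′} t′≢0 (begin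
          t′ ◃ act k z                                             ≡⟨ cong (t′ ◃_) (act-∙ ((g ∙ enum i) ⁻¹ᴳ) (enum i′) z) ⟩
          t′ ◃ act ((g ∙ enum i) ⁻¹ᴳ) (act (enum i′) z)            ≡⟨ sym (act-◃ ((g ∙ enum i) ⁻¹ᴳ) t′ _) ⟩
          act ((g ∙ enum i) ⁻¹ᴳ) (t′ ◃ act (enum i′) z)            ≡⟨ cong (act ((g ∙ enum i) ⁻¹ᴳ)) same ⟩
          act ((g ∙ enum i) ⁻¹ᴳ) ((s * t) ◃ act (g ∙ enum i) z)    ≡⟨ act-◃ ((g ∙ enum i) ⁻¹ᴳ) (s * t) _ ⟩
          (s * t) ◃ act ((g ∙ enum i) ⁻¹ᴳ) (act (g ∙ enum i) z)    ≡⟨ cong ((s * t) ◃_) (act-inverse (g ∙ enum i) z) ⟩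
          (s * t) ◃ z                                              ≡⟨ cong (_◃ z) (sym (trans (*-comm t′ _) ([x/y]*y≡x (s * t) t′≢0))) ⟩
          (t′ * (s * t / t′)) ◃ z                                  ≡⟨ sym (◃-◃ t′ (s * t / t′) z) ⟩
          t′ ◃ (s * t / t′) ◃ z ∎)
        χα≡1 : χ (s * t / t′) ≡ 1#
        χα≡1 = eigenvalue-order k z≢𝟎 eigen (/-≢0 (*-≢0 s≢0 t≢0) t′≢0)

    χ̂-◃ : ∀ {v s} → v ≢ 𝟎 → s ≢ 0# → χ̂ (s ◃ v) ≡ χ s * χ̂ v
    χ̂-◃ {v} {s} v≢𝟎 s≢0 = trans (cong (λ w → χ̂ (s ◃ w)) (sym (act-ε v))) (χ̂-shift ε v≢𝟎 s≢0)

    χ̂-act : ∀ {v} g → v ≢ 𝟎 → χ̂ (act g v) ≡ χ̂ v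
    χ̂-act {v} g v≢𝟎 = trans (cong χ̂ (sym (1◃ (act g v)))) (trans (χ̂-shift g v≢𝟎 1≢0) (trans (cong (_* χ̂ v) (1^n≡1 f)) (*-identityˡ (χ̂ v))))

-- From a parametrised family of blocks to a design with a group action.

module BlockFamilies where
  open import Defs
  open Counting
  open import Level using (Level)
  open import Data.Nat as ℕ using (ℕ; zero; suc)
  import Data.Nat.Properties as ℕₚ
  open import Data.Bool using (true)
  open import Data.Fin as Fin using (Fin; zero; suc)
  open import Data.Fin.Properties using (any?) renaming (_≟_ to _≟F_)
  open import Data.Fin.Permutation using (Permutation′; permutation; _⟨$⟩ˡ_)
  open import Data.Fin.Subset using (Subset; ∣_∣) renaming (_∈_ to _∈ₛ_)
  open import Data.Vec using (tabulate)
  open import Data.Vec.Properties using (lookup∘tabulate; tabulate-cong; lookup⇒[]=; []=⇒lookup)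
  open import Data.List as List using (List)
  open import Data.List.Membership.Propositional using (_∈_)
  open import Data.List.Membership.Propositional.Properties using (∈-map⁺; ∈-map⁻; ∈-filter⁺; ∈-filter⁻)
  open import Data.Product using (_×_; _,_; ∃-syntax; proj₁; proj₂)
  open import Data.Empty using (⊥-elim)
  open import Function using (_∘_)
  open import Algebra.Bundles using (Group)
  open import Relation.Nullary
  open import Relation.Nullary.Decidable using (does-≡; map′)
  open import Relation.Binary.PropositionalEquality

  card-tabulate : ∀ {n} {P : Fin n → Set} (P? : ∀ i → Dec (P i)) → ∣ tabulate (does ∘ P?) ∣ ≡ count P?
  card-tabulate {zero} P? = refl
  card-tabulate {suc n} P? with P? zero
  ... | yes _ = cong suc (card-tabulate (P? ∘ suc))
  ... | no _ = card-tabulate (P? ∘ suc)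

  does-cong : ∀ {A B : Set} (a? : Dec A) (b? : Dec B) → (A → B) → (B → A) → does a? ≡ does b?
  does-cong a? b? f g = does-≡ (map′ f g a?) b?

  range : ∀ {k v} → (Fin k → Fin v) → Subset v
  range e = tabulate λ y → does (any? λ s → e s ≟F y)

  ∈-range⁺ : ∀ {k v} (e : Fin k → Fin v) s → e s ∈ₛ range e
  ∈-range⁺ e s = lookup⇒[]= (e s) (range e) (trans (lookup∘tabulate _ (e s)) (holds (any? λ t → e t ≟F e s)))
    where
    holds : (d : Dec (∃[ t ] e t ≡ e s)) → does d ≡ true
    holds (yes _) = refl
    holds (no none) = ⊥-elim (none (s , refl))

  ∈-range⁻ : ∀ {k v} (e : Fin k → Fin v) {y} → y ∈ₛ range e → ∃[ s ] e s ≡ y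
  ∈-range⁻ e {y} h = holds (any? λ t → e t ≟F y) (trans (sym (lookup∘tabulate _ y)) ([]=⇒lookup h))
    where
    holds : (d : Dec (∃[ t ] e t ≡ y)) → does d ≡ true → ∃[ s ] e s ≡ y
    holds (yes r) _ = r

  card-range : ∀ {k v} (e : Fin k → Fin v) → (∀ {s t} → e s ≡ e t → s ≡ t) → ∣ range e ∣ ≡ k
  card-range {k} {v} e inj = begin
    ∣ range e ∣                                ≡⟨ card-tabulate (λ y → any? λ s → e s ≟F y) ⟩
    ∑[ y < v ] ind (any? λ s → e s ≟F y)       ≡⟨ sum-cong-≗ {v} (λ y → hits y (any? λ s → e s ≟F y)) ⟩
    ∑[ y < v ] ∑[ s < k ] ind (e s ≟F y)       ≡⟨ ∑-comm (λ y s → ind (e s ≟F y)) ⟩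
    ∑[ s < k ] ∑[ y < v ] ind (e s ≟F y)       ≡⟨ sum-cong-≗ {k} (λ s → trans (sum-cong-≗ {v} λ y → ind-cong (e s ≟F y) (y ≟F e s) sym sym) (count-≡ (e s))) ⟩
    ∑[ s < k ] 1                               ≡⟨ trans (sum-const k 1) (ℕₚ.*-identityʳ k) ⟩
    k ∎
    where
    open ≡-Reasoning
    hits : ∀ y (d : Dec (∃[ s ] e s ≡ y)) → ind d ≡ ∑[ s < k ] ind (e s ≟F y)
    hits y (no none) = sym (count-none (λ s → e s ≟F y) λ s h → none (s , h))
    hits y (yes (s , h)) = ℕₚ.≤-antisym
      (ℕₚ.≤-trans (ℕₚ.≤-reflexive (sym (ind-yes (e s ≟F y) h))) (term≤sum (λ s → ind (e s ≟F y)) s))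
      (count-unique (λ s → e s ≟F y) λ s t hs ht → inj (trans hs (sym ht)))

  module Family {Pt : Set} {v k : ℕ} (enc : Pt → Fin v) (dec : Fin v → Pt) (dec-enc : ∀ x → dec (enc x) ≡ x) (enc-dec : ∀ i → enc (dec i) ≡ i)
                {I : Set} (Valid : I → Set) (valid? : ∀ β → Dec (Valid β)) (indices : List I) (complete : ∀ β → β ∈ indices)
                (blk : I → Fin k → Pt) where

    -- Different parameters may describe the same block, as d and -d do, so uniqueness is required
    -- of point sets and not of parameters.
    SameRange : I → I → Set
    SameRange β β′ = (∀ s → ∃[ t ] blk β s ≡ blk β′ t) × (∀ t → ∃[ s ] blk β s ≡ blk β′ t)

    enc-injective : ∀ {x y} → enc x ≡ enc y → x ≡ y
    enc-injective {x} {y} e = trans (sym (dec-enc x)) (trans (cong dec e) (dec-enc y))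

    subset : I → Subset v
    subset β = range (enc ∘ blk β)

    subset-cong : ∀ {β β′} → SameRange β β′ → subset β ≡ subset β′
    subset-cong {β} {β′} (to , from) = tabulate-cong λ y → does-cong (any? λ s → enc (blk β s) ≟F y) (any? λ s → enc (blk β′ s) ≟F y)
      (λ (s , h) → proj₁ (to s) , trans (cong enc (sym (proj₂ (to s)))) h)
      (λ (t , h) → proj₁ (from t) , trans (cong enc (proj₂ (from t))) h)

    module _ (inj : ∀ {β s t} → Valid β → blk β s ≡ blk β t → s ≡ t)
             (cover : ∀ {x y} → x ≢ y → ∃[ β ] (Valid β × ∃[ s ] ∃[ t ] (blk β s ≡ x × blk β t ≡ y)))
             (unique : ∀ {β β′ s t s′ t′} → Valid β → Valid β′ → s ≢ t → blk β s ≡ blk β′ s′ → blk β t ≡ blk β′ t′ → SameRange β β′) where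

      blockList : List (Subset v)
      blockList = List.map subset (List.filter valid? indices)

      ∈-blockList⁺ : ∀ {β} → Valid β → subset β ∈ blockList
      ∈-blockList⁺ {β} h = ∈-map⁺ subset (∈-filter⁺ valid? (complete β) h)

      ∈-blockList⁻ : ∀ {B} → B ∈ blockList → ∃[ β ] (Valid β × B ≡ subset β)
      ∈-blockList⁻ h with ∈-map⁻ subset h
      ... | β , β∈ , e = β , proj₂ (∈-filter⁻ valid? {xs = indices} β∈) , e

      ∈-subset⁻ : ∀ {β x} → x ∈ₛ subset β → ∃[ s ] blk β s ≡ dec x
      ∈-subset⁻ {β} {x} h with ∈-range⁻ (enc ∘ blk β) h
      ... | s , e = s , trans (sym (dec-enc (blk β s))) (cong dec e)

      ∈-subset⁺ : ∀ {β s x} → blk β s ≡ dec x → x ∈ₛ subset β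
      ∈-subset⁺ {β} {s} {x} e = subst (_∈ₛ subset β) (trans (cong enc e) (enc-dec x)) (∈-range⁺ (enc ∘ blk β) s)

      dec-≢ : ∀ {x y} → x ≢ y → dec x ≢ dec y
      dec-≢ {x} {y} x≢y e = x≢y (trans (sym (enc-dec x)) (trans (cong enc e) (enc-dec y)))

      design : Design v k
      design = record
        { blocks = blockList
        ; blockSize = size
        ; covered = λ x y x≢y → covers x y (cover (dec-≢ x≢y))
        ; uniqueBlk = λ x y x≢y hB xB yB hB′ xB′ yB′ → uniq x≢y (∈-blockList⁻ hB) xB yB (∈-blockList⁻ hB′) xB′ yB′
        }
        where
        size : ∀ {B} → B ∈ blockList → ∣ B ∣ ≡ k
        size h with ∈-blockList⁻ h
        ... | β , val , refl = card-range (enc ∘ blk β) λ e → inj val (enc-injective e)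
        covers : ∀ x y → ∃[ β ] (Valid β × ∃[ s ] ∃[ t ] (blk β s ≡ dec x × blk β t ≡ dec y)) → ∃[ B ] (B ∈ blockList × x ∈ₛ B × y ∈ₛ B)
        covers x y (β , val , s , t , ex , ey) = subset β , ∈-blockList⁺ val , ∈-subset⁺ {β} {s} ex , ∈-subset⁺ {β} {t} ey
        uniq : ∀ {x y} → x ≢ y → ∀ {B B′} → ∃[ β ] (Valid β × B ≡ subset β) → x ∈ₛ B → y ∈ₛ B →
               ∃[ β ] (Valid β × B′ ≡ subset β) → x ∈ₛ B′ → y ∈ₛ B′ → B ≡ B′
        uniq x≢y (β , val , refl) xB yB (β′ , val′ , refl) xB′ yB′
          with ∈-subset⁻ {β} xB | ∈-subset⁻ {β} yB | ∈-subset⁻ {β′} xB′ | ∈-subset⁻ {β′} yB′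
        ... | s , es | t , et | s′ , es′ | t′ , et′ = subset-cong (unique val val′
                (λ { refl → dec-≢ x≢y (trans (sym es) et) }) (trans es (sym es′)) (trans et (sym et′)))

      module _ {c ℓ : Level} (G : Group c ℓ) where
        open Group G using (Carrier; _≈_; _∙_; ε; _⁻¹; inverseˡ; inverseʳ)

        module _ (move : Carrier → Pt → Pt)
                 (move-cong : ∀ {g h} → g ≈ h → ∀ x → move g x ≡ move h x)
                 (move-ε : ∀ x → move ε x ≡ x)
                 (move-∙ : ∀ g h x → move (g ∙ h) x ≡ move g (move h x))
                 (faithful : ∀ g h → (∀ x → move g x ≡ move h x) → g ≈ h)
                 (preserves : ∀ g {β} → Valid β → ∃[ β′ ] (Valid β′ × (∀ s → blk β′ s ≡ move g (blk β s)))) where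

          cancel : ∀ {g h} → g ∙ h ≈ ε → ∀ i → enc (move g (dec (enc (move h (dec i))))) ≡ i
          cancel {g} {h} e i = trans (cong (enc ∘ move g) (dec-enc (move h (dec i)))) (trans (cong enc (trans (sym (move-∙ g h (dec i)))
            (trans (move-cong e (dec i)) (move-ε (dec i))))) (enc-dec i))

          perm : Carrier → Permutation′ v
          perm g = permutation (enc ∘ move g ∘ dec) (enc ∘ move (g ⁻¹) ∘ dec) (cancel (inverseʳ g)) (cancel (inverseˡ g))

          image-subset : ∀ g {β β′} → (∀ s → blk β′ s ≡ move g (blk β s)) → image (perm g) (subset β) ≡ subset β′
          image-subset g {β} {β′} e = tabulate-cong λ y → trans (lookup∘tabulate _ (perm g ⟨$⟩ˡ y))
            (does-cong (any? λ s → enc (blk β s) ≟F perm g ⟨$⟩ˡ y) (any? λ s → enc (blk β′ s) ≟F y) (to y) (from y))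
            where
            to : ∀ y → ∃[ s ] enc (blk β s) ≡ perm g ⟨$⟩ˡ y → ∃[ s ] enc (blk β′ s) ≡ y
            to y (s , h) = s , trans (cong enc (trans (e s) (cong (move g) (trans (sym (dec-enc (blk β s))) (cong dec h))))) (cancel (inverseʳ g) y)
            from : ∀ y → ∃[ s ] enc (blk β′ s) ≡ y → ∃[ s ] enc (blk β s) ≡ perm g ⟨$⟩ˡ y
            from y (s , refl) = s , sym (trans (cong (λ x → enc (move (g ⁻¹) x)) (trans (dec-enc (blk β′ s)) (e s)))
              (cong enc (trans (sym (move-∙ (g ⁻¹) g (blk β s))) (trans (move-cong (inverseˡ g) (blk β s)) (move-ε (blk β s))))))

          embeds : EmbedsInAut G design
          embeds = record
            { ρ = perm
            ; ρ-aut = λ g → (λ h → forward g (∈-blockList⁻ h)) , λ h → backward g (∈-blockList⁻ h)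
            ; ρ-cong = λ e x → cong enc (move-cong e (dec x))
            ; ρ-hom = λ g h x → cong enc (trans (move-∙ g h (dec x)) (cong (move g) (sym (dec-enc (move h (dec x))))))
            ; ρ-inj = λ g h same → faithful g h λ x → trans (cong (move g) (sym (dec-enc x)))
                (trans (enc-injective (same (enc x))) (cong (move h) (dec-enc x)))
            }
            where
            forward : ∀ g {B} → ∃[ β ] (Valid β × B ≡ subset β) → image (perm g) B ∈ blockList
            forward g (β , val , refl) with preserves g val
            ... | β′ , val′ , e = subst (_∈ blockList) (sym (image-subset g {β} {β′} e)) (∈-blockList⁺ val′)
            backward : ∀ g {B} → ∃[ β ] (Valid β × B ≡ subset β) → ∃[ B′ ] (B′ ∈ blockList × image (perm g) B′ ≡ B)
            -- The block sent to B by g is the image of B under the inverse of g.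
            backward g (β , val , refl) with preserves (g ⁻¹) val
            ... | β′ , val′ , e = subset β′ , ∈-blockList⁺ val′ , image-subset g {β′} {β} λ s → sym (trans (cong (move g) (e s))
                    (trans (sym (move-∙ g (g ⁻¹) (blk β s))) (trans (move-cong (inverseʳ g) (blk β s)) (move-ε (blk β s)))))

-- The three kinds of blocks, their covering property and their uniqueness.

module Assembling where
  open import Defs
  open FiniteFields
  open FieldLemmas
  open LinearActions
  open BlockFamilies
  open DifferenceFamilies
  open import Level using (Level)
  open import Data.Nat as ℕ using (ℕ; _<_; NonZero; _!)
  import Data.Nat.Properties as ℕₚ
  open import Data.Nat.Divisibility using (_∣_)
  open import Data.Fin as Fin using (Fin; toℕ; combine; remQuot)
  open import Data.Fin.Properties using (any?; <-cmp; remQuot-combine; combine-remQuot) renaming (_≟_ to _≟F_)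
  open import Data.List as List using (List; allFin; cartesianProduct; _++_)
  open import Data.List.Membership.Propositional using (_∈_)
  open import Data.List.Membership.Propositional.Properties using (∈-allFin; ∈-cartesianProduct⁺; ∈-map⁺; ∈-++⁺ˡ; ∈-++⁺ʳ)
  open import Data.Sum using (_⊎_; inj₁; inj₂)
  open import Data.Product using (Σ; _×_; _,_; ∃-syntax; Σ-syntax; proj₁; proj₂)
  open import Data.Empty using (⊥; ⊥-elim)
  open import Function using (_∘_)
  open import Algebra.Bundles using (Group)
  open import Relation.Binary using (Tri; tri<; tri≈; tri>)
  open import Relation.Nullary
  open import Relation.Nullary.Decidable using (¬?; _×-dec_)
  open import Relation.Binary.PropositionalEquality

  module Assembly
    {c ℓ : Level} (G : Group c ℓ) (n : ℕ) (H : HasOrder G n) {Q P : ℕ} (FQ : FiniteField Q) (FP : FiniteField P)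
    (f E : ℕ) {{f≢0 : NonZero f}} {{E≢0 : NonZero E}} (n!∣f : n ! ∣ f) where
    private
      module K = FieldProperties FQ
      module L = FieldProperties FP

    module _
      (χ^E≡1 : ∀ {x} → x ≢ L.0# → (x L.^ f) L.^ E ≡ L.1#)
      (2≢0 : L.1# L.+ L.1# ≢ L.0#)
      (λ′ : Fin Q → Fin P) (λ≢0 : ∀ u → λ′ u ≢ L.0#) (λ^E≡1 : ∀ u → λ′ u L.^ E ≡ L.1#)
      (λ-* : ∀ {u v} → u ≢ K.0# → v ≢ K.0# → λ′ (u K.* v) ≡ λ′ u L.* λ′ v)
      {k : ℕ} (space : LinearSpace Q k)
      (prescribed : ∀ (κ : Fin k → Fin k → Fin P) → (∀ i j → κ i j L.^ E ≡ L.1#) →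
                    Σ[ b ∈ (Fin k → Fin P) ] (∀ i j → i Fin.< j → (b j L.- b i) L.^ f ≡ κ i j))
      (z : Fin k → Fin Q) (b : Fin k → Fin P) (mirror : Fin k → Fin k)
      (mirror-z : ∀ s → z (mirror s) ≡ z s) (mirror-b : ∀ s → b (mirror s) ≡ L.- b s)
      (distinct : ∀ {s s′} → z s ≡ z s′ → b s ≡ b s′ → s ≡ s′)
      (same-col : ∀ {s s′} → z s ≡ z s′ → b s′ ≡ b s ⊎ b s′ ≡ L.- b s)
      (cross : ∀ {s s′} → z s ≢ z s′ → b s ≢ b s′)
      (class-injective : ∀ {s s′ σ σ′} → z s ≢ z s′ → z σ ≢ z σ′ →
         (b s′ L.- b s) L.^ f L.* λ′ (z σ′ K.- z σ) ≡ (b σ′ L.- b σ) L.^ f L.* λ′ (z s′ K.- z s) →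
         (z σ ≡ z s × z σ′ ≡ z s′) × ((b σ ≡ b s × b σ′ ≡ b s′) ⊎ (b σ ≡ L.- b s × b σ′ ≡ L.- b s′)))
      (vertical-cover : ∀ {ξ} → ξ L.^ E ≡ L.1# → ∃[ s ] ∃[ u ] (b s ≢ L.0# × u ≢ K.0# × b s L.^ f L.* λ′ u ≡ ξ))
      (vertical-unique : ∀ {s s′ u u′} → b s ≢ L.0# → b s′ ≢ L.0# → u ≢ K.0# → u′ ≢ K.0# →
         b s L.^ f L.* λ′ u ≡ b s′ L.^ f L.* λ′ u′ → z s ≡ z s′ × u ≡ u′)
      where

      open VectorSpace FP n
      open GroupAction G n H FP f n!∣f
      open LinearSpace space

      two : Fin P
      two = L.1# L.+ L.1#

      -- No condition on v is needed, since `χ̂` is always χ of a nonzero scalar, even at the zero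
      -- vector.
      χ̂^E≡1 : ∀ v → χ̂ v L.^ E ≡ L.1#
      χ̂^E≡1 v = χ^E≡1 (proj₁ (proj₂ (proj₁ (proj₂ (representative v)))))

      χ≢0 : ∀ {x} → x ≢ L.0# → χ x ≢ L.0#
      χ≢0 = L.^-≢0 f

      ◃-diff : ∀ a x y d → (a ⊞ y ◃ d) ⊟ (a ⊞ x ◃ d) ≡ (y L.- x) ◃ d
      ◃-diff a x y d = ext λ i → trans (at-⊟ (a ⊞ y ◃ d) (a ⊞ x ◃ d) i) (trans (cong₂ L._-_ (at-⊞◃ a y d i) (at-⊞◃ a x d i))
        (trans (L.solve 4 (λ a x y d → (a L.:+ y L.:* d) L.:- (a L.:+ x L.:* d) L.:= (y L.:- x) L.:* d) refl (at a i) x y (at d i))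
          (sym (at-◃ (y L.- x) d i))))

      ⊟-⊞ : ∀ x v → (x ⊟ v) ⊞ v ≡ x
      ⊟-⊞ x v = ext λ i → trans (at-⊞ (x ⊟ v) v i) (trans (cong (L._+ at v i) (at-⊟ x v i))
        (L.solve 2 (λ x v → (x L.:- v) L.:+ v L.:= x) refl (at x i) (at v i)))

      ⊞-cancelʳ : ∀ {x y v} → x ⊞ v ≡ y ⊞ v → x ≡ y
      ⊞-cancelʳ {x} {y} {v} e = ext λ i → trans (L.solve 2 (λ x v → x L.:= (x L.:+ v) L.:- v) refl (at x i) (at v i))
        (trans (cong (L._- at v i) (trans (sym (at-⊞ x v i)) (trans (cong (λ w → at w i) e) (at-⊞ y v i))))
          (L.solve 2 (λ x v → (x L.:+ v) L.:- v L.:= x) refl (at y i) (at v i)))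

      reach : ∀ {x y d} s t → (t L.- s) ◃ d ≡ y ⊟ x → (x ⊟ s ◃ d) ⊞ t ◃ d ≡ y
      reach {x} {y} {d} s t e = ext λ i → begin
        at ((x ⊟ s ◃ d) ⊞ t ◃ d) i             ≡⟨ at-⊞◃ (x ⊟ s ◃ d) t d i ⟩
        at (x ⊟ s ◃ d) i L.+ t L.* at d i      ≡⟨ cong (L._+ t L.* at d i) (trans (at-⊟ x (s ◃ d) i) (cong (λ v → at x i L.- v) (at-◃ s d i))) ⟩
        (at x i L.- s L.* at d i) L.+ t L.* at d i
          ≡⟨ L.solve 4 (λ x s t d → (x L.:- s L.:* d) L.:+ t L.:* d L.:= x L.:+ (t L.:- s) L.:* d) refl (at x i) s t (at d i) ⟩
        at x i L.+ (t L.- s) L.* at d i        ≡⟨ cong (at x i L.+_) (trans (sym (at-◃ (t L.- s) d i)) (trans (cong (λ w → at w i) e) (at-⊟ y x i))) ⟩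
        at x i L.+ (at y i L.- at x i)         ≡⟨ L.solve 2 (λ x y → x L.:+ (y L.:- x) L.:= y) refl (at x i) (at y i) ⟩
        at y i ∎
        where open ≡-Reasoning

      neg◃neg : ∀ t d → (L.- t) ◃ (L.- L.1#) ◃ d ≡ t ◃ d
      neg◃neg t d = trans (◃-◃ (L.- t) (L.- L.1#) d) (cong (_◃ d) (L.solve 1 (λ t → (L.:- t) L.:* (L.:- L.:1) L.:= t) refl t))

      neg-◃ : ∀ t d → (L.- t) ◃ d ≡ t ◃ (L.- L.1#) ◃ d
      neg-◃ t d = trans (cong (_◃ d) (L.solve 1 (λ t → L.:- t L.:= t L.:* (L.:- L.:1)) refl t)) (sym (◃-◃ t (L.- L.1#) d))

      offsets : ∀ {a a′ d d′} x y x′ y′ → a ⊞ x ◃ d ≡ a′ ⊞ x′ ◃ d′ → a ⊞ y ◃ d ≡ a′ ⊞ y′ ◃ d′ → (y L.- x) ◃ d ≡ (y′ L.- x′) ◃ d′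
      offsets {a} {a′} {d} {d′} x y x′ y′ ex ey = trans (sym (◃-diff a x y d)) (trans (cong₂ _⊟_ ey ex) (◃-diff a′ x′ y′ d′))

      steps : ∀ {w w′ u u′} x y x′ y′ → w K.+ u K.* x ≡ w′ K.+ u′ K.* x′ → w K.+ u K.* y ≡ w′ K.+ u′ K.* y′ → u K.* (y K.- x) ≡ u′ K.* (y′ K.- x′)
      steps {w} {w′} {u} {u′} x y x′ y′ ex ey = trans (diff w u x y) (trans (cong₂ K._-_ ey ex) (sym (diff w′ u′ x′ y′)))
        where
        diff : ∀ w u x y → u K.* (y K.- x) ≡ (w K.+ u K.* y) K.- (w K.+ u K.* x)
        diff = K.solve 4 (λ w u x y → u K.:* (y K.:- x) K.:= (w K.:+ u K.:* y) K.:- (w K.:+ u K.:* x)) refl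

      K-cancelʳ : ∀ {x y} v → x K.+ v ≡ y K.+ v → x ≡ y
      K-cancelʳ {x} {y} v e = trans (K.solve 2 (λ x v → x K.:= (x K.:+ v) K.:- v) refl x v) (trans (cong (K._- v) e)
        (K.solve 2 (λ y v → (y K.:+ v) K.:- v K.:= y) refl y v))

      classes : ∀ {s t d d′} → s ≢ L.0# → t ≢ L.0# → d ≢ 𝟎 → d′ ≢ 𝟎 → s ◃ d ≡ t ◃ d′ → χ s L.* χ̂ d ≡ χ t L.* χ̂ d′
      classes {s} {t} s≢0 t≢0 d≢𝟎 d′≢𝟎 e = trans (sym (χ̂-◃ d≢𝟎 s≢0)) (trans (cong χ̂ e) (χ̂-◃ d′≢𝟎 t≢0))

      -- The classes χ̂ (x′ - x) / λ (z′ - z) of the pairs (z , x), (z′ , x′) lying in starter blocks.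
      InΓ : Fin P → Set
      InΓ ξ = ∃[ s ] ∃[ t ] (z s ≢ z t × χ (b t L.- b s) ≡ ξ L.* λ′ (z t K.- z s))

      InΓ? : ∀ ξ → Dec (InΓ ξ)
      InΓ? ξ = any? λ s → any? λ t → ¬? (z s ≟F z t) ×-dec (χ (b t L.- b s) ≟F ξ L.* λ′ (z t K.- z s))

      twisted-root : ∀ β {ξ} → ξ L.^ E ≡ L.1# → ∀ i j → (λ′ (block β j K.- block β i) L.* ξ) L.^ E ≡ L.1#
      twisted-root β {ξ} ξ^E i j = trans (L.^-distrib-* (λ′ (block β j K.- block β i)) ξ E)
        (trans (cong₂ L._*_ (λ^E≡1 (block β j K.- block β i)) ξ^E) (L.*-identityʳ L.1#))

      -- With χ (bⱼ - bᵢ) = λ (Bⱼ - Bᵢ) ξ for i < j and `χ̂` d = 1, all pairs of a transverse block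
      -- taken in increasing order have class ξ. The choice depends on β and ξ only, which makes
      -- blocks with equal β and ξ comparable. For other ξ the value is a filler that `Valid`
      -- excludes.
      coefficients : ∀ β ξ → Dec (ξ L.^ E ≡ L.1#) → Fin k → Fin P
      coefficients β ξ (yes ξ^E) = proj₁ (prescribed (λ i j → λ′ (block β j K.- block β i) L.* ξ) (twisted-root β ξ^E))
      coefficients β ξ (no _) = λ _ → L.0#

      coef : Fin Q × Fin Q → Fin P → Fin k → Fin P
      coef β ξ = coefficients β ξ (ξ L.^ E ≟F L.1#)

      χ-coef : ∀ β {ξ} → ξ L.^ E ≡ L.1# → ∀ {i j} → i Fin.< j → χ (coef β ξ j L.- coef β ξ i) ≡ λ′ (block β j K.- block β i) L.* ξ
      χ-coef β {ξ} ξ^E {i} {j} i<j = spec (ξ L.^ E ≟F L.1#)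
        where
        spec : (d : Dec (ξ L.^ E ≡ L.1#)) → χ (coefficients β ξ d j L.- coefficients β ξ d i) ≡ λ′ (block β j K.- block β i) L.* ξ
        spec (yes ξ^E′) = proj₂ (prescribed (λ i j → λ′ (block β j K.- block β i) L.* ξ) (twisted-root β ξ^E′)) i j i<j
        spec (no ne) = ⊥-elim (ne ξ^E)

      χ≢0⇒≢0 : ∀ {x y} → χ x ≡ y → y ≢ L.0# → x ≢ L.0#
      χ≢0⇒≢0 e y≢0 x≡0 = y≢0 (trans (sym e) (trans (cong χ x≡0) (L.0^n≡0 f)))

      coef-≢ : ∀ β {ξ} → ξ L.^ E ≡ L.1# → ∀ {i j} → i Fin.< j → coef β ξ j L.- coef β ξ i ≢ L.0#
      coef-≢ β {ξ} ξ^E {i} {j} i<j = χ≢0⇒≢0 (χ-coef β ξ^E i<j) (L.*-≢0 (λ≢0 (block β j K.- block β i)) (L.x^n≡1⇒x≢0 E ξ^E))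

      Pt : Set
      Pt = Fin Q × V

      -- Parameters carry no conditions, so that all of them can be listed; the valid ones are
      -- filtered out afterwards.
      data Param : Set where
        starter    : Fin Q → Fin Q → V → V → Param
        transverse : Fin Q × Fin Q → Fin P → V → V → Param
        level      : Fin Q × Fin Q → V → Param

      Valid : Param → Set
      Valid (starter w u a d) = u ≢ K.0# × d ≢ 𝟎 × χ̂ d ≡ λ′ u
      Valid (transverse β ξ a d) = Index β × ξ L.^ E ≡ L.1# × ¬ InΓ ξ × d ≢ 𝟎 × χ̂ d ≡ L.1#
      Valid (level β a) = Index β

      valid? : ∀ β → Dec (Valid β)
      valid? (starter w u a d) = ¬? (u ≟F K.0#) ×-dec (¬? (d ≟F 𝟎) ×-dec (χ̂ d ≟F λ′ u))
      valid? (transverse β ξ a d) = Index? β ×-dec ((ξ L.^ E ≟F L.1#) ×-dec (¬? (InΓ? ξ) ×-dec (¬? (d ≟F 𝟎) ×-dec (χ̂ d ≟F L.1#))))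
      valid? (level β a) = Index? β

      points : Param → Fin k → Pt
      points (starter w u a d) s = w K.+ u K.* z s , a ⊞ b s ◃ d
      points (transverse β ξ a d) i = block β i , a ⊞ coef β ξ i ◃ d
      points (level β a) i = block β i , a

      allPairs : ∀ m → List (Fin m × Fin m)
      allPairs m = cartesianProduct (allFin m) (allFin m)

      ∈-allPairs : ∀ {m} (p : Fin m × Fin m) → p ∈ allPairs m
      ∈-allPairs (i , j) = ∈-cartesianProduct⁺ (∈-allFin i) (∈-allFin j)

      starters transverses levels params : List Param
      starters = List.map (λ ((w , u) , (a , d)) → starter w u a d) (cartesianProduct (allPairs Q) (allPairs (P ℕ.^ n)))
      transverses = List.map (λ ((β , ξ) , (a , d)) → transverse β ξ a d) (cartesianProduct (cartesianProduct (allPairs Q) (allFin P)) (allPairs (P ℕ.^ n)))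
      levels = List.map (λ (β , a) → level β a) (cartesianProduct (allPairs Q) (allFin (P ℕ.^ n)))
      params = starters ++ (transverses ++ levels)

      ∈-params : ∀ β → β ∈ params
      ∈-params (starter w u a d) = ∈-++⁺ˡ {xs = starters} (∈-map⁺ (λ ((w , u) , (a , d)) → starter w u a d)
        (∈-cartesianProduct⁺ (∈-allPairs (w , u)) (∈-allPairs (a , d))))
      ∈-params (transverse β ξ a d) = ∈-++⁺ʳ starters (∈-++⁺ˡ {xs = transverses} (∈-map⁺ (λ ((β , ξ) , (a , d)) → transverse β ξ a d)
        (∈-cartesianProduct⁺ (∈-cartesianProduct⁺ (∈-allPairs β) (∈-allFin ξ)) (∈-allPairs (a , d)))))
      ∈-params (level β a) = ∈-++⁺ʳ starters (∈-++⁺ʳ transverses (∈-map⁺ (λ (β , a) → level β a)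
        (∈-cartesianProduct⁺ (∈-allPairs β) (∈-allFin a))))

      enc : Pt → Fin (Q ℕ.* (P ℕ.^ n))
      enc (w , a) = combine w a
      dec : Fin (Q ℕ.* (P ℕ.^ n)) → Pt
      dec = remQuot (P ℕ.^ n)

      open Family enc dec (λ (w , a) → remQuot-combine w a) (combine-remQuot {Q} (P ℕ.^ n)) Valid valid? params ∈-params points

      injective : ∀ {β s t} → Valid β → points β s ≡ points β t → s ≡ t
      injective {starter w u a d} {s} {t} (u≢0 , d≢𝟎 , _) e = distinct zz (sym (L.x-y≡0⇒x≡y (◃-cancelʳ d≢𝟎 bb)))
        where
        zz : z s ≡ z t
        zz = K.*-cancelˡ u≢0 (K-cancelʳ w (trans (K.+-comm (u K.* z s) w) (trans (cong proj₁ e) (K.+-comm w (u K.* z t)))))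
        bb : (b t L.- b s) ◃ d ≡ L.0# ◃ d
        bb = trans (sym (◃-diff a (b s) (b t) d)) (trans (cong (_⊟ (a ⊞ b s ◃ d)) (sym (cong proj₂ e)))
               (trans (◃-diff a (b s) (b s) d) (cong (_◃ d) (L.-‿inverseʳ (b s)))))
      injective {transverse β ξ a d} (ix , _) e = block-injective ix (cong proj₁ e)
      injective {level β a} ix e = block-injective ix (cong proj₁ e)

      Through : Pt → Pt → Set
      Through x y = ∃[ β ] (Valid β × ∃[ s ] ∃[ t ] (points β s ≡ x × points β t ≡ y))

      Through-sym : ∀ {x y} → Through x y → Through y x
      Through-sym (β , v , s , t , es , et) = β , v , t , s , et , es

      starter-through : ∀ {z₁ z₂ x₁ x₂} s t u d → u ≢ K.0# → d ≢ 𝟎 → χ̂ d ≡ λ′ u → u K.* (z t K.- z s) ≡ z₂ K.- z₁ → (b t L.- b s) ◃ d ≡ x₂ ⊟ x₁ →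
                        Through (z₁ , x₁) (z₂ , x₂)
      starter-through {z₁} {z₂} {x₁} {x₂} s t u d u≢0 d≢𝟎 χd ez ex =
        starter (z₁ K.- u K.* z s) u (x₁ ⊟ b s ◃ d) d , (u≢0 , d≢𝟎 , χd) , s , t ,
        cong₂ _,_ (K.solve 2 (λ z v → (z K.:- v) K.:+ v K.:= z) refl z₁ (u K.* z s)) (⊟-⊞ x₁ (b s ◃ d)) ,
        cong₂ _,_ (trans (K.solve 4 (λ z u s t → (z K.:- u K.:* s) K.:+ u K.:* t K.:= z K.:+ u K.:* (t K.:- s)) refl z₁ u (z s) (z t))
                    (trans (cong (z₁ K.+_) ez) (K.solve 2 (λ x y → x K.:+ (y K.:- x) K.:= y) refl z₁ z₂)))
                  (reach (b s) (b t) ex)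

      -- The positions `mirror s` and s share a column and differ by 2 b s, so d must be (x₂ - x₁) /
      -- (2 b s). The requirement `χ̂` d = λ u then becomes χ(b s) λ(u) = `χ̂` (x₂ - x₁) / χ(2),
      -- which `vertical-cover` solves.
      vertical : ∀ {z₁ x₁ x₂} → x₁ ≢ x₂ → Through (z₁ , x₁) (z₁ , x₂)
      vertical {z₁} {x₁} {x₂} x₁≢x₂ = go (vertical-cover ξ^E)
        where
        δ : V
        δ = x₂ ⊟ x₁
        δ≢𝟎 : δ ≢ 𝟎
        δ≢𝟎 e = x₁≢x₂ (sym (⊟≡𝟎⇒≡ e))
        ξ : Fin P
        ξ = χ̂ δ L./ χ two
        χ2≢0 : χ two ≢ L.0#
        χ2≢0 = χ≢0 2≢0
        ξ^E : ξ L.^ E ≡ L.1#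
        ξ^E = trans (L.^-/ (χ̂ δ) E χ2≢0) (trans (cong₂ L._/_ (χ̂^E≡1 δ) (χ^E≡1 2≢0)) (L.⁻¹-inverseʳ L.1# L.1≢0))
        go : ∃[ s ] ∃[ u ] (b s ≢ L.0# × u ≢ K.0# × χ (b s) L.* λ′ u ≡ ξ) → Through (z₁ , x₁) (z₁ , x₂)
        go (s , u , b≢0 , u≢0 , e) = starter-through (mirror s) s u d u≢0 d≢𝟎 χd
          (trans (cong (λ t → u K.* (z s K.- t)) (mirror-z s)) (trans (cong (u K.*_) (K.-‿inverseʳ (z s))) (trans (K.zeroʳ u) (sym (K.-‿inverseʳ z₁)))))
          (trans (cong (_◃ d) (trans (cong (λ v → b s L.- v) (mirror-b s)) (L.solve 1 (λ t → t L.:- (L.:- t) L.:= (L.:1 L.:+ L.:1) L.:* t) refl (b s)))) 2b◃d)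
          where
          2b≢0 : two L.* b s ≢ L.0#
          2b≢0 = L.*-≢0 2≢0 b≢0
          d : V
          d = ((two L.* b s) L.⁻¹) ◃ δ
          d≢𝟎 : d ≢ 𝟎
          d≢𝟎 = ◃-≢𝟎 (L.⁻¹-≢0 2b≢0) δ≢𝟎
          2b◃d : (two L.* b s) ◃ d ≡ δ
          2b◃d = trans (◃-◃ (two L.* b s) ((two L.* b s) L.⁻¹) δ) (trans (cong (_◃ δ) (L.⁻¹-inverseʳ (two L.* b s) 2b≢0)) (1◃ δ))
          χd : χ̂ d ≡ λ′ u
          χd = L.*-cancelˡ {x = χ (two L.* b s)} (χ≢0 2b≢0) (begin
            χ (two L.* b s) L.* χ̂ d          ≡⟨ sym (χ̂-◃ d≢𝟎 2b≢0) ⟩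
            χ̂ ((two L.* b s) ◃ d)            ≡⟨ cong χ̂ 2b◃d ⟩
            χ̂ δ                              ≡⟨ sym (L.[x/y]*y≡x (χ̂ δ) χ2≢0) ⟩
            ξ L.* χ two                      ≡⟨ cong (L._* χ two) (sym e) ⟩
            χ (b s) L.* λ′ u L.* χ two       ≡⟨ L.solve 3 (λ a l t → a L.:* l L.:* t L.:= t L.:* a L.:* l) refl (χ (b s)) (λ′ u) (χ two) ⟩
            χ two L.* χ (b s) L.* λ′ u       ≡⟨ cong (L._* λ′ u) (sym (L.^-distrib-* two (b s) f)) ⟩
            χ (two L.* b s) L.* λ′ u ∎)
            where open ≡-Reasoning

      -- The class ξ of the pair alone decides: if it lies in Γ a starter block works, otherwise a
      -- transverse block. The pair is oriented by its positions in the block β, because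
      -- coefficients are prescribed only for i < j.
      mixed : ∀ {z₁ z₂ x₁ x₂} → z₁ ≢ z₂ → x₁ ≢ x₂ → ∀ {β i j} → Index β → i Fin.< j → block β i ≡ z₁ → block β j ≡ z₂ → Through (z₁ , x₁) (z₂ , x₂)
      mixed {z₁} {z₂} {x₁} {x₂} z₁≢z₂ x₁≢x₂ {β} {i} {j} ix i<j ei ej = decide (InΓ? ξ)
        where
        δ : V
        δ = x₂ ⊟ x₁
        δ≢𝟎 : δ ≢ 𝟎
        δ≢𝟎 e = x₁≢x₂ (sym (⊟≡𝟎⇒≡ e))
        Δ : Fin Q
        Δ = z₂ K.- z₁
        Δ≢0 : Δ ≢ K.0#
        Δ≢0 = K.x≢y⇒x-y≢0 (z₁≢z₂ ∘ sym)
        ξ : Fin P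
        ξ = χ̂ δ L./ λ′ Δ
        ξλ : ξ L.* λ′ Δ ≡ χ̂ δ
        ξλ = L.[x/y]*y≡x (χ̂ δ) (λ≢0 Δ)
        ξ^E : ξ L.^ E ≡ L.1#
        ξ^E = trans (L.^-/ (χ̂ δ) E (λ≢0 Δ)) (trans (cong₂ L._/_ (χ̂^E≡1 δ) (λ^E≡1 Δ)) (L.⁻¹-inverseʳ L.1# L.1≢0))
        ξ≢0 : ξ ≢ L.0#
        ξ≢0 = L.x^n≡1⇒x≢0 E ξ^E
        module Scaled (t : Fin P) (t≢0 : t ≢ L.0#) where
          d : V
          d = (t L.⁻¹) ◃ δ
          d≢𝟎 : d ≢ 𝟎
          d≢𝟎 = ◃-≢𝟎 (L.⁻¹-≢0 t≢0) δ≢𝟎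
          t◃d : t ◃ d ≡ δ
          t◃d = trans (◃-◃ t (t L.⁻¹) δ) (trans (cong (_◃ δ) (L.⁻¹-inverseʳ t t≢0)) (1◃ δ))
          χχ̂ : χ t L.* χ̂ d ≡ χ̂ δ
          χχ̂ = trans (sym (χ̂-◃ d≢𝟎 t≢0)) (cong χ̂ t◃d)
        decide : Dec (InΓ ξ) → Through (z₁ , x₁) (z₂ , x₂)
        decide (yes (s , t , ne , e)) = starter-through s t u d u≢0 d≢𝟎 χd (K.[x/y]*y≡x Δ zz≢0) t◃d
          where
          zz≢0 : z t K.- z s ≢ K.0#
          zz≢0 = K.x≢y⇒x-y≢0 (ne ∘ sym)
          u : Fin Q
          u = Δ K./ (z t K.- z s)
          u≢0 : u ≢ K.0#
          u≢0 = K./-≢0 Δ≢0 zz≢0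
          open Scaled (b t L.- b s) (L.x≢y⇒x-y≢0 (cross ne ∘ sym))
          χd : χ̂ d ≡ λ′ u
          χd = L.*-cancelˡ {x = ξ L.* λ′ (z t K.- z s)} (L.*-≢0 ξ≢0 (λ≢0 (z t K.- z s))) (begin
            ξ L.* λ′ (z t K.- z s) L.* χ̂ d           ≡⟨ cong (L._* χ̂ d) (sym e) ⟩
            χ (b t L.- b s) L.* χ̂ d                  ≡⟨ χχ̂ ⟩
            χ̂ δ                                      ≡⟨ sym ξλ ⟩
            ξ L.* λ′ Δ                               ≡⟨ cong (λ v → ξ L.* λ′ v) (sym (K.[x/y]*y≡x Δ zz≢0)) ⟩
            ξ L.* λ′ (u K.* (z t K.- z s))           ≡⟨ cong (ξ L.*_) (trans (λ-* u≢0 zz≢0) (L.*-comm (λ′ u) (λ′ (z t K.- z s)))) ⟩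
            ξ L.* (λ′ (z t K.- z s) L.* λ′ u)        ≡⟨ sym (L.*-assoc ξ (λ′ (z t K.- z s)) (λ′ u)) ⟩
            ξ L.* λ′ (z t K.- z s) L.* λ′ u ∎)
            where open ≡-Reasoning
        decide (no ∉Γ) = transverse β ξ (x₁ ⊟ coef β ξ i ◃ d) d , (ix , ξ^E , ∉Γ , d≢𝟎 , χd) , i , j ,
          cong₂ _,_ ei (⊟-⊞ x₁ (coef β ξ i ◃ d)) , cong₂ _,_ ej (reach (coef β ξ i) (coef β ξ j) t◃d)
          where
          cc≢0 : coef β ξ j L.- coef β ξ i ≢ L.0#
          cc≢0 = coef-≢ β ξ^E i<j
          open Scaled (coef β ξ j L.- coef β ξ i) cc≢0
          χcc : χ (coef β ξ j L.- coef β ξ i) ≡ χ̂ δ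
          χcc = trans (χ-coef β ξ^E i<j) (trans (cong₂ (λ s t → λ′ (s K.- t) L.* ξ) ej ei) (trans (L.*-comm (λ′ Δ) ξ) ξλ))
          χd : χ̂ d ≡ L.1#
          χd = L.*-cancelˡ {x = χ (coef β ξ j L.- coef β ξ i)} (χ≢0 cc≢0) (trans χχ̂ (trans (sym χcc) (sym (L.*-identityʳ _))))

      cover-all : ∀ {x y} → x ≢ y → Through x y
      cover-all {z₁ , x₁} {z₂ , x₂} x≢y = decide (z₁ ≟F z₂) (x₁ ≟F x₂)
        where
        slanted : z₁ ≢ z₂ → x₁ ≢ x₂ → ∃[ β ] (Index β × ∃[ i ] ∃[ j ] (block β i ≡ z₁ × block β j ≡ z₂)) → Through (z₁ , x₁) (z₂ , x₂)
        slanted z≢ x≢ (β , ix , i , j , ei , ej) = order (<-cmp i j)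
          where
          order : Tri (i Fin.< j) (i ≡ j) (j Fin.< i) → Through (z₁ , x₁) (z₂ , x₂)
          order (tri< i<j _ _) = mixed z≢ x≢ {β} ix i<j ei ej
          order (tri≈ _ i≡j _) = ⊥-elim (z≢ (trans (sym ei) (trans (cong (block β) i≡j) ej)))
          order (tri> _ _ j<i) = Through-sym {z₂ , x₂} {z₁ , x₁} (mixed (z≢ ∘ sym) (x≢ ∘ sym) {β} ix j<i ej ei)
        flat : x₁ ≡ x₂ → ∃[ β ] (Index β × ∃[ i ] ∃[ j ] (block β i ≡ z₁ × block β j ≡ z₂)) → Through (z₁ , x₁) (z₂ , x₂)
        flat x≡ (β , ix , i , j , ei , ej) = level β x₁ , ix , i , j , cong (_, x₁) ei , cong₂ _,_ ej x≡
        decide : Dec (z₁ ≡ z₂) → Dec (x₁ ≡ x₂) → Through (z₁ , x₁) (z₂ , x₂)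
        decide (yes z≡) (yes x≡) = ⊥-elim (x≢y (cong₂ _,_ z≡ x≡))
        decide (yes refl) (no x≢) = vertical x≢
        decide (no z≢) (yes x≡) = flat x≡ (cover z≢)
        decide (no z≢) (no x≢) = slanted z≢ x≢ (cover z≢)

      SameRange-refl : ∀ {β β′} → β ≡ β′ → SameRange β β′
      SameRange-refl refl = (λ s → s , refl) , λ s → s , refl

      SameRange-sym : ∀ {β β′} → SameRange β β′ → SameRange β′ β
      SameRange-sym (to , from) = (λ s → proj₁ (from s) , sym (proj₂ (from s))) , λ s → proj₁ (to s) , sym (proj₂ (to s))

      -- Since b (mirror s) = -b s, negating d only permutes the points by `mirror`.
      starter-neg : ∀ w u a d → SameRange (starter w u a d) (starter w u a ((L.- L.1#) ◃ d))
      starter-neg w u a d = (λ s → mirror s , reflected s) , λ s → mirror s , trans (reflected (mirror s)) (twice s)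
        where
        reflected : ∀ s → points (starter w u a d) s ≡ points (starter w u a ((L.- L.1#) ◃ d)) (mirror s)
        reflected s = cong₂ _,_ (cong (λ t → w K.+ u K.* t) (sym (mirror-z s)))
          (cong (a ⊞_) (trans (sym (neg◃neg (b s) d)) (cong (_◃ (L.- L.1#) ◃ d) (sym (mirror-b s)))))
        twice : ∀ s → points (starter w u a ((L.- L.1#) ◃ d)) (mirror (mirror s)) ≡ points (starter w u a ((L.- L.1#) ◃ d)) s
        twice s = cong₂ _,_ (cong (λ t → w K.+ u K.* t) (trans (mirror-z (mirror s)) (mirror-z s)))
          (cong (λ t → a ⊞ t ◃ (L.- L.1#) ◃ d) (trans (mirror-b (mirror s)) (trans (cong L.-_ (mirror-b s)) (L.-‿involutive (b s)))))

      starter-same : ∀ {w w′ u u′ a a′ d d′} s t → u ≡ u′ → z s ≡ z t → (b t ≡ b s × d′ ≡ d) ⊎ (b t ≡ L.- b s × d′ ≡ (L.- L.1#) ◃ d) →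
                     points (starter w u a d) s ≡ points (starter w′ u′ a′ d′) t → SameRange (starter w u a d) (starter w′ u′ a′ d′)
      starter-same {w} {w′} {u} {_} {a} {a′} {d} s t refl zz (inj₁ (bb , refl)) e = SameRange-refl (cong₂ (λ w a → starter w u a d)
        (K-cancelʳ (u K.* z s) (trans (cong proj₁ e) (cong (λ x → w′ K.+ u K.* x) (sym zz))))
        (⊞-cancelʳ {v = b s ◃ d} (trans (cong proj₂ e) (cong (λ x → a′ ⊞ x ◃ d) bb))))
      starter-same {w} {w′} {u} {_} {a} {a′} {d} s t refl zz (inj₂ (bb , refl)) e =
        subst₂ (λ v x → SameRange (starter w u a d) (starter v u x ((L.- L.1#) ◃ d))) w≡ a≡ (starter-neg w u a d)
        where
        w≡ : w ≡ w′
        w≡ = K-cancelʳ (u K.* z s) (trans (cong proj₁ e) (cong (λ x → w′ K.+ u K.* x) (sym zz)))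
        a≡ : a ≡ a′
        a≡ = ⊞-cancelʳ {v = b s ◃ d} (trans (cong proj₂ e) (cong (a′ ⊞_) (trans (cong (_◃ (L.- L.1#) ◃ d) bb) (neg◃neg (b s) d))))

      Unique : Param → Param → Set
      Unique β β′ = ∀ {s t s′ t′} → Valid β → Valid β′ → s ≢ t → points β s ≡ points β′ s′ → points β t ≡ points β′ t′ → SameRange β β′

      -- Inside a column the differences are -2 b s d and -2 b s′ d′, and `vertical-unique` yields
      -- the same column and u = u′. Between columns the two pairs of positions have the same class,
      -- and `class-injective` identifies them up to sign. In both cases d′ is d or -d, with
      -- matching signs of the positions.
      starter-starter : ∀ {w u a d w′ u′ a′ d′} → Unique (starter w u a d) (starter w′ u′ a′ d′)
      starter-starter {w} {u} {a} {d} {w′} {u′} {a′} {d′} {s} {t} {s′} {t′} (u≢0 , d≢𝟎 , χd) val′@(u′≢0 , d′≢𝟎 , χd′) s≢t es et = decide (z s ≟F z t)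
        where
        s′≢t′ : s′ ≢ t′
        s′≢t′ refl = s≢t (injective {starter w u a d} (u≢0 , d≢𝟎 , χd) (trans es (sym et)))
        stepZ : u K.* (z t K.- z s) ≡ u′ K.* (z t′ K.- z s′)
        stepZ = steps (z s) (z t) (z s′) (z t′) (cong proj₁ es) (cong proj₁ et)
        stepB : (b t L.- b s) ◃ d ≡ (b t′ L.- b s′) ◃ d′
        stepB = offsets (b s) (b t) (b s′) (b t′) (cong proj₂ es) (cong proj₂ et)
        opposite : ∀ {s t} → s ≢ t → z s ≡ z t → b t ≡ L.- b s
        opposite {s} {t} s≢t zz = pick (same-col zz)
          where
          pick : b t ≡ b s ⊎ b t ≡ L.- b s → b t ≡ L.- b s
          pick (inj₁ bb) = ⊥-elim (s≢t (distinct zz (sym bb)))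
          pick (inj₂ bb) = bb
        b≢0 : ∀ {s t} → s ≢ t → z s ≡ z t → b s ≢ L.0#
        b≢0 s≢t zz b0 = s≢t (distinct zz (trans b0 (sym (trans (opposite s≢t zz) (trans (cong L.-_ b0) L.-0#≈0#)))))
        doubled : ∀ {s t} → s ≢ t → z s ≡ z t → b t L.- b s ≡ (L.- two) L.* b s
        doubled {s} {t} s≢t zz = trans (cong (L._- b s) (opposite s≢t zz)) (L.solve 1 (λ x → (L.:- x) L.:- x L.:= (L.:- (L.:1 L.:+ L.:1)) L.:* x) refl (b s))
        decide : Dec (z s ≡ z t) → SameRange (starter w u a d) (starter w′ u′ a′ d′)
        decide (yes zz) = conclude (vertical-unique b≢ b′≢ u≢0 u′≢0 cls)
          where
          zz′ : z s′ ≡ z t′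
          zz′ = sym (K.x-y≡0⇒x≡y (K.*-cancelˡ u′≢0 (trans (sym stepZ) (trans (cong (u K.*_) (trans (cong (K._- z s) (sym zz)) (K.-‿inverseʳ (z s))))
                  (trans (K.zeroʳ u) (sym (K.zeroʳ u′)))))))
          b≢ : b s ≢ L.0#
          b≢ = b≢0 s≢t zz
          b′≢ : b s′ ≢ L.0#
          b′≢ = b≢0 s′≢t′ zz′
          -2≢0 : L.- two ≢ L.0#
          -2≢0 = L.-‿≢0 2≢0
          bd : b s ◃ d ≡ b s′ ◃ d′
          bd = ◃-cancelˡ -2≢0 (trans (◃-◃ (L.- two) (b s) d) (trans (cong (_◃ d) (sym (doubled s≢t zz))) (trans stepB
                 (trans (cong (_◃ d′) (doubled s′≢t′ zz′)) (sym (◃-◃ (L.- two) (b s′) d′))))))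
          cls : χ (b s) L.* λ′ u ≡ χ (b s′) L.* λ′ u′
          cls = trans (cong (χ (b s) L.*_) (sym χd)) (trans (classes b≢ b′≢ d≢𝟎 d′≢𝟎 bd) (cong (χ (b s′) L.*_) χd′))
          conclude : z s ≡ z s′ × u ≡ u′ → SameRange (starter w u a d) (starter w′ u′ a′ d′)
          conclude (zs , uu) = starter-same {w} {w′} {u} {u′} {a} {a′} {d} {d′} s s′ uu zs (pick (same-col zs)) es
            where
            pick : b s′ ≡ b s ⊎ b s′ ≡ L.- b s → (b s′ ≡ b s × d′ ≡ d) ⊎ (b s′ ≡ L.- b s × d′ ≡ (L.- L.1#) ◃ d)
            pick (inj₁ bb) = inj₁ (bb , ◃-cancelˡ b≢ (trans (cong (_◃ d′) (sym bb)) (sym bd)))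
            pick (inj₂ bb) = inj₂ (bb , ◃-cancelˡ b′≢ (trans (sym bd) (trans (sym (neg◃neg (b s) d)) (cong (_◃ (L.- L.1#) ◃ d) (sym bb)))))
        decide (no zz) = conclude (class-injective zz zz′ cls)
          where
          zt-zs : z t K.- z s ≢ K.0#
          zt-zs = K.x≢y⇒x-y≢0 (zz ∘ sym)
          zz′ : z s′ ≢ z t′
          zz′ e = K.*-≢0 u≢0 zt-zs (trans stepZ (trans (cong (u′ K.*_) (trans (cong (λ v → z t′ K.- v) e) (K.-‿inverseʳ (z t′)))) (K.zeroʳ u′)))
          zt-zs′ : z t′ K.- z s′ ≢ K.0#
          zt-zs′ = K.x≢y⇒x-y≢0 (zz′ ∘ sym)
          bb≢ : b t L.- b s ≢ L.0#
          bb≢ = L.x≢y⇒x-y≢0 (cross zz ∘ sym)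
          bb≢′ : b t′ L.- b s′ ≢ L.0#
          bb≢′ = L.x≢y⇒x-y≢0 (cross zz′ ∘ sym)
          X = χ (b t L.- b s)
          X′ = χ (b t′ L.- b s′)
          Λ = λ′ (z t K.- z s)
          Λ′ = λ′ (z t′ K.- z s′)
          λλ : λ′ u L.* Λ ≡ λ′ u′ L.* Λ′
          λλ = trans (sym (λ-* u≢0 zt-zs)) (trans (cong λ′ stepZ) (λ-* u′≢0 zt-zs′))
          χχ : X L.* λ′ u ≡ X′ L.* λ′ u′
          χχ = trans (cong (X L.*_) (sym χd)) (trans (classes bb≢ bb≢′ d≢𝟎 d′≢𝟎 stepB) (cong (X′ L.*_) χd′))
          -- Eliminating λ(u) and λ(u′) between `λλ` and `χχ` leaves a relation between positions
          -- only.
          cls : X L.* Λ′ ≡ X′ L.* Λ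
          cls = L.*-cancelˡ {x = λ′ u′} (λ≢0 u′) (begin
            λ′ u′ L.* (X L.* Λ′)    ≡⟨ L.solve 3 (λ l x m → l L.:* (x L.:* m) L.:= x L.:* (l L.:* m)) refl (λ′ u′) X Λ′ ⟩
            X L.* (λ′ u′ L.* Λ′)    ≡⟨ cong (X L.*_) (sym λλ) ⟩
            X L.* (λ′ u L.* Λ)      ≡⟨ sym (L.*-assoc X (λ′ u) Λ) ⟩
            X L.* λ′ u L.* Λ        ≡⟨ cong (L._* Λ) χχ ⟩
            X′ L.* λ′ u′ L.* Λ      ≡⟨ L.solve 3 (λ x l m → x L.:* l L.:* m L.:= l L.:* (x L.:* m)) refl X′ (λ′ u′) Λ ⟩
            λ′ u′ L.* (X′ L.* Λ) ∎)
            where open ≡-Reasoning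
          conclude : (z s′ ≡ z s × z t′ ≡ z t) × ((b s′ ≡ b s × b t′ ≡ b t) ⊎ (b s′ ≡ L.- b s × b t′ ≡ L.- b t)) →
                     SameRange (starter w u a d) (starter w′ u′ a′ d′)
          conclude ((zs , zt) , bs) = starter-same {w} {w′} {u} {u′} {a} {a′} {d} {d′} s s′ uu (sym zs) (pick bs) es
            where
            uu : u ≡ u′
            uu = K.*-cancelʳ zt-zs (trans stepZ (cong₂ (λ x y → u′ K.* (x K.- y)) zt zs))
            pick : (b s′ ≡ b s × b t′ ≡ b t) ⊎ (b s′ ≡ L.- b s × b t′ ≡ L.- b t) → (b s′ ≡ b s × d′ ≡ d) ⊎ (b s′ ≡ L.- b s × d′ ≡ (L.- L.1#) ◃ d)
            pick (inj₁ (bs , bt)) = inj₁ (bs , sym (◃-cancelˡ bb≢ (trans stepB (cong₂ (λ x y → (x L.- y) ◃ d′) bt bs))))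
            pick (inj₂ (bs , bt)) = inj₂ (bs , ◃-cancelˡ bb≢′ (trans (sym stepB) (trans (cong (_◃ d) flip) (neg-◃ (b t′ L.- b s′) d))))
              where
              flip : b t L.- b s ≡ L.- (b t′ L.- b s′)
              flip = trans (L.solve 2 (λ x y → x L.:- y L.:= L.:- ((L.:- x) L.:- (L.:- y))) refl (b t) (b s))
                (cong₂ (λ x y → L.- (x L.- y)) (sym bt) (sym bs))

      -- A common pair has class ξ as a pair of the transverse block. Lying in a starter block, it
      -- would put ξ into Γ.
      starter-transverse-< : ∀ {w u a d β ξ a′ d′} s t i j → Valid (starter w u a d) → Valid (transverse β ξ a′ d′) → i Fin.< j →
        points (starter w u a d) s ≡ points (transverse β ξ a′ d′) i → points (starter w u a d) t ≡ points (transverse β ξ a′ d′) j → ⊥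
      starter-transverse-< {w} {u} {a} {d} {β} {ξ} {a′} {d′} s t i j (u≢0 , d≢𝟎 , χd) (ix , ξ^E , ∉Γ , d′≢𝟎 , χd′) i<j es et = ∉Γ (s , t , zz , in-Γ)
        where
        zz : z s ≢ z t
        zz e = ℕₚ.<⇒≢ i<j (cong toℕ (block-injective ix (trans (sym (cong proj₁ es)) (trans (cong (λ x → w K.+ u K.* x) e) (cong proj₁ et)))))
        zt-zs : z t K.- z s ≢ K.0#
        zt-zs = K.x≢y⇒x-y≢0 (zz ∘ sym)
        stepZ : u K.* (z t K.- z s) ≡ block β j K.- block β i
        stepZ = trans (K.solve 4 (λ w u x y → u K.:* (y K.:- x) K.:= (w K.:+ u K.:* y) K.:- (w K.:+ u K.:* x)) refl w u (z s) (z t)) (cong₂ K._-_ (cong proj₁ et) (cong proj₁ es))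
        X = χ (b t L.- b s)
        Λ = λ′ (z t K.- z s)
        in-Γ : X ≡ ξ L.* Λ
        in-Γ = L.*-cancelʳ {x = λ′ u} (λ≢0 u) (begin
          X L.* λ′ u                                         ≡⟨ cong (X L.*_) (sym χd) ⟩
          X L.* χ̂ d                                          ≡⟨ classes (L.x≢y⇒x-y≢0 (cross zz ∘ sym)) (coef-≢ β ξ^E i<j) d≢𝟎 d′≢𝟎
                                                                  (offsets (b s) (b t) (coef β ξ i) (coef β ξ j) (cong proj₂ es) (cong proj₂ et)) ⟩
          χ (coef β ξ j L.- coef β ξ i) L.* χ̂ d′             ≡⟨ cong₂ L._*_ (χ-coef β ξ^E i<j) χd′ ⟩
          λ′ (block β j K.- block β i) L.* ξ L.* L.1#        ≡⟨ L.*-identityʳ _ ⟩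
          λ′ (block β j K.- block β i) L.* ξ                 ≡⟨ cong (λ v → λ′ v L.* ξ) (sym stepZ) ⟩
          λ′ (u K.* (z t K.- z s)) L.* ξ                     ≡⟨ cong (L._* ξ) (λ-* u≢0 zt-zs) ⟩
          λ′ u L.* Λ L.* ξ                                   ≡⟨ L.solve 3 (λ l m x → l L.:* m L.:* x L.:= x L.:* m L.:* l) refl (λ′ u) Λ ξ ⟩
          ξ L.* Λ L.* λ′ u ∎)
          where open ≡-Reasoning

      starter-transverse : ∀ {w u a d β ξ a′ d′} → Unique (starter w u a d) (transverse β ξ a′ d′)
      starter-transverse {w} {u} {a} {d} {β} {ξ} {a′} {d′} {s} {t} {i} {j} val val′ s≢t es et = ⊥-elim (decide (<-cmp i j))
        where
        decide : Tri (i Fin.< j) (i ≡ j) (j Fin.< i) → ⊥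
        decide (tri< i<j _ _) = starter-transverse-< {w} {u} {a} {d} {β} {ξ} {a′} {d′} s t i j val val′ i<j es et
        decide (tri≈ _ i≡j _) = s≢t (injective {starter w u a d} val (trans es (trans (cong (points (transverse β ξ a′ d′)) i≡j) (sym et))))
        decide (tri> _ _ j<i) = starter-transverse-< {w} {u} {a} {d} {β} {ξ} {a′} {d′} t s j i val val′ j<i et es

      -- The constant second coordinate of a level block forces b s = b t. This contradicts
      -- `distinct` inside a column and `cross` between columns.
      starter-level : ∀ {w u a d β a′} → Unique (starter w u a d) (level β a′)
      starter-level {w} {u} {a} {d} {β} {a′} {s} {t} {i} {j} val@(u≢0 , d≢𝟎 , χd) ix s≢t es et = ⊥-elim (decide (z s ≟F z t))
        where
        bb : b s ≡ b t
        bb = sym (L.x-y≡0⇒x≡y (◃-cancelʳ d≢𝟎 (trans (sym (◃-diff a (b s) (b t) d)) (trans (cong (_⊟ (a ⊞ b s ◃ d)) (trans (cong proj₂ et) (sym (cong proj₂ es))))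
          (trans (◃-diff a (b s) (b s) d) (cong (_◃ d) (L.-‿inverseʳ (b s))))))))
        decide : Dec (z s ≡ z t) → ⊥
        decide (yes zz) = s≢t (distinct zz bb)
        decide (no zz) = cross zz bb

      transverse-transverse-< : ∀ {β ξ a d ξ′ a′ d′} i j → Valid (transverse β ξ a d) → Valid (transverse β ξ′ a′ d′) → i Fin.< j →
        points (transverse β ξ a d) i ≡ points (transverse β ξ′ a′ d′) i → points (transverse β ξ a d) j ≡ points (transverse β ξ′ a′ d′) j →
        transverse β ξ a d ≡ transverse β ξ′ a′ d′
      transverse-transverse-< {β} {ξ} {a} {d} {ξ′} {a′} {d′} i j (ix , ξ^E , ∉Γ , d≢𝟎 , χd) (_ , ξ′^E , ∉Γ′ , d′≢𝟎 , χd′) i<j ei ej = same ξ≡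
        where
        offset : (coef β ξ j L.- coef β ξ i) ◃ d ≡ (coef β ξ′ j L.- coef β ξ′ i) ◃ d′
        offset = offsets (coef β ξ i) (coef β ξ j) (coef β ξ′ i) (coef β ξ′ j) (cong proj₂ ei) (cong proj₂ ej)
        side : ∀ {ξ d} → ξ L.^ E ≡ L.1# → χ̂ d ≡ L.1# → χ (coef β ξ j L.- coef β ξ i) L.* χ̂ d ≡ λ′ (block β j K.- block β i) L.* ξ
        side ξ^E χd = trans (cong₂ L._*_ (χ-coef β ξ^E i<j) χd) (L.*-identityʳ _)
        ξ≡ : ξ ≡ ξ′
        ξ≡ = L.*-cancelˡ {x = λ′ (block β j K.- block β i)} (λ≢0 (block β j K.- block β i)) (trans (sym (side {ξ} {d} ξ^E χd))
          (trans (classes (coef-≢ β ξ^E i<j) (coef-≢ β ξ′^E i<j) d≢𝟎 d′≢𝟎 offset) (side {ξ′} {d′} ξ′^E χd′)))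
        same : ξ ≡ ξ′ → transverse β ξ a d ≡ transverse β ξ′ a′ d′
        same refl = cong₂ (transverse β ξ) (⊞-cancelʳ {v = coef β ξ i ◃ d} (trans (cong proj₂ ei) (cong (λ v → a′ ⊞ coef β ξ i ◃ v) (sym d≡)))) d≡
          where
          d≡ : d ≡ d′
          d≡ = ◃-cancelˡ (coef-≢ β ξ^E i<j) offset

      -- The first coordinates determine β and both positions, by uniqueness in the linear space.
      -- The class then determines ξ and with it the coefficients, so d and a follow.
      transverse-transverse : ∀ {β ξ a d β′ ξ′ a′ d′} → Unique (transverse β ξ a d) (transverse β′ ξ′ a′ d′)
      transverse-transverse {β} {ξ} {a} {d} {β′} {ξ′} {a′} {d′} {i} {j} {i′} {j′} val val′ i≢j ei ej =
        go (unique (proj₁ val) (proj₁ val′) i≢j (cong proj₁ ei) (cong proj₁ ej)) val′ ei ej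
        where
        go : ∀ {β′ i′ j′} → β ≡ β′ × i ≡ i′ × j ≡ j′ → Valid (transverse β′ ξ′ a′ d′) → points (transverse β ξ a d) i ≡ points (transverse β′ ξ′ a′ d′) i′ →
             points (transverse β ξ a d) j ≡ points (transverse β′ ξ′ a′ d′) j′ → SameRange (transverse β ξ a d) (transverse β′ ξ′ a′ d′)
        go (refl , refl , refl) val′ ei ej = SameRange-refl (order (<-cmp i j))
          where
          order : Tri (i Fin.< j) (i ≡ j) (j Fin.< i) → transverse β ξ a d ≡ transverse β ξ′ a′ d′
          order (tri< i<j _ _) = transverse-transverse-< {β} {ξ} {a} {d} {ξ′} {a′} {d′} i j val val′ i<j ei ej
          order (tri≈ _ i≡j _) = ⊥-elim (i≢j i≡j)
          order (tri> _ _ j<i) = transverse-transverse-< {β} {ξ} {a} {d} {ξ′} {a′} {d′} j i val val′ j<i ej ei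

      transverse-level : ∀ {β ξ a d β′ a′} → Unique (transverse β ξ a d) (level β′ a′)
      transverse-level {β} {ξ} {a} {d} {β′} {a′} {i} {j} (ix , ξ^E , _ , d≢𝟎 , _) ix′ i≢j ei ej = ⊥-elim (decide (<-cmp i j))
        where
        collapse : ∀ {i j} → i Fin.< j → a ⊞ coef β ξ i ◃ d ≡ a′ → a ⊞ coef β ξ j ◃ d ≡ a′ → ⊥
        collapse {i} {j} i<j ei ej = coef-≢ β ξ^E i<j (◃-cancelʳ d≢𝟎 (trans (sym (◃-diff a (coef β ξ i) (coef β ξ j) d))
          (trans (cong (_⊟ (a ⊞ coef β ξ i ◃ d)) (trans ej (sym ei))) (trans (◃-diff a (coef β ξ i) (coef β ξ i) d) (cong (_◃ d) (L.-‿inverseʳ (coef β ξ i)))))))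
        decide : Tri (i Fin.< j) (i ≡ j) (j Fin.< i) → ⊥
        decide (tri< i<j _ _) = collapse i<j (cong proj₂ ei) (cong proj₂ ej)
        decide (tri≈ _ i≡j _) = i≢j i≡j
        decide (tri> _ _ j<i) = collapse j<i (cong proj₂ ej) (cong proj₂ ei)

      level-level : ∀ {β a β′ a′} → Unique (level β a) (level β′ a′)
      level-level {β} {a} {β′} {a′} ix ix′ i≢j ei ej = SameRange-refl
        (cong₂ level (proj₁ (unique ix ix′ i≢j (cong proj₁ ei) (cong proj₁ ej))) (cong proj₂ ei))

      Unique-sym : ∀ {β β′} → Unique β β′ → Unique β′ β
      Unique-sym {β} {β′} un {s} {t} {s′} {t′} val′ val s≢t es et = SameRange-sym {β} {β′} (un val val′
        (λ { refl → s≢t (injective {β′} val′ (trans es (sym et))) }) (sym es) (sym et))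

      unique-all : ∀ {β β′} → Unique β β′
      unique-all {starter w u a d} {starter w′ u′ a′ d′} = starter-starter {w} {u} {a} {d} {w′} {u′} {a′} {d′}
      unique-all {starter w u a d} {transverse β ξ a′ d′} = starter-transverse {w} {u} {a} {d} {β} {ξ} {a′} {d′}
      unique-all {starter w u a d} {level β a′} = starter-level {w} {u} {a} {d} {β} {a′}
      unique-all {transverse β ξ a d} {starter w′ u′ a′ d′} = Unique-sym {starter w′ u′ a′ d′} {transverse β ξ a d} (starter-transverse {w′} {u′} {a′} {d′} {β} {ξ} {a} {d})
      unique-all {transverse β ξ a d} {transverse β′ ξ′ a′ d′} = transverse-transverse {β} {ξ} {a} {d} {β′} {ξ′} {a′} {d′}
      unique-all {transverse β ξ a d} {level β′ a′} = transverse-level {β} {ξ} {a} {d} {β′} {a′}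
      unique-all {level β a} {starter w′ u′ a′ d′} = Unique-sym {starter w′ u′ a′ d′} {level β a} (starter-level {w′} {u′} {a′} {d′} {β} {a})
      unique-all {level β a} {transverse β′ ξ′ a′ d′} = Unique-sym {transverse β′ ξ′ a′ d′} {level β a} (transverse-level {β′} {ξ′} {a′} {d′} {β} {a})
      unique-all {level β a} {level β′ a′} = level-level {β} {a} {β′} {a′}

      move : Group.Carrier G → Pt → Pt
      move g (w , a) = w , act g a

      -- The conditions on d are only that it is nonzero and has a given value of `χ̂`, both
      -- invariant under G. Linearity of the action carries the points along.
      preserves : ∀ g {β} → Valid β → ∃[ β′ ] (Valid β′ × (∀ s → points β′ s ≡ move g (points β s)))
      preserves g {starter w u a d} (u≢0 , d≢𝟎 , χd) = starter w u (act g a) (act g d) ,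
        (u≢0 , act-≢𝟎 g d≢𝟎 , trans (χ̂-act g d≢𝟎) χd) ,
        λ s → cong (w K.+ u K.* z s ,_) (sym (trans (act-⊞ g a (b s ◃ d)) (cong (act g a ⊞_) (act-◃ g (b s) d))))
      preserves g {transverse β ξ a d} (ix , ξ^E , ∉Γ , d≢𝟎 , χd) = transverse β ξ (act g a) (act g d) ,
        (ix , ξ^E , ∉Γ , act-≢𝟎 g d≢𝟎 , trans (χ̂-act g d≢𝟎) χd) ,
        λ i → cong (block β i ,_) (sym (trans (act-⊞ g a (coef β ξ i ◃ d)) (cong (act g a ⊞_) (act-◃ g (coef β ξ i) d))))
      preserves g {level β a} ix = level β (act g a) , ix , λ i → refl

      symmetricDesign : Σ (Design (Q ℕ.* (P ℕ.^ n)) k) (λ D → EmbedsInAut G D)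
      symmetricDesign = design (λ {β} → injective {β}) cover-all (λ {β} {β′} → unique-all {β} {β′}) ,
        embeds (λ {β} → injective {β}) cover-all (λ {β} {β′} → unique-all {β} {β′}) G move
          (λ e (w , a) → cong (w ,_) (act-cong e a)) (λ (w , a) → cong (w ,_) (act-ε a)) (λ g h (w , a) → cong (w ,_) (act-∙ g h a))
          (λ g h same → act-faithful g h λ a → cong proj₂ (same (K.0# , a))) (λ g {β} → preserves g {β})

-- Choice of the two primes and conclusion.

module Parameters where
  open import Defs
  open FiniteFields
  open FieldLemmas
  open MultiplicativeGroups
  open PrimeFields
  open PrimesInProgressions
  open CyclotomicClasses
  open StarterPositions
  open DifferenceFamilies
  open Assembling
  open import Level using (Level)
  open import Data.Nat as ℕ using (ℕ; zero; suc; _≤_; _<_; s≤s; z≤n; NonZero; _!)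
  import Data.Nat.Properties as ℕₚ
  open import Data.Nat.Divisibility
  open import Data.Nat.Primality using (Prime)
  open import Data.Nat.DivMod using (_/_; _%_; m≡m%n+[m/n]*n; m%n<n)
  open import Data.Nat.Solver using (module +-*-Solver)
  open import Data.Fin as Fin using (Fin; zero; suc; inject≤; punchIn)
  open import Data.Fin.Properties using (punchIn-injective; punchInᵢ≢i; inject≤-injective)
  open import Data.Sum using (_⊎_; inj₁; inj₂)
  open import Data.Product using (Σ; _×_; _,_; ∃-syntax; Σ-syntax; proj₁; proj₂)
  open import Data.Empty using (⊥-elim)
  open import Algebra.Bundles using (Group)
  open import Relation.Nullary
  open import Relation.Binary.PropositionalEquality hiding ([_])

  module _ {p : ℕ} (pr : Prime (suc p)) (2≤p : 2 ≤ p) where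
    private
      module F = FiniteField (ResidueField.field′ (residueField pr))

    residue-2≢0 : F.1# F.+ F.1# ≢ F.0#
    residue-2≢0 e = ℕₚ.<⇒≱ (s≤s 2≤p) (∣⇒≤ ([]≡0⇒∣ (trans (sym ([]-+ 1 1)) (trans (cong₂ F._+_ [1]≡1 [1]≡1) e))))
      where open ResidueField (residueField pr)

  record Field-with-root (p : ℕ) : Set where
    field
      F    : FiniteField (suc p)
      root : MultiplicativeGroup.PrimitiveRoot F
      2≢0  : FiniteField._+_ F (FiniteField.1# F) (FiniteField.1# F) ≢ FiniteField.0# F

  primeFieldWithRoot : ∀ {p} → Prime (suc p) → 2 ≤ p → Field-with-root p
  primeFieldWithRoot {p} pr 2≤p = record
    { F = ResidueField.field′ (residueField pr)
    ; root = MultiplicativeGroup.primitiveRoot (ResidueField.field′ (residueField pr)) (ℕ.>-nonZero (ℕₚ.<-trans (s≤s z≤n) 2≤p))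
    ; 2≢0 = residue-2≢0 pr 2≤p
    }

  module Construction {c ℓ : Level} (G : Group c ℓ) (n : ℕ) (H : HasOrder G n) (r : ℕ) {{r≢0 : NonZero r}}
    {M N hQ hP : ℕ} (𝔔 : Field-with-root M) (𝔓 : Field-with-root N)
    {{M≢0 : NonZero M}} {{hQ≢0 : NonZero hQ}} {{hP≢0 : NonZero hP}} {{pairs≢0 : NonZero (pairs (size r))}}
    (M≡ : M ≡ pairs (size r) ℕ.* (hQ ℕ.* 2)) (N≡ : N ≡ (r ℕ.* M) ℕ.* (hP ℕ.* 2)) (n!∣hP : n ! ∣ hP)
    (bigQ : threshold (pairs (size r)) (size r) 1 ≤ suc M) (r≤M : r ≤ M) (room : (size r ℕ.* size r ℕ.* size r) ℕ.* 4 < M)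
    (bigP : threshold (r ℕ.* M) (size r) 1 ≤ suc N) where
    open Field-with-root 𝔔 using () renaming (F to FQ; root to rootQ; 2≢0 to 2≢0-Q)
    open Field-with-root 𝔓 using () renaming (F to FP; root to rootP; 2≢0 to 2≢0-P)

    open Starters FQ FP rootQ rootP r hP N≡ 2≢0-Q 2≢0-P

    -- Any r distinct nonzero elements serve as starter columns; `punchIn` skips zero.
    t : Fin r → Fin (suc M)
    t i = punchIn K.0# (inject≤ i r≤M)

    t-injective : ∀ {i j} → t i ≡ t j → i ≡ j
    t-injective {i} {j} e = inject≤-injective r≤M r≤M i j (punchIn-injective K.0# _ _ e)

    t≢0 : ∀ i → t i ≢ K.0#
    t≢0 i = punchInᵢ≢i K.0# (inject≤ i r≤M)

    S : Starter t t-injective t≢0 r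
    S = starter t t-injective t≢0 r ℕₚ.≤-refl room
    open Starter S
    open Complete t t-injective t≢0 S

    λ^E≡1 : ∀ u → λ′ u L.^ E ≡ L.1#
    λ^E≡1 u = Roots.^-∣ FP {λ′ u} {M} (λ^M≡1 u) (n∣m*n r)

    ≈⇒ : ∀ {s s′ σ σ′} → (pos σ , pos σ′) ≈ (pos s , pos s′) →
         (z σ ≡ z s × z σ′ ≡ z s′) × ((b σ ≡ b s × b σ′ ≡ b s′) ⊎ (b σ ≡ L.- b s × b σ′ ≡ L.- b s′))
    ≈⇒ (inj₁ (e , e′)) = (cong proj₁ e , cong proj₁ e′) , inj₁ (cong proj₂ e , cong proj₂ e′)
    ≈⇒ (inj₂ (e , e′)) = (cong proj₁ e , cong proj₁ e′) , inj₂ (cong proj₂ e , cong proj₂ e′)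

    result : Σ (Design (suc M ℕ.* (suc N ℕ.^ n)) (size r)) (λ D → EmbedsInAut G D)
    result = Assembly.symmetricDesign G n H FQ FP f E (∣m⇒∣m*n 2 n!∣hP) (λ {x} → χ^E≡1 {x}) 2≢0-P λ′ λ≢0 λ^E≡1 (λ {u} {v} → λ-* {u} {v})
      (DifferenceFamily.linearSpace FQ rootQ (size r) hQ M≡ 2≢0-Q bigQ)
      (Cyc.prescribed-differences (size r) bigP)
      z b mirror mirror-z mirror-b distinct same-col cross
      (λ {s} {s′} {σ} {σ′} ne ne′ e → ≈⇒ {s} {s′} {σ} {σ′} (class-injective {s} {s′} {σ} {σ′} ne ne′ e))
      (λ {ξ} → vertical-cover {ξ}) (λ {s} {s′} {u} {u′} → vertical-unique {s} {s′} {u} {u′})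

  odd⇒size : ∀ k → 3 ≤ k → ¬ (2 ∣ k) → Σ[ r ∈ ℕ ] (NonZero r × k ≡ size r)
  odd⇒size k 3≤k 2∤k = r , r≢0 , trans k≡ (sym (size≡ r))
    where
    r = k / 2
    k≡ : k ≡ suc (2 ℕ.* r)
    k≡ = parity (k % 2) (m%n<n k 2) (m≡m%n+[m/n]*n k 2)
      where
      parity : ∀ m → m < 2 → k ≡ m ℕ.+ r ℕ.* 2 → k ≡ suc (2 ℕ.* r)
      parity zero _ e = ⊥-elim (2∤k (divides r e))
      parity (suc zero) _ e = trans e (cong suc (ℕₚ.*-comm r 2))
      parity (suc (suc m)) (s≤s (s≤s ())) _
    r≢0 : NonZero r
    r≢0 = ℕ.≢-nonZero λ e → ℕₚ.<⇒≱ (s≤s (s≤s z≤n)) (ℕₚ.≤-trans 3≤k (ℕₚ.≤-reflexive (trans k≡ (cong (λ t → suc (2 ℕ.* t)) e))))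

  -- First Q is taken with k (k - 1) ∣ Q - 1, so that f is even for the difference family. Then p is
  -- taken with 2 r (Q - 1) n! ∣ p - 1, so that (p - 1) / E is even and a multiple of n!.
  designs : ∀ {c ℓ : Level} (G : Group c ℓ) (n : ℕ) → HasOrder G n → ∀ r → NonZero r → ∀ B →
            ∃[ v ] (B ≤ v × Σ (Design v (size r)) (λ D → EmbedsInAut G D))
  designs G n H r r≢0 B = chooseQ (∃-prime≡1mod (pairs k ℕ.* 2) boundQ)
    where
    k = size r
    instance
      _ = r≢0
      pairs≢0 : NonZero (pairs k)
      pairs≢0 = ℕ.>-nonZero (positive r r≢0)
        where
        positive : ∀ r → NonZero r → 0 < pairs (size r)
        positive (suc r) _ = s≤s z≤n
      pairs2≢0 : NonZero (pairs k ℕ.* 2)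
      pairs2≢0 = ℕₚ.m*n≢0 (pairs k) 2
      n!≢0 : NonZero (n !)
      n!≢0 = n !≢0
        where open import Data.Nat.Properties using (_!≢0)
    cube = k ℕ.* k ℕ.* k ℕ.* 4
    thresholdQ = threshold (pairs k) k 1
    -- The summands give, in turn, odd characteristic, the difference family, room for r starter
    -- columns, and the inequality needed by the greedy choice.
    boundQ = 2 ℕ.+ (thresholdQ ℕ.+ (r ℕ.+ cube))
    Goal = ∃[ v ] (B ≤ v × Σ (Design v (size r)) (λ D → EmbedsInAut G D))
    -- G contains its identity. With n > 0 the number of points Q pⁿ is at least p, so a large p
    -- makes v exceed B.
    n≢0 : NonZero n
    n≢0 = inhabited n (proj₁ (HasOrder.enum-surj H (Group.ε G)))
      where
      inhabited : ∀ n → Fin n → NonZero n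
      inhabited (suc n) _ = _

    chooseP : ∀ {M hQ} → Prime (suc M) → NonZero hQ → M ≡ pairs k ℕ.* (hQ ℕ.* 2) → boundQ < M → Goal
    chooseP {M} {hQ} prQ hQ≢0 M≡ bigM = finish (∃-prime≡1mod (r ℕ.* M ℕ.* (n ! ℕ.* 2)) (2 ℕ.+ (threshold (r ℕ.* M) k 1 ℕ.+ B)))
      where
      instance
        _ = hQ≢0
        M≢0 : NonZero M
        M≢0 = ℕ.>-nonZero (ℕₚ.≤-<-trans z≤n bigM)
        rM≢0 : NonZero (r ℕ.* M)
        rM≢0 = ℕₚ.m*n≢0 r M
        n!2≢0 : NonZero (n ! ℕ.* 2)
        n!2≢0 = ℕₚ.m*n≢0 (n !) 2
        modulus≢0 : NonZero (r ℕ.* M ℕ.* (n ! ℕ.* 2))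
        modulus≢0 = ℕₚ.m*n≢0 (r ℕ.* M) (n ! ℕ.* 2)
      part : ∀ {m} → m ≤ thresholdQ ℕ.+ (r ℕ.+ cube) → m < M
      part h = ℕₚ.≤-<-trans (ℕₚ.≤-trans h (ℕₚ.m≤n+m _ 2)) bigM
      finish : Σ[ N ∈ ℕ ] (Prime (suc N) × r ℕ.* M ℕ.* (n ! ℕ.* 2) ∣ N × 2 ℕ.+ (threshold (r ℕ.* M) k 1 ℕ.+ B) < N) → Goal
      finish (N , prP , divides h N≡ , bigN) = suc M ℕ.* (suc N ℕ.^ n) , B≤v ,
        Construction.result G n H r {M} {N} {hQ} {h ℕ.* n !} (primeFieldWithRoot prQ (ℕₚ.≤-trans (ℕₚ.m≤m+n 2 _) (ℕₚ.<⇒≤ bigM)))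
          (primeFieldWithRoot prP (ℕₚ.≤-trans (ℕₚ.m≤m+n 2 _) (ℕₚ.<⇒≤ bigN)))
          M≡ (trans N≡ (solve 4 (λ h r M m → h :* (r :* M :* (m :* con 2)) := r :* M :* (h :* m :* con 2)) refl h r M (n !)))
          (n∣m*n h)
          (ℕₚ.≤-trans (ℕₚ.<⇒≤ (part (ℕₚ.m≤m+n thresholdQ _))) (ℕₚ.n≤1+n M))
          (ℕₚ.<⇒≤ (part (ℕₚ.≤-trans (ℕₚ.m≤m+n r cube) (ℕₚ.m≤n+m (r ℕ.+ cube) thresholdQ))))
          (part (ℕₚ.≤-trans (ℕₚ.m≤n+m cube r) (ℕₚ.m≤n+m (r ℕ.+ cube) thresholdQ)))
          (ℕₚ.≤-trans (ℕₚ.≤-trans (ℕₚ.m≤m+n (threshold (r ℕ.* M) k 1) B) (ℕₚ.m≤n+m _ 2)) (ℕₚ.≤-trans (ℕₚ.<⇒≤ bigN) (ℕₚ.n≤1+n N)))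
        where
        open +-*-Solver
        instance
          h≢0 : NonZero h
          h≢0 = ℕₚ.m*n≢0⇒m≢0 h {{subst NonZero N≡ (ℕ.>-nonZero (ℕₚ.≤-<-trans z≤n bigN))}}
          hn!≢0 : NonZero (h ℕ.* n !)
          hn!≢0 = ℕₚ.m*n≢0 h (n !)
        B≤v : B ≤ suc M ℕ.* (suc N ℕ.^ n)
        B≤v = ℕₚ.≤-trans (ℕₚ.≤-trans (ℕₚ.m≤n+m B (threshold (r ℕ.* M) k 1)) (ℕₚ.m≤n+m _ 2)) (ℕₚ.≤-trans (ℕₚ.<⇒≤ bigN)
          (ℕₚ.≤-trans (ℕₚ.n≤1+n N) (ℕₚ.≤-trans (base≤power n n≢0) (ℕₚ.m≤n*m (suc N ℕ.^ n) (suc M)))))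
          where
          base≤power : ∀ n → NonZero n → suc N ≤ suc N ℕ.^ n
          base≤power (suc n) _ = ℕₚ.m≤m*n (suc N) (suc N ℕ.^ n) {{ℕₚ.m^n≢0 (suc N) n}}

    chooseQ : Σ[ M ∈ ℕ ] (Prime (suc M) × pairs k ℕ.* 2 ∣ M × boundQ < M) → Goal
    chooseQ (M , prQ , divides h M≡ , big) = chooseP {M} {h} prQ
      (ℕₚ.m*n≢0⇒m≢0 h {{subst NonZero M≡ (ℕ.>-nonZero (ℕₚ.≤-<-trans z≤n big))}})
      (trans M≡ (solve 2 (λ h m → h :* (m :* con 2) := m :* (h :* con 2)) refl h (pairs k))) big
      where open +-*-Solver

open Parameters
open import Defs
open import Level using (Level)
open import Data.Nat using (ℕ; _≤_)
open import Data.Nat.Divisibility using (_∣_)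
open import Data.Nat.GCD using (gcd)
open import Data.Product using (Σ; ∃-syntax; _×_; _,_)
open import Relation.Binary.PropositionalEquality using (_≡_; refl)
open import Relation.Nullary using (¬_)
open import Algebra.Bundles using (Group)

theorem1p2 : ∀ {c ℓ : Level} (k : ℕ) → 3 ≤ k → ¬ (2 ∣ k) →
    (G : Group c ℓ) (n : ℕ) → HasOrder G n → 2 ∣ n → gcd k n ≡ 1 →
    ∀ (N : ℕ) → ∃[ v ] (N ≤ v × Σ (Design v k) (λ D → EmbedsInAut G D))
theorem1p2 k 3≤k 2∤k G n H _ _ N with odd⇒size k 3≤k 2∤k
... | r , r≢0 , refl = designs G n H r r≢0 N
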